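{- For every integer $n\ge 1$ the following identities hold: (i) $\tau(n) = \frac{5}{12} n\sigma_{3}(n) + \frac{7}{12} n\sigma_5(n) +70 \sum_{m=1}^{n-1}(2n-5m)\sigma_3(m)\sigma_5(n-m)$; (ii) $\tau(n) = n^2\sigma_{3}(n) + 60 \sum_{m=1}^{n-1}(4n^2-13mn+9m^2)\sigma_3(m)\sigma_3(n-m)$; (iii) $\tau(n) = \frac{65}{756} \sigma_{11}(n) + \frac{5\cdot691}{12\cdot 756\, n} \sigma_7(n) + \frac{691}{12\cdot 108\, n} \sigma_5(n) - \frac{5\cdot 691}{54 n^2} \sum_{m=1}^{n-1}(3n - 7m)\sigma_5(m)\sigma_7(n-m) -\frac{13\cdot 691}{9 n^2}\sum_{m=1}^{n-1}m(n-m)\sigma_5(m)\sigma_5(n-m)$; (iv) $\tau(n) = \frac{65}{756} \sigma_{11}(n) + \frac{3\cdot691}{8\cdot441} \sigma_3(n) + \frac{5\cdot 691}{24\cdot441} \sigma_7(n) + \frac{5\cdot 691}{441 n^2} \sum_{m=1}^{n-1}(91m^2 - 65 mn + 10n^2) \sigma_3(m)\sigma_7(n-m) -\frac{13\cdot 691}{9 n^2}\sum_{m=1}^{n-1}m(n-m)\sigma_5(m)\sigma_5(n-m)$; (v) $\tau(n) = \frac{65}{756} \sigma_{11}(n) + \frac{25\cdot691}{36\cdot 756\, n} \sigma_3(n) + \frac{11\cdot691}{36\cdot 756\, n} \sigma_9(n) - \frac{55\cdot 691}{1134 n^2} \sum_{m=1}^{n-1}(7m-2n)\sigma_3(m)\sigma_9(n-m)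 -\frac{13\cdot 691}{9 n^2}\sum_{m=1}^{n-1}m(n-m)\sigma_5(m)\sigma_5(n-m)$.
   Context: $\tau(n)$ is Ramanujan's tau function, defined by $q\prod_{n\ge 1}(1-q^n)^{24} = \sum_{n\ge 1}\tau(n)q^n$. For $k\ge 1$, $\sigma_k(n)=\sum_{d\mid n} d^k$ (sum over positive divisors of $n$). For $n=1$ the sum $\sum_{m=1}^{n-1}$ is empty and equals $0$. -}

module Defs where

open import Data.Bool.Base using (if_then_else_)
open import Data.Integer.Base as ℤ using (ℤ; +_; 0ℤ; 1ℤ)
import Data.Integer.Properties as ℤ
open import Data.List.Base using (List; map; filter; foldr; applyUpTo)
open import Data.Nat.Base as ℕ using (ℕ; zero; suc; _≤_; _<_; _∸_; _^_; _≡ᵇ_; z≤n; s≤s; _≤′_; ≤′-refl; ≤′-step)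
open import Data.Nat.Divisibility using (_∣?_)
open import Data.Nat.ListAction using (sum)
import Data.Nat.Properties as ℕ
open import Data.Rational.Base as ℚ using (ℚ; 0ℚ)
open import Data.Rational.Literals using (fromℤ)
open import Relation.Binary.PropositionalEquality

divisors : ℕ → List ℕ
divisors n = filter (_∣? n) (applyUpTo suc n)

σ : ℕ → ℕ → ℕ
σ k n = sum (map (_^ k) (divisors n))

-- Formal power series over ℤ, given by their coefficients.
Series : Set
Series = ℕ → ℤ

sumℤ : List ℤ → ℤ
sumℤ = foldr ℤ._+_ 0ℤ

infixl 7 _⊛_
infixl 6 _⊖_
infixr 8 _⊛^_

q^_ : ℕ → Series
(q^ j) i = if i ≡ᵇ j then 1ℤ else 0ℤ

_⊖_ : Series → Series → Series
(f ⊖ g) i = f i ℤ.- g i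

_⊛_ : Series → Series → Series
(f ⊛ g) n = sumℤ (applyUpTo (λ k → f k ℤ.* g (n ∸ k)) (suc n))

_⊛^_ : Series → ℕ → Series
f ⊛^ zero  = q^ 0
f ⊛^ suc e = f ⊛ (f ⊛^ e)

-- ∏_{j=1}^{N} F j
partialProduct : (ℕ → Series) → ℕ → Series
partialProduct F zero    = q^ 0
partialProduct F (suc N) = F (suc N) ⊛ partialProduct F N

-- ∏_{j≥1} F j, for F with F j ≡ 1 modulo q^j: the factors with j > n do not
-- affect the coefficient of q^n, so that coefficient is read off from
-- ∏_{j=1}^{n} F j.  See ∏-stable for the family used below.
∏ : (ℕ → Series) → Series
∏ F n = partialProduct F n n

-- (1 - q^j)^e
factor : ℕ → ℕ → Series
factor e j = (q^ 0 ⊖ q^ j) ⊛^ e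

τ : ℕ → ℤ
τ = q^ 1 ⊛ ∏ (factor 24)

ι : ℕ → ℚ
ι n = fromℤ (+ n)

infixl 7 _÷ℕ_

_÷ℕ_ : ℚ → (d : ℕ) .{{_ : ℕ.NonZero d}} → ℚ
p ÷ℕ d = p ℚ.* (1ℤ ℚ./ d)

infix 8 ∑₁

∑₁ : ℕ → (ℕ → ℚ) → ℚ
∑₁ n f = foldr ℚ._+_ 0ℚ (applyUpTo (λ i → f (suc i)) (n ∸ 1))

syntax ∑₁ n (λ m → e) = ∑[1≤ m < n ] e

private
  sumℤ-zero : ∀ (f : ℕ → ℤ) n → (∀ i → i < n → f i ≡ 0ℤ) → sumℤ (applyUpTo f n) ≡ 0ℤ
  sumℤ-zero f zero    f≡0 = refl
  sumℤ-zero f (suc n) f≡0 = cong₂ ℤ._+_ (f≡0 0 (s≤s z≤n))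
    (sumℤ-zero (λ i → f (suc i)) n λ i i<n → f≡0 (suc i) (s≤s i<n))

  -- f ≡ 1 modulo q^(N+1)
  record OneUpTo (N : ℕ) (f : Series) : Set where
    field
      head≡1 : f 0 ≡ 1ℤ
      tail≡0 : ∀ i → i < N → f (suc i) ≡ 0ℤ
  open OneUpTo

  ⊛-identityˡ : ∀ {N f} → OneUpTo N f → ∀ g n → n ≤ N → (f ⊛ g) n ≡ g n
  ⊛-identityˡ {f = f} h g n n≤N = begin
    f 0 ℤ.* g n ℤ.+ sumℤ (applyUpTo (λ k → f (suc k) ℤ.* g (n ∸ suc k)) n)
      ≡⟨ cong₂ (λ x y → x ℤ.* g n ℤ.+ y) (head≡1 h) (sumℤ-zero _ n λ i i<n →
           cong (ℤ._* g (n ∸ suc i)) (tail≡0 h i (ℕ.<-≤-trans i<n n≤N))) ⟩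
    1ℤ ℤ.* g n ℤ.+ 0ℤ  ≡⟨ ℤ.+-identityʳ _ ⟩
    1ℤ ℤ.* g n         ≡⟨ ℤ.*-identityˡ _ ⟩
    g n                ∎
    where open ≡-Reasoning

  ⊛^-one : ∀ {N f} → OneUpTo N f → ∀ e → OneUpTo N (f ⊛^ e)
  ⊛^-one h zero    = record { head≡1 = refl ; tail≡0 = λ _ _ → refl }
  ⊛^-one {f = f} h (suc e) = record
    { head≡1 = trans (⊛-identityˡ h (f ⊛^ e) 0 z≤n) (head≡1 (⊛^-one h e))
    ; tail≡0 = λ i i<N → trans (⊛-identityˡ h (f ⊛^ e) (suc i) i<N) (tail≡0 (⊛^-one h e) i i<N)
    }

  q^-zero : ∀ i j → i < j → (q^ j) i ≡ 0ℤ
  q^-zero zero    (suc j) _         = refl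
  q^-zero (suc i) (suc j) (s≤s i<j) = q^-zero i j i<j

  base-one : ∀ N → OneUpTo N (q^ 0 ⊖ q^ suc N)
  base-one N = record
    { head≡1 = refl ; tail≡0 = λ i i<N → cong (λ x → 0ℤ ℤ.- x) (q^-zero i N i<N) }

  factor-one : ∀ e N → OneUpTo N (factor e (suc N))
  factor-one e N = ⊛^-one (base-one N) e

  stable : ∀ (F : ℕ → Series) → (∀ N → OneUpTo N (F (suc N))) →
           ∀ {n N} → n ≤′ N → partialProduct F N n ≡ ∏ F n
  stable F h     ≤′-refl             = refl
  stable F h {n} (≤′-step {n = N} p) =
    trans (⊛-identityˡ (h N) (partialProduct F N) n (ℕ.≤′⇒≤ p)) (stable F h p)

∏-stable : ∀ e {n N} → n ≤ N → partialProduct (factor e) N n ≡ ∏ (factor e) n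
∏-stable e n≤N = stable (factor e) (factor-one e) (ℕ.≤⇒≤′ n≤N)

{-# OPTIONS --safe #-}
module Submission where

-- Write P = 1 - 24 ∑ σ₁ q^n, Q = 1 + 240 ∑ σ₃ q^n, R = 1 - 504 ∑ σ₅ q^n and
-- D = q d/dq.  For a polynomial H invariant under permuting and negating the
-- triple (a , b , - a - b), the substitution (a , b , x , y) ↦ (a , a + b , x - y , y)
-- on the solutions of a x + b y = n evaluates ∑ (H a b - H a (- b)) as a divisor
-- sum (Liouville, Skoruppa).  The invariants u = a² + a b + b² and
-- v = (a b (a + b))² in the combinations u, u², 2 u³ - 7 v, v, u v, u² v give
-- Ramanujan's system
--   12 D P = P² - Q,  3 D Q = P Q - R,  2 D R = P R - Q²
-- and E₈ = Q², E₁₀ = Q R, 691 E₁₂ = 441 Q³ + 250 R².  Both Q³ - R² and, by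
-- logarithmic differentiation of the product, ∑ τ q^n solve D f = P f, which
-- determines f up to a constant factor; hence Q³ - R² = 1728 ∑ τ q^n.  The identities
-- (i) and (ii) are then the Rankin–Cohen brackets [Q , R]₁ and [Q , Q]₂; for the
-- others D² is applied to the relation for E₁₂, and the multiple of Q ∑ τ q^n
-- left over is written as a bracket of weight 16.

-- No theory of modular forms enters: each fact usually drawn from the dimension of a space of forms
-- becomes a polynomial identity with explicit multipliers. The invariants differ in their value at
-- (d , - d), where u = d² and v = 0. The first three contain a pure power of u and leave a term n
-- σ(n), which becomes the derivative in Ramanujan's system. The multiples of v leave none, so the
-- relations for E₈, E₁₀ and E₁₂ are free of P. Series are compared modulo q^(N+1), where N is the
-- index at which the final identity is read off. The infinite product and the Lambert series are
-- then finite, with one bound for all the coefficients involved. The division by n² in (iii)-(v)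
-- comes from reaching τ through the coefficient of D² τ. In the relation for E₁₂ the cube Q³ is
-- traded for τ and R² is kept, since D² (R²) yields the σ₅σ₅ sum common to the three identities. It
-- also yields R D² R, which the bracket [R , R]₂ turns into the multiple of Q τ. Up to the last
-- step everything is integral: division is replaced by cancelling positive integers.

open import Defs
open import Algebra.Bundles using (CommutativeRing)
import Algebra.Solver.Ring as RingSolver
open import Algebra.Solver.Ring.AlmostCommutativeRing
  using (fromCommutativeRing; _-Raw-AlmostCommutative⟶_; -raw-almostCommutative⟶)
open import Data.Bool.Base using (T; if_then_else_)
open import Data.Empty using (⊥-elim)
open import Data.Fin.Base using (zero; suc)
open import Data.Integer.Base as ℤ using (ℤ; 0ℤ; 1ℤ)
import Data.Integer.Properties as ℤ
open import Data.Integer.Tactic.RingSolver using (solve-∀)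
open import Data.List.Base using (List; []; _∷_; map; filter; foldr; applyUpTo)
open import Data.Maybe using (Maybe; just; nothing; is-just; to-witness-T)
open import Data.Nat.Base as ℕ using (ℕ; zero; suc; _≤_; _<_; _∸_; z≤n; s≤s)
open import Data.Nat.Divisibility using (_∣_; _∣?_; divides; ∣⇒≤)
open import Data.Nat.Induction using (<-rec)
open import Data.Nat.ListAction using (sum)
import Data.Nat.Properties as ℕ
import Data.Nat.Tactic.RingSolver as ℕ-Solver
open import Data.Product.Base using (_×_; _,_; proj₁; proj₂)
open import Data.Rational.Base as ℚ using (ℚ; 0ℚ; 1ℚ; toℚᵘ)
open import Data.Rational.Literals using (fromℤ)
import Data.Rational.Properties as ℚ
open import Data.Rational.Unnormalised.Base using (mkℚᵘ; *≡*)
import Data.Rational.Unnormalised.Properties as ℚᵘ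
open import Data.Vec.Base using ([]; _∷_)
open import Data.Vec.N-ary using (N-ary; Eq; curryⁿ; curryⁿ-cong)
open import Function.Base using (_∘_)
open import Level using (0ℓ)
open import Relation.Binary.PropositionalEquality as ≡ using (_≡_; cong; cong₂; module ≡-Reasoning)
import Relation.Binary.Reasoning.Setoid as SetoidReasoning
import Relation.Binary.Reflection as Reflection
open import Relation.Nullary using (¬_; Dec; yes; no; does)

-- The solver of the library compares the values of the two normal forms by
-- conversion, which is infeasible in high degree; here the normal forms
-- themselves are compared, a closed computation.
module IntegerCoefficients {c ℓ} (R : CommutativeRing c ℓ)
  (hom : CommutativeRing.rawRing ℤ.+-*-commutativeRing -Raw-AlmostCommutative⟶ fromCommutativeRing R)
  where

  open CommutativeRing R
  open _-Raw-AlmostCommutative⟶_ hom renaming (⟦_⟧ to ⟦_⟧ℤ)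

  private
    _coeff≟_ : ∀ a b → Maybe (⟦ a ⟧ℤ ≈ ⟦ b ⟧ℤ)
    a coeff≟ b with a ℤ.≟ b
    ... | yes a≡b = just (reflexive (≡.cong ⟦_⟧ℤ a≡b))
    ... | no  _   = nothing

  open RingSolver _ _ hom _coeff≟_ public
    using (Polynomial; var; con; _:+_; _:*_; _:-_; :-_; _:^_; _:=_; ⟦_⟧)
  open RingSolver _ _ hom _coeff≟_ using (normalise; _≟N_; ⟦_⟧↓; ⟦_⟧N-cong; correct)
  open Reflection setoid var ⟦_⟧ ⟦_⟧↓ correct using (close; prove)

  -- On closed polynomials this computes to the unit type when the normal forms agree, so an
  -- implicit argument of this type is filled by evaluation alone.
  Valid : ∀ {n} → Polynomial n × Polynomial n → Set
  Valid (e₁ , e₂) = T (is-just (normalise e₁ ≟N normalise e₂))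

  sound : ∀ {n} (e : Polynomial n × Polynomial n) → Valid e → ∀ ρ → ⟦ proj₁ e ⟧ ρ ≈ ⟦ proj₂ e ⟧ ρ
  sound (e₁ , e₂) valid ρ = prove ρ e₁ e₂ (⟦ to-witness-T (normalise e₁ ≟N normalise e₂) valid ⟧N-cong ρ)

  solve : ∀ n (f : N-ary n (Polynomial n) (Polynomial n × Polynomial n)) {_ : Valid (close n f)} →
    Eq n _≈_ (curryⁿ ⟦ proj₁ (close n f) ⟧) (curryⁿ ⟦ proj₂ (close n f) ⟧)
  solve n f {valid} = curryⁿ-cong _≈_ ⟦ proj₁ (close n f) ⟧ ⟦ proj₂ (close n f) ⟧ (sound (close n f) valid)

  -- To derive x ≈ y from equations lᵢ ≈ rᵢ: `solve` x ≈ y + ∑ aᵢ (lᵢ - rᵢ) and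
  -- drop the summands.
  drop : ∀ {l r} → l ≈ r → ∀ {z} a → z + a * (l - r) ≈ z
  drop {l} {r} l≈r {z} a = trans
    (+-congˡ (trans (*-congˡ (trans (+-congˡ (-‿cong (sym l≈r))) (-‿inverseʳ l))) (zeroʳ a)))
    (+-identityʳ z)

-- Rearrangements of finite sums of integers

module FiniteSums where

  open import Data.Integer.Base using (_+_; _*_; _-_; -_)
  open ≡ using (refl; sym; trans)
  open ≡-Reasoning

  ∑ : ℕ → (ℕ → ℤ) → ℤ
  ∑ n f = sumℤ (applyUpTo f n)

  ∑-cong-< : ∀ n {f g : ℕ → ℤ} → (∀ i → i < n → f i ≡ g i) → ∑ n f ≡ ∑ n g
  ∑-cong-< zero    eq = refl
  ∑-cong-< (suc n) eq = cong₂ _+_ (eq 0 (s≤s z≤n)) (∑-cong-< n λ i i<n → eq (suc i) (s≤s i<n))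

  ∑-cong : ∀ n {f g : ℕ → ℤ} → (∀ i → f i ≡ g i) → ∑ n f ≡ ∑ n g
  ∑-cong n eq = ∑-cong-< n λ i _ → eq i

  ∑-zero : ∀ n {f} → (∀ i → i < n → f i ≡ 0ℤ) → ∑ n f ≡ 0ℤ
  ∑-zero zero    eq = refl
  ∑-zero (suc n) eq = cong₂ _+_ (eq 0 (s≤s z≤n)) (∑-zero n λ i i<n → eq (suc i) (s≤s i<n))

  interchange : ∀ a b c d → (a + b) + (c + d) ≡ (a + c) + (b + d)
  interchange = solve-∀

  ∑-distrib-+ : ∀ n (f g : ℕ → ℤ) → ∑ n (λ i → f i + g i) ≡ ∑ n f + ∑ n g
  ∑-distrib-+ zero    f g = refl
  ∑-distrib-+ (suc n) f g = trans (cong (f 0 + g 0 +_) (∑-distrib-+ n (f ∘ suc) (g ∘ suc)))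
    (interchange (f 0) (g 0) (∑ n (f ∘ suc)) (∑ n (g ∘ suc)))

  ∑-distribˡ-* : ∀ n c (f : ℕ → ℤ) → ∑ n (λ i → c * f i) ≡ c * ∑ n f
  ∑-distribˡ-* zero    c f = sym (ℤ.*-zeroʳ c)
  ∑-distribˡ-* (suc n) c f = trans (cong (c * f 0 +_) (∑-distribˡ-* n c (f ∘ suc)))
    (sym (ℤ.*-distribˡ-+ c (f 0) (∑ n (f ∘ suc))))

  ∑-distribʳ-* : ∀ n c (f : ℕ → ℤ) → ∑ n (λ i → f i * c) ≡ ∑ n f * c
  ∑-distribʳ-* n c f = trans (∑-cong n λ i → ℤ.*-comm (f i) c)
    (trans (∑-distribˡ-* n c f) (ℤ.*-comm c _))

  ∑-swap : ∀ m n (f : ℕ → ℕ → ℤ) →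
           ∑ m (λ i → ∑ n (λ j → f i j)) ≡ ∑ n (λ j → ∑ m (λ i → f i j))
  ∑-swap zero    n f = sym (∑-zero n λ _ _ → refl)
  ∑-swap (suc m) n f = trans (cong (∑ n (f 0) +_) (∑-swap m n (f ∘ suc)))
    (sym (∑-distrib-+ n (f 0) (λ j → ∑ m (λ i → f (suc i) j))))

  ∑-last : ∀ n f → ∑ (suc n) f ≡ ∑ n f + f n
  ∑-last zero    f = ℤ.+-comm (f 0) 0ℤ
  ∑-last (suc n) f = trans (cong (f 0 +_) (∑-last n (f ∘ suc)))
      (sym (ℤ.+-assoc (f 0) (∑ n (f ∘ suc)) (f (suc n))))

  ∑-last-zero : ∀ n f → f n ≡ 0ℤ → ∑ (suc n) f ≡ ∑ n f
  ∑-last-zero n f fn≡0 = trans (∑-last n f) (trans (cong (∑ n f +_) fn≡0) (ℤ.+-identityʳ _))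

  -- Trichotomy x = y, x > y, x < y, with the difference k + 1 as new variable. As `g` vanishes
  -- outside the square, k and the smaller coordinate may both run up to N independently: the pairs
  -- this adds contribute 0.
  ∑-square : ∀ N (g : ℕ → ℕ → ℤ) →
    (∀ x y → N ≤ x → g x y ≡ 0ℤ) → (∀ x y → N ≤ y → g x y ≡ 0ℤ) →
    ∑ N (λ x → ∑ N (λ y → g x y)) ≡
      ∑ N (λ x → g x x) + ∑ N (λ k → ∑ N (λ y → g (suc (k ℕ.+ y)) y))
                        + ∑ N (λ k → ∑ N (λ x → g x (suc (k ℕ.+ x))))
  ∑-square zero    g _  _  = refl
  ∑-square (suc N) g zˡ zʳ = begin
    (g 0 0 + row) + ∑ N (λ x → g (suc x) 0 + ∑ N (λ y → g (suc x) (suc y)))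
      ≡⟨ cong (g 0 0 + row +_) (∑-distrib-+ N (λ x → g (suc x) 0) (λ x → ∑ N (λ y → g (suc x) (suc y)))) ⟩
    (g 0 0 + row) + (col + ∑ N (λ x → ∑ N (λ y → g (suc x) (suc y))))
      ≡⟨ cong (λ s → (g 0 0 + row) + (col + s)) (∑-square N (λ x y → g (suc x) (suc y))
           (λ x y N≤x → zˡ (suc x) (suc y) (s≤s N≤x)) (λ x y N≤y → zʳ (suc x) (suc y) (s≤s N≤y))) ⟩
    (g 0 0 + row) + (col + (diag + lower + upper))
      ≡⟨ rearrange (g 0 0) row col diag lower upper ⟩
    (g 0 0 + diag) + (col + lower) + (row + upper)
      ≡⟨ cong₂ (λ s t → (g 0 0 + diag) + s + t) (sym lower-eq) (sym upper-eq) ⟩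
    _ ∎
    where
    row = ∑ N (λ y → g 0 (suc y))
    col = ∑ N (λ x → g (suc x) 0)
    diag = ∑ N (λ x → g (suc x) (suc x))
    lower = ∑ N (λ k → ∑ N (λ y → g (suc (suc (k ℕ.+ y))) (suc y)))
    upper = ∑ N (λ k → ∑ N (λ x → g (suc x) (suc (suc (k ℕ.+ x)))))

    rearrange : ∀ a r c d l u → (a + r) + (c + (d + l + u)) ≡ (a + d) + (c + l) + (r + u)
    rearrange = solve-∀

    peel : ∀ (h : ℕ → ℕ → ℤ) → (∀ x y → N ≤ x → h x y ≡ 0ℤ) →
      ∑ (suc N) (λ k → ∑ (suc N) (λ y → h (k ℕ.+ y) y)) ≡
      ∑ N (λ k → h k 0) + ∑ N (λ k → ∑ N (λ y → h (suc (k ℕ.+ y)) (suc y)))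
    peel h z = begin
      ∑ (suc N) (λ k → ∑ (suc N) (λ y → h (k ℕ.+ y) y))
        ≡⟨ ∑-last-zero N _ (∑-zero (suc N) λ y _ → z _ y (ℕ.m≤m+n N y)) ⟩
      ∑ N (λ k → ∑ (suc N) (λ y → h (k ℕ.+ y) y))
        ≡⟨ ∑-cong N (λ k → cong₂ _+_ (cong (λ i → h i 0) (ℕ.+-identityʳ k))
             (∑-cong N λ y → cong (λ i → h i (suc y)) (ℕ.+-suc k y))) ⟩
      ∑ N (λ k → h k 0 + ∑ N (λ y → h (suc (k ℕ.+ y)) (suc y)))
        ≡⟨ ∑-distrib-+ N (λ k → h k 0) (λ k → ∑ N (λ y → h (suc (k ℕ.+ y)) (suc y))) ⟩
      _ ∎

    lower-eq : ∑ (suc N) (λ k → ∑ (suc N) (λ y → g (suc (k ℕ.+ y)) y)) ≡ col + lower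
    lower-eq = peel (λ x y → g (suc x) y) λ x y N≤x → zˡ (suc x) y (s≤s N≤x)

    upper-eq : ∑ (suc N) (λ k → ∑ (suc N) (λ x → g x (suc (k ℕ.+ x)))) ≡ row + upper
    upper-eq = peel (λ y x → g x (suc y)) λ y x N≤y → zʳ x (suc y) (s≤s N≤y)

  -- The new index is d = a + b + 1. With a + 1 and b + 1 as the actual summation variables, their
  -- sum is d + 1, and d = 0 gives the empty sum.
  ∑-antidiagonal : ∀ N (g : ℕ → ℕ → ℤ) → (∀ a b → N ≤ suc (a ℕ.+ b) → g a b ≡ 0ℤ) →
    ∑ N (λ a → ∑ N (λ b → g a b)) ≡ ∑ N (λ d → ∑ d (λ a → g a (d ∸ suc a)))
  ∑-antidiagonal zero    g z = refl
  ∑-antidiagonal (suc M) g z = begin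
    ∑ (suc M) (g 0) + ∑ M (λ a → ∑ (suc M) (g (suc a)))
      ≡⟨ cong₂ _+_ (∑-last-zero M _ (z 0 M ℕ.≤-refl))
           (∑-cong M λ a → ∑-last-zero M _ (z (suc a) M (s≤s (ℕ.m≤n+m M (suc a))))) ⟩
    ∑ M (g 0) + ∑ M (λ a → ∑ M (g (suc a)))
      ≡⟨ cong (∑ M (g 0) +_) (∑-antidiagonal M (g ∘ suc) λ a b M≤ → z (suc a) b (s≤s M≤)) ⟩
    ∑ M (g 0) + ∑ M (λ d → ∑ d (λ a → g (suc a) (d ∸ suc a)))
      ≡⟨ ∑-distrib-+ M (g 0) (λ d → ∑ d (λ a → g (suc a) (d ∸ suc a))) ⟨
    ∑ M (λ d → g 0 d + ∑ d (λ a → g (suc a) (d ∸ suc a)))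
      ≡⟨ ℤ.+-identityˡ _ ⟨
    _ ∎

  ∑-telescope : ∀ n (F : ℕ → ℤ) → ∑ n (λ i → F (suc i) - F i) ≡ F n - F 0
  ∑-telescope zero    F = sym (ℤ.+-inverseʳ (F 0))
  ∑-telescope (suc n) F = trans (cong (F 1 - F 0 +_) (∑-telescope n (F ∘ suc)))
    (cancel (F 0) (F 1) (F (suc n)))
    where
    cancel : ∀ a b c → (b - a) + (c - b) ≡ c - a
    cancel = solve-∀

-- Liouville's identity for the solutions of a x + b y = n

module LiouvilleIdentity where

  open import Data.Integer.Base using (_+_; _*_; _-_; -_)
  open ≡ using (refl; sym; trans; subst)
  open ≡-Reasoning
  open FiniteSums

  ∑⁺ : ℕ → (ℕ → ℤ) → ℤ
  ∑⁺ N f = ∑ N (λ i → f (suc i))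

  q^-below : ∀ {i j} → i < j → (q^ j) i ≡ 0ℤ
  q^-below {zero}  {suc j} _         = refl
  q^-below {suc i} {suc j} (s≤s i<j) = q^-below i<j

  module _ (n : ℕ) where

    -- the number of (x , y) with x , y ≥ 1 and a x + b y ≡ n
    reps : ℕ → ℕ → ℤ
    reps a b = ∑⁺ n λ x → ∑⁺ n λ y → (q^ (a ℕ.* x ℕ.+ b ℕ.* y)) n

    private
      -- Every variable of a solution with positive entries is at most n, so the sums cut off at n
      -- lose no solution.
      big : ∀ {a x r} → n < x → n < suc a ℕ.* x ℕ.+ r
      big {a} {x} {r} n<x = ℕ.<-≤-trans n<x (ℕ.≤-trans (ℕ.m≤m+n x (a ℕ.* x)) (ℕ.m≤m+n _ r))

      big₂ : ∀ {a x r} → n < suc a → n < suc a ℕ.* suc x ℕ.+ r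
      big₂ {a} {x} {r} n<a = ℕ.<-≤-trans n<a (ℕ.≤-trans (ℕ.m≤m*n (suc a) (suc x)) (ℕ.m≤m+n _ r))

      -- the part x > y of reps a b, after the substitution x = k + y
      above : ℕ → ℕ → ℤ
      above a b = ∑⁺ n λ k → ∑⁺ n λ y → (q^ (a ℕ.* k ℕ.+ (a ℕ.+ b) ℕ.* y)) n

      level : ℕ → ℤ
      level d = ∑⁺ n λ x → (q^ (d ℕ.* x)) n

      coeff : ∀ {i j} → i ≡ j → (q^ i) n ≡ (q^ j) n
      coeff = cong λ i → (q^ i) n

    -- The cases x = y, x > y and x < y: on the diagonal the equation is (a + b) x = n, and
    -- exchanging the roles of (a , x) and (b , y) carries the third case into the second.
    reps-split : ∀ a b → reps (suc a) (suc b) ≡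
      level (suc a ℕ.+ suc b) + above (suc a) (suc b) + above (suc b) (suc a)
    reps-split a b = begin
      reps (suc a) (suc b)
        ≡⟨ ∑-square n (λ x y → (q^ (suc a ℕ.* suc x ℕ.+ suc b ℕ.* suc y)) n)
             (λ x y n≤x → q^-below (big {a} {suc x} (s≤s n≤x)))
             (λ x y n≤y → trans (coeff (ℕ.+-comm (suc a ℕ.* suc x) _)) (q^-below (big {b} {suc y} (s≤s n≤y)))) ⟩
      _ ≡⟨ cong₂ _+_ (cong₂ _+_
             (∑-cong n λ x → coeff (sym (ℕ.*-distribʳ-+ (suc x) (suc a) (suc b))))
             (∑-cong n λ k → ∑-cong n λ y → coeff (shift (suc a) (suc b) k y)))
             (∑-cong n λ k → ∑-cong n λ x → coeff
                 (trans (ℕ.+-comm (suc a ℕ.* suc x) _) (shift (suc b) (suc a) k x))) ⟩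
      _ ∎
      where
      shift : ∀ a b k y → a ℕ.* (2 ℕ.+ (k ℕ.+ y)) ℕ.+ b ℕ.* suc y ≡ a ℕ.* suc k ℕ.+ (a ℕ.+ b) ℕ.* suc y
      shift = ℕ-Solver.solve-∀

    reps-sym : ∀ a b → reps a b ≡ reps b a
    reps-sym a b = trans (∑-swap n n _)
      (∑-cong n λ y → ∑-cong n λ x → coeff (ℕ.+-comm (a ℕ.* suc x) (b ℕ.* suc y)))

    reps-above : ∀ a b → n ≤ a → reps (suc a) b ≡ 0ℤ
    reps-above a b n≤a = ∑-zero n λ x _ → ∑-zero n λ y _ → q^-below (big₂ {a} {x} (s≤s n≤a))

    -- Put z = x + y: there are z - 1 ways to write z as a sum of two positive integers.
    reps-diagonal : ∀ a → reps (suc a) (suc a) ≡ ∑⁺ n λ z → (q^ (suc a ℕ.* z)) n * (ℤ.+ z - 1ℤ)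
    reps-diagonal a = begin
      reps (suc a) (suc a)
        ≡⟨ ∑-cong n (λ x → ∑-cong n λ y → coeff (sym (shift (suc a) x y))) ⟩
      ∑ n (λ x → ∑ n λ y → (q^ (suc a ℕ.* suc (suc (x ℕ.+ y)))) n)
        ≡⟨ ∑-antidiagonal n _ (λ x y n≤ → q^-below (ℕ.<-≤-trans (s≤s n≤) (ℕ.m≤m+n _ _))) ⟩
      ∑ n (λ z → ∑ z λ x → (q^ (suc a ℕ.* suc (suc (x ℕ.+ (z ∸ suc x))))) n)
        ≡⟨ ∑-cong n (λ z → trans (∑-cong-< z λ x x<z → coeff (cong (λ i → suc a ℕ.* suc i) (ℕ.m+[n∸m]≡n x<z)))
             (trans (∑-const z _) (cong ((q^ (suc a ℕ.* suc z)) n *_) (pred z)))) ⟩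
      _ ∎
      where
      shift : ∀ a x y → a ℕ.* suc (suc (x ℕ.+ y)) ≡ a ℕ.* suc x ℕ.+ a ℕ.* suc y
      shift = ℕ-Solver.solve-∀

      pred : ∀ z → ℤ.+ z ≡ ℤ.+ suc z - 1ℤ
      pred z = refl

      ∑-const : ∀ m c → ∑ m (λ _ → c) ≡ c * ℤ.+ m
      ∑-const zero    c = sym (ℤ.*-zeroʳ c)
      ∑-const (suc m) c = trans (cong (c +_) (∑-const m c)) (sym (ℤ.*-suc c (ℤ.+ m)))

    module _ (H : ℤ → ℤ → ℤ)
      (H-sym : ∀ x y → H x y ≡ H y x)
      -- Both conditions come from the triple (x , y , - x - y): the triple of (x + y , - y) is its
      -- negative up to order, and that of (x , - (y + x)) is a permutation of it.
      (H-left : ∀ x y → H (x + y) (- y) ≡ H x y)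
      (H-right : ∀ x y → H x (- (y + x)) ≡ H x y)
      where

      private
        H⁺ H⁻ : ℕ → ℕ → ℤ
        H⁺ a b = H (ℤ.+ a) (ℤ.+ b)
        H⁻ a b = H (ℤ.+ a) (- ℤ.+ b)

        core : ℤ
        core = ∑⁺ n λ a → ∑⁺ n λ b → H⁺ a b * above a b

        total : (ℕ → ℕ → ℤ) → ℤ
        total F = ∑⁺ n λ a → ∑⁺ n λ b → F a b * reps a b

        antidiag : ℕ → ℤ
        antidiag d = ∑ d λ a → H⁺ (suc a) (suc d ∸ suc a)

        ∑∑-distrib-+ : ∀ (f g : ℕ → ℕ → ℤ) →
          ∑ n (λ a → ∑ n λ b → f a b + g a b) ≡ ∑ n (λ a → ∑ n λ b → f a b) + ∑ n (λ a → ∑ n λ b → g a b)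
        ∑∑-distrib-+ f g = trans (∑-cong n λ a → ∑-distrib-+ n (f a) (g a)) (∑-distrib-+ n _ _)

        total⁺ : total H⁺ ≡ ∑ n (λ d → level (suc d) * antidiag d) + core + core
        total⁺ = begin
          total H⁺
            ≡⟨ ∑-cong n (λ a → ∑-cong n λ b → trans (cong (H⁺ (suc a) (suc b) *_) (reps-split a b))
                 (distr (H⁺ (suc a) (suc b)) (level (suc a ℕ.+ suc b)) (above (suc a) (suc b))
                     (above (suc b) (suc a)))) ⟩
          ∑ n (λ a → ∑ n λ b → t₁ a b + t₂ a b + t₃ a b)
            ≡⟨ trans (∑∑-distrib-+ (λ a b → t₁ a b + t₂ a b) t₃)
                (cong (_+ ∑ n (λ a → ∑ n (t₃ a))) (∑∑-distrib-+ t₁ t₂)) ⟩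
          ∑ n (λ a → ∑ n (t₁ a)) + core + ∑ n (λ a → ∑ n (t₃ a))
            ≡⟨ cong₂ (λ s t → s + core + t) first third ⟩
          _ ∎
          where
          t₁ t₂ t₃ : ℕ → ℕ → ℤ
          t₁ a b = level (suc a ℕ.+ suc b) * H⁺ (suc a) (suc b)
          t₂ a b = H⁺ (suc a) (suc b) * above (suc a) (suc b)
          t₃ a b = H⁺ (suc a) (suc b) * above (suc b) (suc a)

          distr : ∀ h x y z → h * (x + y + z) ≡ x * h + h * y + h * z
          distr = solve-∀

          third : ∑ n (λ a → ∑ n (t₃ a)) ≡ core
          third = trans (∑-swap n n t₃)
            (∑-cong n λ b → ∑-cong n λ a → cong (_* above (suc b) (suc a)) (H-sym (ℤ.+ suc a) (ℤ.+ suc b)))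

          level-zero : ∀ d → n < suc d → level (suc d) ≡ 0ℤ
          level-zero d n<d = ∑-zero n λ x _ → q^-below (ℕ.<-≤-trans n<d (ℕ.m≤m*n (suc d) (suc x)))

          first : ∑ n (λ a → ∑ n (t₁ a)) ≡ ∑ n (λ d → level (suc d) * antidiag d)
          first = begin
            ∑ n (λ a → ∑ n (t₁ a))
              ≡⟨ ∑-antidiagonal n t₁ (λ a b n≤ → trans (cong (_* H⁺ (suc a) (suc b))
                   (level-zero (a ℕ.+ suc b) (s≤s (subst (n ≤_) (sym (ℕ.+-suc a b)) n≤))))
                   (ℤ.*-zeroˡ (H⁺ (suc a) (suc b)))) ⟩
            ∑ n (λ d → ∑ d λ a → t₁ a (d ∸ suc a))
              ≡⟨ ∑-cong n (λ d → trans (∑-cong-< d λ a a<d → cong₂ (λ i j → level i * H⁺ (suc a) j)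
                   (cong suc (trans (ℕ.+-suc a _) (ℕ.m+[n∸m]≡n a<d))) (sym (ℕ.+-∸-assoc 1 a<d)))
                   (∑-distribˡ-* d (level (suc d)) _)) ⟩
            _ ∎

        -- Now the trichotomy is applied to a and b. For b = a + k the equation a x + (a + k) y = n
        -- is the one counted by `above a k`, and the symmetries of `H` turn H a (- b) into H a k.
        total⁻ : total H⁻ ≡ ∑ n (λ d → H⁻ (suc d) (suc d) * reps (suc d) (suc d)) + core + core
        total⁻ = begin
          total H⁻
            ≡⟨ ∑-square n (λ a b → H⁻ (suc a) (suc b) * reps (suc a) (suc b))
                 (λ a b n≤a → trans (cong (H⁻ (suc a) (suc b) *_) (reps-above a (suc b) n≤a))
                     (ℤ.*-zeroʳ (H⁻ (suc a) (suc b))))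
                 (λ a b n≤b → trans (cong (H⁻ (suc a) (suc b) *_)
                   (trans (reps-sym (suc a) (suc b)) (reps-above b (suc a) n≤b)))
                       (ℤ.*-zeroʳ (H⁻ (suc a) (suc b)))) ⟩
          _ ≡⟨ cong₂ (λ s t → ∑ n (λ d → H⁻ (suc d) (suc d) * reps (suc d) (suc d)) + s + t)
                 (trans (∑-cong n λ k → ∑-cong n λ b → cong₂ _*_ (lower k b) (reps-lower k b)) (∑-swap n n _))
                 (∑-swap n n _) ⟩
          _ ≡⟨ cong₂ (λ s t → ∑ n (λ d → H⁻ (suc d) (suc d) * reps (suc d) (suc d)) + s + t)
                 refl (∑-cong n λ a → ∑-cong n λ k → cong₂ _*_ (upper k a) (reps-upper k a)) ⟩
          _ ∎
          where
          cast : ∀ k b → ℤ.+ suc (suc (k ℕ.+ b)) ≡ ℤ.+ suc k + ℤ.+ suc b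
          cast k b = cong (λ i → ℤ.+ suc i) (sym (ℕ.+-suc k b))

          lower : ∀ k b → H⁻ (suc (suc (k ℕ.+ b))) (suc b) ≡ H⁺ (suc b) (suc k)
          lower k b = trans (cong (λ i → H i (- ℤ.+ suc b)) (cast k b))
            (trans (H-left (ℤ.+ suc k) (ℤ.+ suc b)) (H-sym _ _))

          upper : ∀ k a → H⁻ (suc a) (suc (suc (k ℕ.+ a))) ≡ H⁺ (suc a) (suc k)
          upper k a = trans (cong (λ i → H (ℤ.+ suc a) (- i)) (cast k a)) (H-right (ℤ.+ suc a) (ℤ.+ suc k))

          reps-upper : ∀ k a → reps (suc a) (suc (suc (k ℕ.+ a))) ≡ above (suc a) (suc k)
          reps-upper k a = ∑-cong n λ x → ∑-cong n λ y → coeff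
              (cong (λ i → suc a ℕ.* suc x ℕ.+ i ℕ.* suc y) (nat k a))
            where
            nat : ∀ k a → suc (suc (k ℕ.+ a)) ≡ suc a ℕ.+ suc k
            nat = ℕ-Solver.solve-∀

          reps-lower : ∀ k b → reps (suc (suc (k ℕ.+ b))) (suc b) ≡ above (suc b) (suc k)
          reps-lower k b = trans (reps-sym (suc (suc (k ℕ.+ b))) (suc b)) (reps-upper k b)

      -- Splitting the left-hand side by x <=> y in the terms H a b and by a <=> b in
      -- the terms H a (- b) gives 2 core plus a diagonal in both cases.
      liouville :
        ∑⁺ n (λ a → ∑⁺ n λ b → (H (ℤ.+ a) (ℤ.+ b) - H (ℤ.+ a) (- ℤ.+ b)) * reps a b) ≡
        ∑⁺ n (λ d → ∑⁺ n λ z → (q^ (d ℕ.* z)) n *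
          (∑ (ℕ.pred d) (λ i → H (ℤ.+ suc i) (ℤ.+ (d ∸ suc i))) - (ℤ.+ z - 1ℤ) * H (ℤ.+ d) (- ℤ.+ d)))
      liouville = begin
        ∑⁺ n (λ a → ∑⁺ n λ b → (H⁺ a b - H⁻ a b) * reps a b)
          ≡⟨ ∑-cong n (λ a → ∑-cong n λ b → distr (H⁺ (suc a) (suc b)) (H⁻ (suc a) (suc b))
              (reps (suc a) (suc b))) ⟩
        ∑ n (λ a → ∑ n λ b → H⁺ (suc a) (suc b) * reps (suc a) (suc b) + -1ℤ*
            (H⁻ (suc a) (suc b) * reps (suc a) (suc b)))
          ≡⟨ trans (∑∑-distrib-+ _ _) (cong (total H⁺ +_)
               (trans (∑-cong n λ a → ∑-distribˡ-* n (- 1ℤ) (h a)) (∑-distribˡ-* n (- 1ℤ) (λ a → ∑ n (h a))))) ⟩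
        total H⁺ + -1ℤ* total H⁻
          ≡⟨ cong₂ (λ s t → s + -1ℤ* t) total⁺ total⁻ ⟩
        (∑ n (λ d → level (suc d) * antidiag d) + core + core) + -1ℤ* (diag + core + core)
          ≡⟨ cancel (∑ n lead) diag core ⟩
        ∑ n (λ d → level (suc d) * antidiag d) + -1ℤ* diag
          ≡⟨ cong (∑ n lead +_) (sym (∑-distribˡ-* n (- 1ℤ) (λ d → h d d))) ⟩
        ∑ n (λ d → level (suc d) * antidiag d) + ∑ n (λ d → -1ℤ* (H⁻ (suc d) (suc d) * reps (suc d) (suc d)))
          ≡⟨ sym (∑-distrib-+ n _ _) ⟩
        ∑ n (λ d → level (suc d) * antidiag d + -1ℤ* (H⁻ (suc d) (suc d) * reps (suc d) (suc d)))
          ≡⟨ ∑-cong n (λ d → cong₂ _+_ (sym (∑-distribʳ-* n (antidiag d) _))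
               (trans (cong (λ s → -1ℤ* (H⁻ (suc d) (suc d) * s)) (reps-diagonal d))
                 (trans (sym (ℤ.*-assoc (- 1ℤ) (H⁻ (suc d) (suc d))
                     (∑⁺ n λ z → (q^ (suc d ℕ.* z)) n * (ℤ.+ z - 1ℤ))))
                   (sym (∑-distribˡ-* n (- 1ℤ * H⁻ (suc d) (suc d))
                       (λ z → (q^ (suc d ℕ.* suc z)) n * (ℤ.+ suc z - 1ℤ))))))) ⟩
        _ ≡⟨ ∑-cong n (λ d → sym (∑-distrib-+ n _ _)) ⟩
        _ ≡⟨ ∑-cong n (λ d → ∑-cong n λ z →
               collect ((q^ (suc d ℕ.* suc z)) n) (antidiag d) (H⁻ (suc d) (suc d)) (ℤ.+ suc z - 1ℤ)) ⟩
        _ ∎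
        where
        -1ℤ*_ : ℤ → ℤ
        -1ℤ* x = - 1ℤ * x

        diag = ∑ n (λ d → H⁻ (suc d) (suc d) * reps (suc d) (suc d))

        lead : ℕ → ℤ
        lead d = level (suc d) * antidiag d

        h : ℕ → ℕ → ℤ
        h a b = H⁻ (suc a) (suc b) * reps (suc a) (suc b)

        distr : ∀ x y r → (x - y) * r ≡ x * r + - 1ℤ * (y * r)
        distr = solve-∀

        cancel : ∀ l d c → (l + c + c) + - 1ℤ * (d + c + c) ≡ l + - 1ℤ * d
        cancel = solve-∀

        collect : ∀ q s h z → q * s + (- 1ℤ * h) * (q * z) ≡ q * (s - z * h)
        collect = solve-∀

-- The differential ring of power series, exactly and modulo q^(N+1)

module PowerSeries where

  open import Data.Integer.Base using (_+_; _*_; _-_; -_)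
  open ≡ using (refl; sym; trans)
  open ≡-Reasoning
  open FiniteSums

  infixl 6 _⊕_
  infix  8 ⊝_

  _⊕_ : Series → Series → Series
  (f ⊕ g) i = f i + g i

  ⊝_ : Series → Series
  (⊝ f) i = - f i

  const : ℤ → Series
  const c i = c * (q^ 0) i

  D : Series → Series
  D f i = ℤ.+ i * f i

  ⊛-cong : ∀ {f f′ g g′} n → (∀ i → i ≤ n → f i ≡ f′ i) → (∀ i → i ≤ n → g i ≡ g′ i) →
           (f ⊛ g) n ≡ (f′ ⊛ g′) n
  ⊛-cong n f≡ g≡ = ∑-cong-< (suc n) λ { k (s≤s k≤n) → cong₂ _*_ (f≡ k k≤n) (g≡ (n ∸ k) (ℕ.m∸n≤m n k)) }

  ⊛-distribʳ : ∀ f g h n → ((f ⊕ g) ⊛ h) n ≡ (f ⊛ h) n + (g ⊛ h) n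
  ⊛-distribʳ f g h n = trans (∑-cong (suc n) λ k → ℤ.*-distribʳ-+ (h (n ∸ k)) (f k) (g k))
    (∑-distrib-+ (suc n) (λ k → f k * h (n ∸ k)) (λ k → g k * h (n ∸ k)))

  ⊛-scaleˡ : ∀ c f g n → ((λ i → c * f i) ⊛ g) n ≡ c * (f ⊛ g) n
  ⊛-scaleˡ c f g n = trans (∑-cong (suc n) λ k → ℤ.*-assoc c (f k) (g (n ∸ k)))
    (∑-distribˡ-* (suc n) c (λ k → f k * g (n ∸ k)))

  ⊛-∑ˡ : ∀ N (F : ℕ → Series) g n → ((λ m → ∑ N (λ i → F i m)) ⊛ g) n ≡ ∑ N (λ i → (F i ⊛ g) n)
  ⊛-∑ˡ N F g n = trans (∑-cong (suc n) λ k → sym (∑-distribʳ-* N (g (n ∸ k)) (λ i → F i k)))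
    (∑-swap (suc n) N (λ k i → F i k * g (n ∸ k)))

  -- The product unfolds by itself at its first term only; splitting off the last one is the mirror
  -- image, from which commutativity follows by induction.
  ⊛-last : ∀ f g n → (f ⊛ g) (suc n) ≡ f (suc n) * g 0 + (f ⊛ (g ∘ suc)) n
  ⊛-last f g zero = swap (f 0 * g 1) (f 1 * g 0)
    where
    swap : ∀ a b → a + (b + 0ℤ) ≡ b + (a + 0ℤ)
    swap = solve-∀
  ⊛-last f g (suc n) = trans (cong (f 0 * g (suc (suc n)) +_) (⊛-last (f ∘ suc) g n))
    (swap (f 0 * g (suc (suc n))) (f (suc (suc n)) * g 0) (((f ∘ suc) ⊛ (g ∘ suc)) n))
    where
    swap : ∀ a b c → a + (b + c) ≡ b + (a + c)
    swap = solve-∀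

  ⊛-comm : ∀ f g n → (f ⊛ g) n ≡ (g ⊛ f) n
  ⊛-comm f g zero    = cong (_+ 0ℤ) (ℤ.*-comm (f 0) (g 0))
  ⊛-comm f g (suc n) = trans (cong₂ _+_ (ℤ.*-comm (f 0) (g (suc n))) (⊛-comm (f ∘ suc) g n))
    (sym (⊛-last g f n))

  ⊛-assoc : ∀ f g h n → ((f ⊛ g) ⊛ h) n ≡ (f ⊛ (g ⊛ h)) n
  ⊛-assoc f g h zero    = lemma (f 0) (g 0) (h 0)
    where
    lemma : ∀ a b c → (a * b + 0ℤ) * c + 0ℤ ≡ a * (b * c + 0ℤ) + 0ℤ
    lemma = solve-∀
  ⊛-assoc f g h (suc n) = begin
    -- By unfolding, the shift of f ⊛ g is f 0 times the shift of g plus (f ∘ suc) ⊛ g, so the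
    -- induction hypothesis is needed for f ∘ suc.
    (f 0 * g 0 + 0ℤ) * h (suc n) + (((λ i → f 0 * g (suc i)) ⊕ ((f ∘ suc) ⊛ g)) ⊛ h) n
      ≡⟨ cong₂ _+_ (assoc₀ (f 0) (g 0) (h (suc n)))
           (trans (⊛-distribʳ (λ i → f 0 * g (suc i)) ((f ∘ suc) ⊛ g) h n)
             (cong₂ _+_ (⊛-scaleˡ (f 0) (g ∘ suc) h n) (⊛-assoc (f ∘ suc) g h n))) ⟩
    f 0 * (g 0 * h (suc n)) + (f 0 * ((g ∘ suc) ⊛ h) n + ((f ∘ suc) ⊛ (g ⊛ h)) n)
      ≡⟨ collect (f 0) (g 0 * h (suc n)) (((g ∘ suc) ⊛ h) n) (((f ∘ suc) ⊛ (g ⊛ h)) n) ⟩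
    _ ∎
    where
    assoc₀ : ∀ a b c → (a * b + 0ℤ) * c ≡ a * (b * c)
    assoc₀ = solve-∀

    collect : ∀ a b c d → a * b + (a * c + d) ≡ a * (b + c) + d
    collect = solve-∀

  ⊛-identityˡ : ∀ f n → (q^ 0 ⊛ f) n ≡ f n
  ⊛-identityˡ f n = begin
    1ℤ * f n + ∑ n (λ k → 0ℤ * f (n ∸ suc k))
      ≡⟨ cong₂ _+_ (ℤ.*-identityˡ (f n)) (∑-zero n λ k _ → ℤ.*-zeroˡ (f (n ∸ suc k))) ⟩
    f n + 0ℤ  ≡⟨ ℤ.+-identityʳ (f n) ⟩
    f n       ∎

  const-⊛ : ∀ c f n → (const c ⊛ f) n ≡ c * f n
  const-⊛ c f n = trans (⊛-scaleˡ c (q^ 0) f n) (cong (c *_) (⊛-identityˡ f n))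

  q^-⊛ : ∀ i j n → (q^ i ⊛ q^ j) n ≡ (q^ (i ℕ.+ j)) n
  q^-⊛ zero    j n       = ⊛-identityˡ (q^ j) n
  q^-⊛ (suc i) j zero    = trans (ℤ.+-identityʳ (0ℤ * (q^ j) 0)) (ℤ.*-zeroˡ ((q^ j) 0))
  q^-⊛ (suc i) j (suc n) = trans
    (cong₂ _+_ (ℤ.*-zeroˡ ((q^ j) (suc n))) (q^-⊛ i j n)) (ℤ.+-identityˡ ((q^ (i ℕ.+ j)) n))

  D-⊛ : ∀ f g n → D (f ⊛ g) n ≡ (D f ⊛ g) n + (f ⊛ D g) n
  D-⊛ f g n = begin
    ℤ.+ n * (f ⊛ g) n
      ≡⟨ ∑-distribˡ-* (suc n) (ℤ.+ n) (λ k → f k * g (n ∸ k)) ⟨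
    ∑ (suc n) (λ k → ℤ.+ n * (f k * g (n ∸ k)))
      ≡⟨ ∑-cong-< (suc n) (λ { k (s≤s k≤n) → trans
           (cong (λ i → ℤ.+ i * (f k * g (n ∸ k))) (sym (ℕ.m+[n∸m]≡n k≤n)))
           (lemma (ℤ.+ k) (ℤ.+ (n ∸ k)) (f k) (g (n ∸ k))) }) ⟩
    ∑ (suc n) (λ k → ℤ.+ k * f k * g (n ∸ k) + f k * (ℤ.+ (n ∸ k) * g (n ∸ k)))
      ≡⟨ ∑-distrib-+ (suc n) (λ k → ℤ.+ k * f k * g (n ∸ k)) (λ k → f k * (ℤ.+ (n ∸ k) * g (n ∸ k))) ⟩
    _ ∎
    where
    lemma : ∀ k l a b → (k + l) * (a * b) ≡ k * a * b + a * (l * b)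
    lemma = solve-∀

  D-q^ : ∀ j n → D (q^ j) n ≡ ℤ.+ j * (q^ j) n
  D-q^ j n = go j n (λ i → i)
    where
    -- The recursion lowers both indices; `s` remembers the amount removed, so that the weights stay
    -- those of the original indices.
    go : ∀ j n (s : ℕ → ℕ) → ℤ.+ s n * (q^ j) n ≡ ℤ.+ s j * (q^ j) n
    go zero    zero    s = refl
    go zero    (suc n) s = trans (ℤ.*-zeroʳ (ℤ.+ s (suc n))) (sym (ℤ.*-zeroʳ (ℤ.+ s 0)))
    go (suc j) zero    s = trans (ℤ.*-zeroʳ (ℤ.+ s 0)) (sym (ℤ.*-zeroʳ (ℤ.+ s (suc j))))
    go (suc j) (suc n) s = go j n (s ∘ suc)

  module Truncated (N : ℕ) where

    infix 4 _≈_

    -- congruence modulo q^(N+1)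
    record _≈_ (f g : Series) : Set where
      constructor coeffs
      field coeff : ∀ i → i ≤ N → f i ≡ g i
    open _≈_ public

    pointwise : ∀ {f g} → (∀ i → f i ≡ g i) → f ≈ g
    pointwise eq = coeffs λ i _ → eq i

    commutativeRing : CommutativeRing 0ℓ 0ℓ
    commutativeRing = record
      { Carrier = Series
      ; _≈_ = _≈_
      ; _+_ = _⊕_
      ; _*_ = _⊛_
      ; -_  = ⊝_
      ; 0#  = λ _ → 0ℤ
      ; 1#  = q^ 0
      ; isCommutativeRing = record
        { isRing = record
          { +-isAbelianGroup = record
            { isGroup = record
              { isMonoid = record
                { isSemigroup = record
                  { isMagma = record
                    { isEquivalence = record
                      { refl  = pointwise λ _ → refl
                      ; sym   = λ e → coeffs λ i i≤N → sym (coeff e i i≤N)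
                      ; trans = λ e e′ → coeffs λ i i≤N → trans (coeff e i i≤N) (coeff e′ i i≤N)
                      }
                    ; ∙-cong = λ e e′ → coeffs λ i i≤N → cong₂ _+_ (coeff e i i≤N) (coeff e′ i i≤N)
                    }
                  ; assoc = λ f g h → pointwise λ i → ℤ.+-assoc (f i) (g i) (h i)
                  }
                ; identity = (λ f → pointwise λ i → ℤ.+-identityˡ (f i)) ,
                    (λ f → pointwise λ i → ℤ.+-identityʳ (f i))
                }
              ; inverse = (λ f → pointwise λ i → ℤ.+-inverseˡ (f i)) ,
                  (λ f → pointwise λ i → ℤ.+-inverseʳ (f i))
              ; ⁻¹-cong = λ e → coeffs λ i i≤N → cong -_ (coeff e i i≤N)
              }
            ; comm = λ f g → pointwise λ i → ℤ.+-comm (f i) (g i)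
            }
          ; *-cong = λ {f} {f′} {g} {g′} e e′ → coeffs λ i i≤N → ⊛-cong {f} {f′} {g} {g′} i
              (λ j j≤i → coeff e j (ℕ.≤-trans j≤i i≤N)) (λ j j≤i → coeff e′ j (ℕ.≤-trans j≤i i≤N))
          ; *-assoc = λ f g h → pointwise (⊛-assoc f g h)
          ; *-identity = (λ f → pointwise (⊛-identityˡ f))
                       , (λ f → pointwise λ i → trans (⊛-comm f (q^ 0) i) (⊛-identityˡ f i))
          ; distrib = (λ f g h → pointwise λ i → trans (⊛-comm f (g ⊕ h) i)
                         (trans (⊛-distribʳ g h f i) (cong₂ _+_ (⊛-comm g f i) (⊛-comm h f i))))
                    , (λ f g h → pointwise (⊛-distribʳ g h f))
          }
        ; *-comm = λ f g → pointwise (⊛-comm f g)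
        }
      }

    const-hom : CommutativeRing.rawRing ℤ.+-*-commutativeRing
                -Raw-AlmostCommutative⟶ fromCommutativeRing commutativeRing
    const-hom = record
      { ⟦_⟧    = const
      ; +-homo = λ a b → pointwise λ i → ℤ.*-distribʳ-+ ((q^ 0) i) a b
      ; *-homo = λ a b → pointwise λ i → trans (ℤ.*-assoc a b ((q^ 0) i)) (sym (const-⊛ a (const b) i))
      ; -‿homo = λ a → pointwise λ i → sym (ℤ.neg-distribˡ-* a ((q^ 0) i))
      ; 0-homo = pointwise λ i → ℤ.*-zeroˡ ((q^ 0) i)
      ; 1-homo = pointwise λ i → ℤ.*-identityˡ ((q^ 0) i)
      }

    module Solver = IntegerCoefficients commutativeRing const-hom

    D-cong : ∀ {f g} → f ≈ g → D f ≈ D g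
    D-cong e = coeffs λ i i≤N → cong (ℤ.+ i *_) (coeff e i i≤N)

-- Divisor sums as coefficients of Lambert series

module DivisorSums where

  open import Data.Integer.Base using (_+_; _*_; _-_; -_; _^_)
  open ≡ using (refl; sym; trans)
  open ≡-Reasoning
  open FiniteSums
  open LiouvilleIdentity
  open PowerSeries

  s : ℕ → Series
  s k n = ℤ.+ σ k n

  q^-diagonal : ∀ j → (q^ j) j ≡ 1ℤ
  q^-diagonal zero    = refl
  q^-diagonal (suc j) = q^-diagonal j

  q^-off : ∀ {i j} → ¬ i ≡ j → (q^ j) i ≡ 0ℤ
  q^-off {zero}  {zero}  i≢j = ⊥-elim (i≢j refl)
  q^-off {zero}  {suc j} i≢j = refl
  q^-off {suc i} {zero}  i≢j = refl
  q^-off {suc i} {suc j} i≢j = q^-off (i≢j ∘ cong suc)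

  pos-^ : ∀ d k → ℤ.+ (d ℕ.^ k) ≡ (ℤ.+ d) ^ k
  pos-^ d zero    = refl
  pos-^ d (suc k) = trans (ℤ.pos-* d (d ℕ.^ k)) (cong (ℤ.+ d *_) (pos-^ d k))

  ∑-single : ∀ {j N} f → j < N → (∀ i → ¬ i ≡ j → f i ≡ 0ℤ) → ∑ N f ≡ f j
  ∑-single {zero}  {suc N} f _         z =
    trans (cong (f 0 +_) (∑-zero N λ i _ → z (suc i) λ ())) (ℤ.+-identityʳ (f 0))
  ∑-single {suc j} {suc N} f (s≤s j<N) z =
    trans (cong₂ _+_ (z 0 λ ()) (∑-single (f ∘ suc) j<N λ i i≢j → z (suc i) (i≢j ∘ ℕ.suc-injective)))
      (ℤ.+-identityˡ (f (suc j)))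

  ∑-extend : ∀ {n N} f → n ≤ N → (∀ i → n ≤ i → f i ≡ 0ℤ) → ∑ N f ≡ ∑ n f
  ∑-extend {N = N} f z≤n z = ∑-zero N λ i _ → z i z≤n
  ∑-extend f (s≤s n≤N) z = cong (f 0 +_) (∑-extend (f ∘ suc) n≤N λ i n≤i → z (suc i) (s≤s n≤i))

  multiples : ∀ d n N → n ≤ N → ℕ.NonZero n →
    (d∣?n : Dec (suc d ∣ n)) → ∑⁺ N (λ z → (q^ (suc d ℕ.* z)) n) ≡ (if does d∣?n then 1ℤ else 0ℤ)
  multiples d n N n≤N n≢0 (no  d∤n) = ∑-zero N λ z _ → q^-off λ n≡dz → d∤n
      (divides (suc z) (trans n≡dz (ℕ.*-comm (suc d) (suc z))))
  multiples d n N n≤N n≢0 (yes (divides (suc q) refl)) = trans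
    (∑-single {q} _ (ℕ.<-≤-trans (ℕ.≤-trans (ℕ.≤-reflexive (sym (ℕ.*-identityʳ (suc q))))
        (ℕ.*-monoʳ-≤ (suc q) (s≤s z≤n))) n≤N)
      (λ i i≢q → q^-off λ eq → i≢q (sym (ℕ.suc-injective
          (ℕ.*-cancelʳ-≡ (suc q) (suc i) (suc d) (trans eq (ℕ.*-comm (suc d) (suc i))))))))
    (trans (cong (λ m → (q^ m) (suc q ℕ.* suc d)) (ℕ.*-comm (suc d) (suc q))) (q^-diagonal (suc q ℕ.* suc d)))

  sum-filter : ∀ k n m (f : ℕ → ℕ) →
    ℤ.+ sum (map (ℕ._^ k) (filter (_∣? n) (applyUpTo f m))) ≡
    ∑ m (λ i → (ℤ.+ f i) ^ k * (if does (f i ∣? n) then 1ℤ else 0ℤ))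
  sum-filter k n zero    f = refl
  sum-filter k n (suc m) f with f 0 ∣? n
  ... | yes _ = cong₂ _+_ (trans (pos-^ (f 0) k) (sym (ℤ.*-identityʳ _))) (sum-filter k n m (f ∘ suc))
  ... | no  _ = trans (sum-filter k n m (f ∘ suc))
    (sym (trans (cong (_+ rest) (ℤ.*-zeroʳ ((ℤ.+ f 0) ^ k))) (ℤ.+-identityˡ rest)))
    where rest = ∑ m (λ i → (ℤ.+ f (suc i)) ^ k * (if does (f (suc i) ∣? n) then 1ℤ else 0ℤ))

  -- Each divisor d of n is counted through its unique cofactor z. The bound N is independent of n,
  -- so one double sum represents all coefficients up to N. At n = 0 the list of divisors is empty,
  -- and no monomial q^(d z) has a constant term.
  σ-expand : ∀ k {n N} → n ≤ N →
    s k n ≡ ∑⁺ N (λ d → ∑⁺ N λ z → (ℤ.+ d) ^ k * (q^ (d ℕ.* z)) n)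
  σ-expand k {zero}  {N} _   = sym (∑-zero N λ d _ → ∑-zero N λ z _ → ℤ.*-zeroʳ ((ℤ.+ suc d) ^ k))
  σ-expand k {suc n} {N} n≤N = begin
    ℤ.+ σ k (suc n)
      ≡⟨ sum-filter k (suc n) (suc n) suc ⟩
    ∑ (suc n) (λ d → (ℤ.+ suc d) ^ k * (if does (suc d ∣? suc n) then 1ℤ else 0ℤ))
      ≡⟨ ∑-extend _ n≤N (λ d n<d → trans (cong ((ℤ.+ suc d) ^ k *_) (too-big d n<d (suc d ∣? suc n)))
          (ℤ.*-zeroʳ ((ℤ.+ suc d) ^ k))) ⟨
    ∑ N (λ d → (ℤ.+ suc d) ^ k * (if does (suc d ∣? suc n) then 1ℤ else 0ℤ))
      ≡⟨ ∑-cong N (λ d → trans (cong ((ℤ.+ suc d) ^ k *_) (sym (multiples d (suc n) N n≤N _ (suc d ∣? suc n))))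
           (sym (∑-distribˡ-* N ((ℤ.+ suc d) ^ k) (λ z → (q^ (suc d ℕ.* suc z)) (suc n))))) ⟩
    _ ∎
    where
    too-big : ∀ d → suc n ≤ d → (d∣?n : Dec (suc d ∣ suc n)) → (if does d∣?n then 1ℤ else 0ℤ) ≡ 0ℤ
    too-big d n<d (yes d∣n) = ⊥-elim (ℕ.<-irrefl refl (ℕ.<-≤-trans (s≤s n<d) (∣⇒≤ d∣n)))
    too-big d n<d (no  _)   = refl

  ⊛-scaleʳ : ∀ c f g n → (f ⊛ (λ i → c * g i)) n ≡ c * (f ⊛ g) n
  ⊛-scaleʳ c f g n = trans (⊛-comm f (λ i → c * g i) n)
    (trans (⊛-scaleˡ c g f n) (cong (c *_) (⊛-comm g f n)))

  ⊛-∑ʳ : ∀ N f (F : ℕ → Series) n → (f ⊛ (λ m → ∑ N (λ i → F i m))) n ≡ ∑ N (λ i → (f ⊛ F i) n)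
  ⊛-∑ʳ N f F n = trans (⊛-comm f (λ m → ∑ N (λ i → F i m)) n)
    (trans (⊛-∑ˡ N F f n) (∑-cong N λ i → ⊛-comm (F i) f n))

  monomial-⊛ : ∀ c i d j n →
    ((λ m → c * (q^ i) m) ⊛ (λ m → d * (q^ j) m)) n ≡ c * d * (q^ (i ℕ.+ j)) n
  monomial-⊛ c i d j n = trans (⊛-scaleˡ c (q^ i) (λ m → d * (q^ j) m) n)
    (trans (cong (c *_) (trans (⊛-scaleʳ d (q^ i) (q^ j) n) (cong (d *_) (q^-⊛ i j n))))
      (sym (ℤ.*-assoc c d ((q^ (i ℕ.+ j)) n))))

  -- Multiplying the two Lambert series gives the monomials q^(a x + b y), and their coefficient at
  -- n counts the solutions.
  σ-convolution : ∀ j k n →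
    ∑⁺ n (λ a → ∑⁺ n λ b → (ℤ.+ a) ^ j * (ℤ.+ b) ^ k * reps n a b) ≡ (s j ⊛ s k) n
  σ-convolution j k n = sym (begin
    (s j ⊛ s k) n
      ≡⟨ ⊛-cong {s j} {λ m → ∑ n (λ a → A a m)} {s k} {λ m → ∑ n (λ b → B b m)} n (λ _ → σ-expand j)
          (λ _ → σ-expand k) ⟩
    ((λ m → ∑ n (λ a → A a m)) ⊛ (λ m → ∑ n (λ b → B b m))) n
      ≡⟨ trans (⊛-∑ˡ n A (λ m → ∑ n (λ b → B b m)) n) (∑-cong n λ a → ⊛-∑ʳ n (A a) B n) ⟩
    ∑ n (λ a → ∑ n λ b → (A a ⊛ B b) n)
      ≡⟨ ∑-cong n (λ a → ∑-cong n (λ b → product (suc a) (suc b))) ⟩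
    _ ∎)
    where
    A B : ℕ → Series
    A a m = ∑⁺ n λ x → (ℤ.+ suc a) ^ j * (q^ (suc a ℕ.* x)) m
    B b m = ∑⁺ n λ y → (ℤ.+ suc b) ^ k * (q^ (suc b ℕ.* y)) m

    product : ∀ a b →
      ((λ m → ∑⁺ n λ x → (ℤ.+ a) ^ j * (q^ (a ℕ.* x)) m) ⊛
          (λ m → ∑⁺ n λ y → (ℤ.+ b) ^ k * (q^ (b ℕ.* y)) m)) n ≡
      (ℤ.+ a) ^ j * (ℤ.+ b) ^ k * reps n a b
    product a b = begin
      ((λ m → ∑ n λ x → α x m) ⊛ (λ m → ∑ n λ y → β y m)) n
        ≡⟨ trans (⊛-∑ˡ n α (λ m → ∑ n λ y → β y m) n) (∑-cong n λ x → ⊛-∑ʳ n (α x) β n) ⟩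
      ∑ n (λ x → ∑ n λ y → (α x ⊛ β y) n)
        ≡⟨ ∑-cong n (λ x → ∑-cong n λ y → monomial-⊛ ((ℤ.+ a) ^ j) (a ℕ.* suc x) ((ℤ.+ b) ^ k)
            (b ℕ.* suc y) n) ⟩
      ∑ n (λ x → ∑ n λ y → ab * e x y)
        ≡⟨ trans (∑-cong n λ x → ∑-distribˡ-* n ab (e x)) (∑-distribˡ-* n ab (λ x → ∑ n (e x))) ⟩
      ab * reps n a b ∎
      where
      α β : ℕ → Series
      α x m = (ℤ.+ a) ^ j * (q^ (a ℕ.* suc x)) m
      β y m = (ℤ.+ b) ^ k * (q^ (b ℕ.* suc y)) m
      ab = (ℤ.+ a) ^ j * (ℤ.+ b) ^ k
      e : ℕ → ℕ → ℤ
      e x y = (q^ (a ℕ.* suc x ℕ.+ b ℕ.* suc y)) n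

-- Convolution identities of divisor sums from hexagonal invariants

module ConvolutionRelations where

  open import Data.Integer.Base using (_+_; _*_; _-_; -_; _^_)
  open ≡ using (refl; sym; trans)
  open ≡-Reasoning
  open FiniteSums
  open LiouvilleIdentity
  open PowerSeries
  open DivisorSums

  private module S = IntegerCoefficients ℤ.+-*-commutativeRing (-raw-almostCommutative⟶ _)
  open S using (Polynomial; var; con; _:+_; _:*_; _:-_; :-_; _:^_; _:=_)

  -- Polynomials are kept as lists of a coefficient with its exponents: the same data is read as an
  -- integer function, as a formal polynomial for the solver, and as a combination of divisor sums
  -- or of their convolutions.
  Poly₁ Poly₂ : Set
  Poly₁ = List (ℤ × ℕ)
  Poly₂ = List (ℤ × ℕ × ℕ)

  eval₁ : Poly₁ → ℤ → ℤ
  eval₁ []            x = 0ℤ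
  eval₁ ((c , i) ∷ p) x = c * x ^ i + eval₁ p x

  eval₂ : Poly₂ → ℤ → ℤ → ℤ
  eval₂ []                x y = 0ℤ
  eval₂ ((c , i , j) ∷ p) x y = c * (x ^ i * y ^ j) + eval₂ p x y

  -- u and v are - e₂ and e₃² for the elementary symmetric functions of x , y , - x - y.
  u v : ℤ → ℤ → ℤ
  u x y = x * x + x * y + y * y
  v x y = x * y * (x + y) * (x * y * (x + y))

  hexagonal : Poly₂ → ℤ → ℤ → ℤ
  hexagonal h x y = eval₂ h (u x y) (v x y)

  divisorSum : Poly₁ → ℕ → ℤ
  divisorSum []            n = 0ℤ
  divisorSum ((c , i) ∷ p) n = c * s i n + divisorSum p n

  convolutionSum : Poly₂ → ℕ → ℤ
  convolutionSum []                n = 0ℤ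
  convolutionSum ((c , i , j) ∷ p) n = c * (s i ⊛ s j) n + convolutionSum p n

  private
    ∑∑-linear : ∀ n c (f g : ℕ → ℕ → ℤ) →
      ∑ n (λ a → ∑ n λ b → c * f a b + g a b) ≡ c * ∑ n (λ a → ∑ n (f a)) + ∑ n (λ a → ∑ n (g a))
    ∑∑-linear n c f g = begin
      ∑ n (λ a → ∑ n λ b → c * f a b + g a b)
        ≡⟨ ∑-cong n (λ a → trans (∑-distrib-+ n (λ b → c * f a b) (g a))
            (cong (_+ ∑ n (g a)) (∑-distribˡ-* n c (f a)))) ⟩
      ∑ n (λ a → c * ∑ n (f a) + ∑ n (g a))
        ≡⟨ trans (∑-distrib-+ n (λ a → c * ∑ n (f a)) (λ a → ∑ n (g a)))
             (cong (_+ ∑ n (λ a → ∑ n (g a))) (∑-distribˡ-* n c (λ a → ∑ n (f a)))) ⟩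
      c * ∑ n (λ a → ∑ n (f a)) + ∑ n (λ a → ∑ n (g a)) ∎

    ∑-eval₂ : ∀ p n → ∑⁺ n (λ a → ∑⁺ n λ b → eval₂ p (ℤ.+ a) (ℤ.+ b) * reps n a b) ≡ convolutionSum p n
    ∑-eval₂ []                n = ∑-zero n λ a _ → ∑-zero n λ b _ → ℤ.*-zeroˡ (reps n (suc a) (suc b))
    ∑-eval₂ ((c , i , j) ∷ p) n = begin
      _ ≡⟨ ∑-cong n (λ a → ∑-cong n λ b → distr c ((ℤ.+ suc a) ^ i * (ℤ.+ suc b) ^ j)
             (eval₂ p (ℤ.+ suc a) (ℤ.+ suc b)) (reps n (suc a) (suc b))) ⟩
      ∑ n (λ a → ∑ n λ b → c * f a b + g a b)
        ≡⟨ ∑∑-linear n c f g ⟩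
      c * ∑ n (λ a → ∑ n (f a)) + ∑ n (λ a → ∑ n (g a))
        ≡⟨ cong₂ (λ x y → c * x + y) (σ-convolution i j n) (∑-eval₂ p n) ⟩
      _ ∎
      where
      f g : ℕ → ℕ → ℤ
      f a b = (ℤ.+ suc a) ^ i * (ℤ.+ suc b) ^ j * reps n (suc a) (suc b)
      g a b = eval₂ p (ℤ.+ suc a) (ℤ.+ suc b) * reps n (suc a) (suc b)

      distr : ∀ c x e r → (c * x + e) * r ≡ c * (x * r) + e * r
      distr = solve-∀

    ∑-eval₁ : ∀ p n → ∑⁺ n (λ d → ∑⁺ n λ z → eval₁ p (ℤ.+ d) * (q^ (d ℕ.* z)) n) ≡ divisorSum p n
    ∑-eval₁ []            n = ∑-zero n λ d _ → ∑-zero n λ z _ → ℤ.*-zeroˡ ((q^ (suc d ℕ.* suc z)) n)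
    ∑-eval₁ ((c , i) ∷ p) n = begin
      _ ≡⟨ ∑-cong n (λ d → ∑-cong n λ z → distr c ((ℤ.+ suc d) ^ i)
             (eval₁ p (ℤ.+ suc d)) ((q^ (suc d ℕ.* suc z)) n)) ⟩
      ∑ n (λ d → ∑ n λ z → c * f d z + g d z)
        ≡⟨ ∑∑-linear n c f g ⟩
      c * ∑ n (λ d → ∑ n (f d)) + ∑ n (λ d → ∑ n (g d))
        ≡⟨ cong₂ (λ x y → c * x + y) (sym (σ-expand i {n} ℕ.≤-refl)) (∑-eval₁ p n) ⟩
      _ ∎
      where
      f g : ℕ → ℕ → ℤ
      f d z = (ℤ.+ suc d) ^ i * (q^ (suc d ℕ.* suc z)) n
      g d z = eval₁ p (ℤ.+ suc d) * (q^ (suc d ℕ.* suc z)) n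

      distr : ∀ c x e r → (c * x + e) * r ≡ c * (x * r) + e * r
      distr = solve-∀

    hexagonal-cong : ∀ h {x y x′ y′} → u x y ≡ u x′ y′ → v x y ≡ v x′ y′ → hexagonal h x y ≡ hexagonal h x′ y′
    hexagonal-cong h = cong₂ (eval₂ h)

    module _ (h : Poly₂) where

      hexagonal-sym : ∀ x y → hexagonal h x y ≡ hexagonal h y x
      hexagonal-sym x y = hexagonal-cong h {x} {y} {y} {x}
        (S.solve 2 (λ x y → x :* x :+ x :* y :+ y :* y := y :* y :+ y :* x :+ x :* x) x y)
        (S.solve 2 (λ x y → x :* y :* (x :+ y) :* (x :* y :* (x :+ y)) := y :* x :* (y :+ x) :*
            (y :* x :* (y :+ x))) x y)

      hexagonal-left : ∀ x y → hexagonal h (x + y) (- y) ≡ hexagonal h x y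
      hexagonal-left x y = hexagonal-cong h {x + y} { - y} {x} {y}
        (S.solve 2 (λ x y → (x :+ y) :* (x :+ y) :+ (x :+ y) :* (:- y) :+ (:- y) :*
            (:- y) := x :* x :+ x :* y :+ y :* y) x y)
        (S.solve 2 (λ x y → (x :+ y) :* (:- y) :* ((x :+ y) :+ (:- y)) :*
            ((x :+ y) :* (:- y) :* ((x :+ y) :+ (:- y)))
          := x :* y :* (x :+ y) :* (x :* y :* (x :+ y))) x y)

      hexagonal-right : ∀ x y → hexagonal h x (- (y + x)) ≡ hexagonal h x y
      hexagonal-right x y = hexagonal-cong h {x} { - (y + x)} {x} {y}
        (S.solve 2 (λ x y → let z = :- (y :+ x) in x :* x :+ x :* z :+ z :* z := x :* x :+ x :* y :+ y :* y) x y)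
        (S.solve 2 (λ x y → let z = :- (y :+ x) in x :* z :* (x :+ z) :* (x :* z :* (x :+ z))
          := x :* y :* (x :+ y) :* (x :* y :* (x :+ y))) x y)

  private
    eval₁ᴾ : ∀ {m} → Poly₁ → Polynomial m → Polynomial m
    eval₁ᴾ []            x = con 0ℤ
    eval₁ᴾ ((c , i) ∷ p) x = con c :* x :^ i :+ eval₁ᴾ p x

    eval₂ᴾ : ∀ {m} → Poly₂ → Polynomial m → Polynomial m → Polynomial m
    eval₂ᴾ []                x y = con 0ℤ
    eval₂ᴾ ((c , i , j) ∷ p) x y = con c :* (x :^ i :* y :^ j) :+ eval₂ᴾ p x y

    hexagonalᴾ : ∀ {m} → Poly₂ → Polynomial m → Polynomial m → Polynomial m
    hexagonalᴾ h x y = eval₂ᴾ h (x :* x :+ x :* y :+ y :* y) (x :* y :* (x :+ y) :* (x :* y :* (x :+ y)))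

    x₀ : ∀ {m} → Polynomial (suc m)
    x₀ = var zero

    x₁ : ∀ {m} → Polynomial (suc (suc m))
    x₁ = var (suc zero)

    odd-equation step-equation : Poly₂ → ℤ → Poly₂ → Polynomial 2 × Polynomial 2
    odd-equation h κ A = con κ :* (hexagonalᴾ h x₀ x₁ :- hexagonalᴾ h x₀ (:- x₁)) := eval₂ᴾ A x₀ x₁
    step-equation h κ W = eval₂ᴾ W (x₀ :+ con 1ℤ) x₁ :- eval₂ᴾ W x₀ x₁ := con κ :* hexagonalᴾ h x₀ (x₁ :- x₀)

    ends-equation : Poly₂ → ℤ → Poly₂ → Poly₁ → Polynomial 1 × Polynomial 1
    ends-equation h κ W B =
      eval₂ᴾ W x₀ x₀ :- eval₂ᴾ W (con 1ℤ) x₀ :+ con κ :* hexagonalᴾ h x₀ (:- x₀) := eval₁ᴾ B x₀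

    diagonal-equation : Poly₂ → ℤ → ℤ → ℕ → Polynomial 1 × Polynomial 1
    diagonal-equation h κ t e = con κ :* hexagonalᴾ h x₀ (:- x₀) := con t :* x₀ :^ suc e

    ^-semantics : ∀ {m} (x : Polynomial m) i ρ → S.⟦ x :^ i ⟧ ρ ≡ S.⟦ x ⟧ ρ ^ i
    ^-semantics x zero    ρ = refl
    ^-semantics x (suc i) ρ = cong (S.⟦ x ⟧ ρ *_) (^-semantics x i ρ)

    eval₁-semantics : ∀ {m} p (x : Polynomial m) ρ → S.⟦ eval₁ᴾ p x ⟧ ρ ≡ eval₁ p (S.⟦ x ⟧ ρ)
    eval₁-semantics []            x ρ = refl
    eval₁-semantics ((c , i) ∷ p) x ρ =
      cong₂ (λ a b → c * a + b) (^-semantics x i ρ) (eval₁-semantics p x ρ)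

    eval₂-semantics : ∀ {m} p (x y : Polynomial m) ρ →
      S.⟦ eval₂ᴾ p x y ⟧ ρ ≡ eval₂ p (S.⟦ x ⟧ ρ) (S.⟦ y ⟧ ρ)
    eval₂-semantics []                x y ρ = refl
    eval₂-semantics ((c , i , j) ∷ p) x y ρ = cong₂ (λ a b → c * a + b)
      (cong₂ _*_ (^-semantics x i ρ) (^-semantics y j ρ)) (eval₂-semantics p x y ρ)

    hexagonal-semantics : ∀ {m} h (x y : Polynomial m) ρ →
      S.⟦ hexagonalᴾ h x y ⟧ ρ ≡ hexagonal h (S.⟦ x ⟧ ρ) (S.⟦ y ⟧ ρ)
    hexagonal-semantics h x y ρ =
      eval₂-semantics h (x :* x :+ x :* y :+ y :* y) (x :* y :* (x :+ y) :* (x :* y :* (x :+ y))) ρ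

  -- With H = κ h(u , v), the four checked equations say that A is H a b - H a (- b),
  -- W an antidifference of a ↦ H a (d - a), B the sum of H a b over a + b = d with
  -- a , b > 0 plus H d (- d), and t d^(e+1) the value H d (- d).
  convolution-relation : ∀ (h A W : Poly₂) (B : Poly₁) κ t e →
    {_ : S.Valid (odd-equation h κ A)} {_ : S.Valid (step-equation h κ W)}
    {_ : S.Valid (ends-equation h κ W B)} {_ : S.Valid (diagonal-equation h κ t e)} →
    ∀ n → convolutionSum A n ≡ divisorSum B n - t * D (s e) n
  convolution-relation h A W B κ t e {v-odd} {v-step} {v-ends} {v-diagonal} n = begin
    convolutionSum A n
      ≡⟨ ∑-eval₂ A n ⟨
    ∑⁺ n (λ a → ∑⁺ n λ b → eval₂ A (ℤ.+ a) (ℤ.+ b) * reps n a b)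
      ≡⟨ ∑-cong n (λ a → trans (∑-cong n λ b → trans
          (cong (_* reps n (suc a) (suc b)) (sym (odd (ℤ.+ suc a) (ℤ.+ suc b))))
           (ℤ.*-assoc κ (H (ℤ.+ suc a) (ℤ.+ suc b) - H (ℤ.+ suc a) (- ℤ.+ suc b)) (reps n (suc a) (suc b))))
           (∑-distribˡ-* n κ (λ b → (H (ℤ.+ suc a) (ℤ.+ suc b) - H (ℤ.+ suc a) (- ℤ.+ suc b)) * reps n
               (suc a) (suc b)))) ⟩
    ∑ n (λ a → κ * left (suc a))
      ≡⟨ ∑-distribˡ-* n κ (λ a → left (suc a)) ⟩
    κ * ∑⁺ n left
      ≡⟨ cong (κ *_) (liouville n H (hexagonal-sym h) (hexagonal-left h) (hexagonal-right h)) ⟩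
    κ * ∑ n (λ d → ∑ n (right d))
      ≡⟨ trans (∑-cong n λ d → ∑-distribˡ-* n κ (right d)) (∑-distribˡ-* n κ (λ d → ∑ n (right d))) ⟨
    ∑ n (λ d → ∑ n λ z → κ * right d z)
      ≡⟨ ∑-cong n (λ d → ∑-cong n (term d)) ⟩
    ∑ n (λ d → ∑ n λ z → - t * f d z + g d z)
      ≡⟨ ∑∑-linear n (- t) f g ⟩
    - t * ∑ n (λ d → ∑ n (f d)) + ∑ n (λ d → ∑ n (g d))
      ≡⟨ cong₂ (λ x y → - t * x + y) n-σ (∑-eval₁ B n) ⟩
    - t * D (s e) n + divisorSum B n
      ≡⟨ flip t (D (s e) n) (divisorSum B n) ⟩
    divisorSum B n - t * D (s e) n ∎
    where
    H = hexagonal h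

    odd : ∀ a b → κ * (H a b - H a (- b)) ≡ eval₂ A a b
    odd a b = trans (sym (cong₂ (λ i j → κ * (i - j)) (hexagonal-semantics h x₀ x₁ ρ)
        (hexagonal-semantics h x₀ (:- x₁) ρ)))
      (trans (S.sound (odd-equation h κ A) v-odd ρ) (eval₂-semantics A x₀ x₁ ρ))
      where ρ = a ∷ b ∷ []

    step : ∀ a d → eval₂ W (a + 1ℤ) d - eval₂ W a d ≡ κ * H a (d - a)
    step a d = trans (sym (cong₂ _-_ (eval₂-semantics W (x₀ :+ con 1ℤ) x₁ ρ) (eval₂-semantics W x₀ x₁ ρ)))
      (trans (S.sound (step-equation h κ W) v-step ρ) (cong (κ *_) (hexagonal-semantics h x₀ (x₁ :- x₀) ρ)))
      where ρ = a ∷ d ∷ []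

    ends : ∀ d → eval₂ W d d - eval₂ W 1ℤ d + κ * H d (- d) ≡ eval₁ B d
    ends d = trans (sym (cong₂ _+_ (cong₂ _-_ (eval₂-semantics W x₀ x₀ ρ) (eval₂-semantics W (con 1ℤ) x₀ ρ))
        (cong (κ *_) (hexagonal-semantics h x₀ (:- x₀) ρ))))
      (trans (S.sound (ends-equation h κ W B) v-ends ρ) (eval₁-semantics B x₀ ρ))
      where ρ = d ∷ []

    diagonal : ∀ d → κ * H d (- d) ≡ t * d ^ suc e
    diagonal d = trans (sym (cong (κ *_) (hexagonal-semantics h x₀ (:- x₀) ρ)))
      (trans (S.sound (diagonal-equation h κ t e) v-diagonal ρ) (cong (t *_) (^-semantics x₀ (suc e) ρ)))
      where ρ = d ∷ []

    left : ℕ → ℤ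
    left a = ∑⁺ n λ b → (H (ℤ.+ a) (ℤ.+ b) - H (ℤ.+ a) (- ℤ.+ b)) * reps n a b

    q : ℕ → ℕ → ℤ
    q d z = (q^ (suc d ℕ.* suc z)) n

    antidiag : ℕ → ℤ
    antidiag d = ∑ d λ i → H (ℤ.+ suc i) (ℤ.+ (suc d ∸ suc i))

    right f g : ℕ → ℕ → ℤ
    right d z = q d z * (antidiag d - (ℤ.+ suc z - 1ℤ) * H (ℤ.+ suc d) (- ℤ.+ suc d))
    f d z = ℤ.+ n * ((ℤ.+ suc d) ^ e * q d z)
    g d z = eval₁ B (ℤ.+ suc d) * q d z

    flip : ∀ t x y → - t * x + y ≡ y - t * x
    flip = solve-∀

    antidiag-W : ∀ d → κ * antidiag d ≡ eval₂ W (ℤ.+ suc d) (ℤ.+ suc d) - eval₂ W 1ℤ (ℤ.+ suc d)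
    antidiag-W d = begin
      κ * antidiag d
        ≡⟨ ∑-distribˡ-* d κ (λ i → H (ℤ.+ suc i) (ℤ.+ (suc d ∸ suc i))) ⟨
      ∑ d (λ i → κ * H (ℤ.+ suc i) (ℤ.+ (suc d ∸ suc i)))
        ≡⟨ ∑-cong-< d (λ i i<d → trans (cong (λ b → κ * H (ℤ.+ suc i) b) (minus i i<d))
             (trans (sym (step (ℤ.+ suc i) (ℤ.+ suc d)))
               (cong (λ a → eval₂ W a (ℤ.+ suc d) - eval₂ W (ℤ.+ suc i) (ℤ.+ suc d))
                   (ℤ.+-comm (ℤ.+ suc i) 1ℤ)))) ⟩
      ∑ d (λ i → F (suc i) - F i)
        ≡⟨ ∑-telescope d F ⟩
      _ ∎
      where
      F : ℕ → ℤ
      F i = eval₂ W (ℤ.+ suc i) (ℤ.+ suc d)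

      minus : ∀ i → i < d → ℤ.+ (suc d ∸ suc i) ≡ ℤ.+ suc d - ℤ.+ suc i
      minus i i<d = sym (trans (ℤ.m-n≡m⊖n (suc d) (suc i)) (ℤ.⊖-≥ (s≤s (ℕ.<⇒≤ i<d))))

    -- The coefficient `q d z` vanishes unless the two factors multiply to n. This exchange turns
    -- the weight z d^(e+1) into n d^e, hence into the coefficient of `D (s e)`.
    n-q : ∀ d z → ℤ.+ suc d * (ℤ.+ suc z * q d z) ≡ ℤ.+ n * q d z
    n-q d z = trans (sym (ℤ.*-assoc (ℤ.+ suc d) (ℤ.+ suc z) (q d z)))
      (trans (cong (_* q d z) (sym (ℤ.pos-* (suc d) (suc z)))) (sym (D-q^ (suc d ℕ.* suc z) n)))

    term : ∀ d z → κ * right d z ≡ - t * f d z + g d z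
    term d z = begin
      κ * right d z
        ≡⟨ expand κ (q d z) (antidiag d) (ℤ.+ suc z) (H (ℤ.+ suc d) (- ℤ.+ suc d)) ⟩
      -- Here - (z - 1) H = H - z H: the first part joins the antidiagonal sum to form `B`, the
      -- second supplies the derivative term.
      (κ * antidiag d + κH) * q d z - ℤ.+ suc z * κH * q d z
        ≡⟨ cong₂ (λ x y → x * q d z - ℤ.+ suc z * y * q d z)
             (trans (cong (_+ κH) (antidiag-W d)) (ends (ℤ.+ suc d))) (diagonal (ℤ.+ suc d)) ⟩
      g d z - ℤ.+ suc z * (t * (ℤ.+ suc d) ^ suc e) * q d z
        ≡⟨ collect (g d z) t (ℤ.+ suc d) (ℤ.+ suc z) ((ℤ.+ suc d) ^ e) (q d z) ⟩
      - t * ((ℤ.+ suc d) ^ e * (ℤ.+ suc d * (ℤ.+ suc z * q d z))) + g d z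
        ≡⟨ cong (λ x → - t * ((ℤ.+ suc d) ^ e * x) + g d z) (n-q d z) ⟩
      - t * ((ℤ.+ suc d) ^ e * (ℤ.+ n * q d z)) + g d z
        ≡⟨ swap (- t) ((ℤ.+ suc d) ^ e) (ℤ.+ n) (q d z) (g d z) ⟩
      _ ∎
      where
      κH = κ * H (ℤ.+ suc d) (- ℤ.+ suc d)

      expand : ∀ k q a z h → k * (q * (a - (z - 1ℤ) * h)) ≡ (k * a + k * h) * q - z * (k * h) * q
      expand = solve-∀

      collect : ∀ g t d z p q → g - z * (t * (d * p)) * q ≡ - t * (p * (d * (z * q))) + g
      collect = solve-∀

      swap : ∀ t p m q g → t * (p * (m * q)) + g ≡ t * (m * (p * q)) + g
      swap = solve-∀

    n-σ : ∑ n (λ d → ∑ n (f d)) ≡ D (s e) n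
    n-σ = trans (∑-cong n λ d → ∑-distribˡ-* n (ℤ.+ n) (λ z → (ℤ.+ suc d) ^ e * q d z))
      (trans (∑-distribˡ-* n (ℤ.+ n) (λ d → ∑ n λ z → (ℤ.+ suc d) ^ e * q d z))
        (cong (ℤ.+ n *_) (sym (σ-expand e {n} ℕ.≤-refl))))

  -- H = u: H a b - H a (- b) = 2 a b, and H d (- d) = d². Here and below `κ` clears the
  -- denominators of the power sums that make up `W`.
  σ₁σ₁ : ∀ n → convolutionSum ((ℤ.+ 12 , 1 , 1) ∷ []) n ≡
    divisorSum ((ℤ.+ 5 , 3) ∷ (ℤ.+ 1 , 1) ∷ []) n - ℤ.+ 6 * D (s 1) n
  σ₁σ₁ = convolution-relation h A W B κ t 1
    where
    κ = ℤ.+ 6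
    t = ℤ.+ 6
    h = (ℤ.+ 1 , 1 , 0) ∷ []
    A = (ℤ.+ 12 , 1 , 1) ∷ []
    B = (ℤ.+ 5 , 3) ∷ (ℤ.+ 1 , 1) ∷ []
    W = (ℤ.+ 2 , 3 , 0) ∷ (- ℤ.+ 3 , 2 , 1) ∷ (- ℤ.+ 3 , 2 , 0) ∷ (ℤ.+ 6 , 1 , 2) ∷ (ℤ.+ 3 , 1 , 1) ∷
         (ℤ.+ 1 , 1 , 0) ∷ []

  σ₁σ₃ : ∀ n → convolutionSum ((ℤ.+ 120 , 3 , 1) ∷ (ℤ.+ 120 , 1 , 3) ∷ []) n ≡
    divisorSum ((ℤ.+ 21 , 5) ∷ (ℤ.+ 10 , 3) ∷ (- ℤ.+ 1 , 1) ∷ []) n - ℤ.+ 30 * D (s 3) n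
  σ₁σ₃ = convolution-relation h A W B κ t 3
    where
    κ = ℤ.+ 30
    t = ℤ.+ 30
    h = (ℤ.+ 1 , 2 , 0) ∷ []
    A = (ℤ.+ 120 , 3 , 1) ∷ (ℤ.+ 120 , 1 , 3) ∷ []
    B = (ℤ.+ 21 , 5) ∷ (ℤ.+ 10 , 3) ∷ (- ℤ.+ 1 , 1) ∷ []
    W = (ℤ.+ 6 , 5 , 0) ∷ (- ℤ.+ 15 , 4 , 1) ∷ (- ℤ.+ 15 , 4 , 0) ∷ (ℤ.+ 30 , 3 , 2) ∷ (ℤ.+ 30 , 3 , 1) ∷
         (ℤ.+ 10 , 3 , 0) ∷ (- ℤ.+ 30 , 2 , 3) ∷ (- ℤ.+ 45 , 2 , 2) ∷ (- ℤ.+ 15 , 2 , 1) ∷ (ℤ.+ 30 , 1 , 4) ∷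
         (ℤ.+ 30 , 1 , 3) ∷ (ℤ.+ 15 , 1 , 2) ∷ (- ℤ.+ 1 , 1 , 0) ∷ []

  -- The differences H a b - H a (- b) of u³ and v contain 14 a³ b³ and 4 a³ b³; in 2 u³ - 7 v these
  -- cancel, leaving 12 (a⁵ b + a b⁵).
  σ₁σ₅ : ∀ n → convolutionSum ((ℤ.+ 504 , 5 , 1) ∷ (ℤ.+ 504 , 1 , 5) ∷ []) n ≡
    divisorSum ((ℤ.+ 40 , 7) ∷ (ℤ.+ 42 , 5) ∷ (ℤ.+ 2 , 1) ∷ []) n - ℤ.+ 84 * D (s 5) n
  σ₁σ₅ = convolution-relation h A W B κ t 5
    where
    κ = ℤ.+ 42
    t = ℤ.+ 84
    h = (ℤ.+ 2 , 3 , 0) ∷ (- ℤ.+ 7 , 0 , 1) ∷ []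
    A = (ℤ.+ 504 , 5 , 1) ∷ (ℤ.+ 504 , 1 , 5) ∷ []
    B = (ℤ.+ 40 , 7) ∷ (ℤ.+ 42 , 5) ∷ (ℤ.+ 2 , 1) ∷ []
    W = (ℤ.+ 12 , 7 , 0) ∷ (- ℤ.+ 42 , 6 , 1) ∷ (- ℤ.+ 42 , 6 , 0) ∷ (ℤ.+ 42 , 5 , 2) ∷ (ℤ.+ 126 , 5 , 1) ∷
         (ℤ.+ 42 , 5 , 0) ∷ (- ℤ.+ 105 , 4 , 2) ∷ (- ℤ.+ 105 , 4 , 1) ∷ (ℤ.+ 70 , 3 , 4) ∷ (ℤ.+ 70 , 3 , 2) ∷
         (- ℤ.+ 14 , 3 , 0) ∷ (- ℤ.+ 126 , 2 , 5) ∷ (- ℤ.+ 105 , 2 , 4) ∷ (ℤ.+ 21 , 2 , 1) ∷ (ℤ.+ 84 , 1 , 6) ∷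
         (ℤ.+ 126 , 1 , 5) ∷ (ℤ.+ 35 , 1 , 4) ∷ (- ℤ.+ 7 , 1 , 2) ∷ (ℤ.+ 2 , 1 , 0) ∷ []

  -- As v vanishes at (d , - d), `t` is 0 and there is no derivative term; the same holds for u v
  -- and u² v.
  σ₃σ₃ : ∀ n → convolutionSum ((ℤ.+ 120 , 3 , 3) ∷ []) n ≡
    divisorSum ((ℤ.+ 1 , 7) ∷ (- ℤ.+ 1 , 3) ∷ []) n - ℤ.+ 0 * D (s 0) n
  σ₃σ₃ = convolution-relation h A W B κ t 0
    where
    κ = ℤ.+ 30
    t = ℤ.+ 0
    h = (ℤ.+ 1 , 0 , 1) ∷ []
    A = (ℤ.+ 120 , 3 , 3) ∷ []
    B = (ℤ.+ 1 , 7) ∷ (- ℤ.+ 1 , 3) ∷ []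
    W = (ℤ.+ 6 , 5 , 2) ∷ (- ℤ.+ 15 , 4 , 3) ∷ (- ℤ.+ 15 , 4 , 2) ∷ (ℤ.+ 10 , 3 , 4) ∷ (ℤ.+ 30 , 3 , 3) ∷
         (ℤ.+ 10 , 3 , 2) ∷ (- ℤ.+ 15 , 2 , 4) ∷ (- ℤ.+ 15 , 2 , 3) ∷ (ℤ.+ 5 , 1 , 4) ∷ (- ℤ.+ 1 , 1 , 2) ∷ []

  σ₃σ₅ : ∀ n → convolutionSum ((ℤ.+ 2520 , 5 , 3) ∷ (ℤ.+ 2520 , 3 , 5) ∷ []) n ≡
    divisorSum ((ℤ.+ 11 , 9) ∷ (- ℤ.+ 21 , 5) ∷ (ℤ.+ 10 , 3) ∷ []) n - ℤ.+ 0 * D (s 0) n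
  σ₃σ₅ = convolution-relation h A W B κ t 0
    where
    κ = ℤ.+ 420
    t = ℤ.+ 0
    h = (ℤ.+ 1 , 1 , 1) ∷ []
    A = (ℤ.+ 2520 , 5 , 3) ∷ (ℤ.+ 2520 , 3 , 5) ∷ []
    B = (ℤ.+ 11 , 9) ∷ (- ℤ.+ 21 , 5) ∷ (ℤ.+ 10 , 3) ∷ []
    W = (ℤ.+ 60 , 7 , 2) ∷ (- ℤ.+ 210 , 6 , 3) ∷ (- ℤ.+ 210 , 6 , 2) ∷ (ℤ.+ 336 , 5 , 4) ∷ (ℤ.+ 630 , 5 , 3) ∷
         (ℤ.+ 210 , 5 , 2) ∷ (- ℤ.+ 315 , 4 , 5) ∷ (- ℤ.+ 840 , 4 , 4) ∷ (- ℤ.+ 525 , 4 , 3) ∷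
             (ℤ.+ 140 , 3 , 6) ∷
         (ℤ.+ 630 , 3 , 5) ∷ (ℤ.+ 560 , 3 , 4) ∷ (- ℤ.+ 70 , 3 , 2) ∷ (- ℤ.+ 210 , 2 , 6) ∷
             (- ℤ.+ 315 , 2 , 5) ∷
         (ℤ.+ 105 , 2 , 3) ∷ (ℤ.+ 70 , 1 , 6) ∷ (- ℤ.+ 56 , 1 , 4) ∷ (ℤ.+ 10 , 1 , 2) ∷ []

  -- The difference for u² v is 4 a³ b³ (2 a⁴ + 5 a² b² + 2 b⁴). It is the only multiple of v of
  -- this degree, so the products s₃ s₇ and s₅ s₅ come together; hence both Q³ and R² in the
  -- relation for E₁₂.
  σ₃σ₇ : ∀ n → convolutionSum ((ℤ.+ 5040 , 7 , 3) ∷ (ℤ.+ 12600 , 5 , 5) ∷ (ℤ.+ 5040 , 3 , 7) ∷ []) n ≡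
    divisorSum ((ℤ.+ 13 , 11) ∷ (- ℤ.+ 42 , 7) ∷ (ℤ.+ 50 , 5) ∷ (- ℤ.+ 21 , 3) ∷ []) n - ℤ.+ 0 * D (s 0) n
  σ₃σ₇ = convolution-relation h A W B κ t 0
    where
    κ = ℤ.+ 630
    t = ℤ.+ 0
    h = (ℤ.+ 1 , 2 , 1) ∷ []
    A = (ℤ.+ 5040 , 7 , 3) ∷ (ℤ.+ 12600 , 5 , 5) ∷ (ℤ.+ 5040 , 3 , 7) ∷ []
    B = (ℤ.+ 13 , 11) ∷ (- ℤ.+ 42 , 7) ∷ (ℤ.+ 50 , 5) ∷ (- ℤ.+ 21 , 3) ∷ []
    W = (ℤ.+ 70 , 9 , 2) ∷ (- ℤ.+ 315 , 8 , 3) ∷ (- ℤ.+ 315 , 8 , 2) ∷ (ℤ.+ 720 , 7 , 4) ∷ (ℤ.+ 1260 , 7 , 3) ∷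
         (ℤ.+ 420 , 7 , 2) ∷ (- ℤ.+ 1050 , 6 , 5) ∷ (- ℤ.+ 2520 , 6 , 4) ∷ (- ℤ.+ 1470 , 6 , 3) ∷
             (ℤ.+ 1008 , 5 , 6) ∷
         (ℤ.+ 3150 , 5 , 5) ∷ (ℤ.+ 2520 , 5 , 4) ∷ (- ℤ.+ 294 , 5 , 2) ∷ (- ℤ.+ 630 , 4 , 7) ∷
             (- ℤ.+ 2520 , 4 , 6) ∷
         (- ℤ.+ 2625 , 4 , 5) ∷ (ℤ.+ 735 , 4 , 3) ∷ (ℤ.+ 210 , 3 , 8) ∷ (ℤ.+ 1260 , 3 , 7) ∷
             (ℤ.+ 1680 , 3 , 6) ∷
         (- ℤ.+ 840 , 3 , 4) ∷ (ℤ.+ 140 , 3 , 2) ∷ (- ℤ.+ 315 , 2 , 8) ∷ (- ℤ.+ 630 , 2 , 7) ∷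
             (ℤ.+ 525 , 2 , 5) ∷
         (- ℤ.+ 210 , 2 , 3) ∷ (ℤ.+ 105 , 1 , 8) ∷ (- ℤ.+ 168 , 1 , 6) ∷ (ℤ.+ 120 , 1 , 4) ∷
             (- ℤ.+ 21 , 1 , 2) ∷ []

-- Logarithmic differentiation of the product for τ

module ProductDerivative where

  open import Data.Integer.Base using (_+_; _*_; _-_; -_; _^_)
  open FiniteSums
  open LiouvilleIdentity using (∑⁺; q^-below)
  open PowerSeries
  open DivisorSums

  module LogarithmicDerivative (N : ℕ) where

    open Truncated N
    open CommutativeRing commutativeRing using
        (setoid; refl; sym; trans; +-cong; *-cong; *-congˡ; *-congʳ; -‿cong)
    open Solver using (solve; con; _:+_; _:*_; :-_; _:^_; _:=_)

    D-product : ∀ f g → D (f ⊛ g) ≈ (D f ⊛ g) ⊕ (f ⊛ D g)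
    D-product f g = pointwise (D-⊛ f g)

    -- j q^j / (1 - q^j) modulo q^(N+1)
    geometric : ℕ → Series
    geometric j m = ∑⁺ N λ z → ℤ.+ j * (q^ (j ℕ.* z)) m

    private
      geometric-product : ∀ j → geometric (suc j) ⊛ (q^ 0 ⊖ q^ suc j) ≈ (λ n → ℤ.+ suc j * (q^ suc j) n)
      geometric-product j = coeffs λ n n≤N → coefficient n n≤N
        where
        J = suc j

        shift : ∀ i n → n ≤ N → (q^ i ⊛ (q^ 0 ⊖ q^ J)) n ≡ (q^ i) n - (q^ (i ℕ.+ J)) n
        shift i n n≤N = ≡.trans
          -- `x :^ 0` stands for the unit `q^ 0` itself, whereas `con 1ℤ` would denote `const 1ℤ`,
          -- which has the same values but another form.
          (coeff (solve 2 (λ x y → x :* (x :^ 0 :+ :- y) := x :+ :- (x :* y)) (q^ i) (q^ J)) n n≤N)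
          (cong (λ c → (q^ i) n - c) (q^-⊛ i J n))

        coefficient : ∀ n → n ≤ N → (geometric J ⊛ (q^ 0 ⊖ q^ J)) n ≡ ℤ.+ J * (q^ J) n
        coefficient n n≤N = begin
          (geometric J ⊛ (q^ 0 ⊖ q^ J)) n
            ≡⟨ ⊛-∑ˡ N (λ z m → ℤ.+ J * (q^ (J ℕ.* suc z)) m) (q^ 0 ⊖ q^ J) n ⟩
          ∑ N (λ z → ((λ m → ℤ.+ J * (q^ (J ℕ.* suc z)) m) ⊛ (q^ 0 ⊖ q^ J)) n)
            ≡⟨ ∑-cong N (λ z → ≡.trans (⊛-scaleˡ (ℤ.+ J) (q^ (J ℕ.* suc z)) (q^ 0 ⊖ q^ J) n)
                 (cong (ℤ.+ J *_) (≡.trans (shift (J ℕ.* suc z) n n≤N)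
                   (≡.trans (cong (λ e → (q^ (J ℕ.* suc z)) n - (q^ e) n)
                       (≡.trans (ℕ.+-comm (J ℕ.* suc z) J) (≡.sym (ℕ.*-suc J (suc z)))))
                     (flip ((q^ (J ℕ.* suc z)) n) ((q^ (J ℕ.* suc (suc z))) n)))))) ⟩
          ∑ N (λ z → ℤ.+ J * (F (suc z) - F z))
            ≡⟨ ∑-distribˡ-* N (ℤ.+ J) (λ z → F (suc z) - F z) ⟩
          ℤ.+ J * ∑ N (λ z → F (suc z) - F z)
            ≡⟨ cong (ℤ.+ J *_) (∑-telescope N F) ⟩
          ℤ.+ J * (F N - F 0)
            -- The upper end of the telescope is the monomial of degree J (N + 1) > N, invisible
            -- modulo q^(N+1).
            ≡⟨ cong (ℤ.+ J *_) (cong₂ (λ a b → - a - - b)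
                 (q^-below (ℕ.<-≤-trans (s≤s n≤N) (ℕ.m≤n*m (suc N) J)))
                 (cong (λ e → (q^ e) n) (ℕ.*-identityʳ J))) ⟩
          ℤ.+ J * (0ℤ - - (q^ J) n)
            ≡⟨ cong (ℤ.+ J *_) (neg² ((q^ J) n)) ⟩
          ℤ.+ J * (q^ J) n ∎
          where
          open ≡-Reasoning
          F : ℕ → ℤ
          F z = - (q^ (J ℕ.* suc z)) n

          flip : ∀ a b → a - b ≡ - b - - a
          flip = solve-∀

          neg² : ∀ a → 0ℤ - - a ≡ a
          neg² = solve-∀

    -- A logarithmic derivative g of f is kept in the form D f = g f: such g add up over products,
    -- and no series has to be inverted.
    binomial-derivative : ∀ j → D (q^ 0 ⊖ q^ suc j) ≈ ⊝ (geometric (suc j) ⊛ (q^ 0 ⊖ q^ suc j))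
    binomial-derivative j = trans (pointwise eq) (-‿cong (sym (geometric-product j)))
      where
      eq : ∀ n → D (q^ 0 ⊖ q^ suc j) n ≡ - (ℤ.+ suc j * (q^ suc j) n)
      eq n = ≡.trans (distr (ℤ.+ n) ((q^ 0) n) ((q^ suc j) n))
        (≡.trans (cong₂ _-_ (D-q^ 0 n) (D-q^ (suc j) n)) (ℤ.+-identityˡ (- (ℤ.+ suc j * (q^ suc j) n))))
        where
        distr : ∀ m a b → m * (a - b) ≡ m * a - m * b
        distr = solve-∀

    factor-derivative : ∀ e j → D (factor e (suc j)) ≈ ⊝ (const (ℤ.+ e) ⊛ geometric (suc j)) ⊛ factor e (suc j)
    factor-derivative zero    j = trans (pointwise (D-q^ 0))
      (solve 1 (λ g → con 0ℤ := :- (con 0ℤ :* g) :* g :^ 0) (geometric (suc j)))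
    factor-derivative (suc e) j = begin
      D (F ⊛ Fᵉ)
        ≈⟨ D-product F Fᵉ ⟩
      (D F ⊛ Fᵉ) ⊕ (F ⊛ D Fᵉ)
        ≈⟨ +-cong (*-congʳ {Fᵉ} (binomial-derivative j)) (*-congˡ {F} (factor-derivative e j)) ⟩
      (⊝ (L ⊛ F) ⊛ Fᵉ) ⊕ (F ⊛ (⊝ (const (ℤ.+ e) ⊛ L) ⊛ Fᵉ))
        ≈⟨ solve 4 (λ L F Fᵉ e → :- (L :* F) :* Fᵉ :+ F :* (:- (e :* L) :* Fᵉ) := :- ((con 1ℤ :+ e) :* L) :*
            (F :* Fᵉ))
             L F Fᵉ (const (ℤ.+ e)) ⟩
      ⊝ ((const 1ℤ ⊕ const (ℤ.+ e)) ⊛ L) ⊛ (F ⊛ Fᵉ)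
        ≈⟨ *-congʳ {F ⊛ Fᵉ} (-‿cong (*-congʳ {L}
            (pointwise λ i → ≡.sym (ℤ.*-distribʳ-+ ((q^ 0) i) 1ℤ (ℤ.+ e))))) ⟩
      ⊝ (const (ℤ.+ suc e) ⊛ L) ⊛ (F ⊛ Fᵉ) ∎
      where
      open SetoidReasoning setoid
      L = geometric (suc j)
      F = q^ 0 ⊖ q^ suc j
      Fᵉ = factor e (suc j)

    partialProduct-derivative : ∀ e M → D (partialProduct (factor e) M) ≈
      ⊝ (const (ℤ.+ e) ⊛ (λ m → ∑⁺ M λ j → geometric j m)) ⊛ partialProduct (factor e) M
    partialProduct-derivative e zero    = trans (pointwise (D-q^ 0))
      (trans (solve 1 (λ e → con 0ℤ := :- (e :* con 0ℤ) :* e :^ 0) (const (ℤ.+ e)))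
        (*-congʳ (-‿cong (*-congˡ {const (ℤ.+ e)} (pointwise λ i → ℤ.*-zeroˡ ((q^ 0) i))))))
    partialProduct-derivative e (suc M) = begin
      D (F ⊛ G)
        ≈⟨ D-product F G ⟩
      (D F ⊛ G) ⊕ (F ⊛ D G)
        ≈⟨ +-cong (*-congʳ {G} (factor-derivative e M)) (*-congˡ {F} (partialProduct-derivative e M)) ⟩
      (⊝ (E ⊛ L) ⊛ F ⊛ G) ⊕ (F ⊛ (⊝ (E ⊛ L′) ⊛ G))
        ≈⟨ solve 5 (λ E L L′ F G → :- (E :* L) :* F :* G :+ F :* (:- (E :* L′) :* G) := :-
            (E :* (L′ :+ L)) :* (F :* G))
             E L L′ F G ⟩
      ⊝ (E ⊛ (L′ ⊕ L)) ⊛ (F ⊛ G)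
        ≈⟨ *-congʳ {F ⊛ G} (-‿cong (*-congˡ {E}
            (pointwise λ i → ≡.sym (∑-last M (λ j → geometric (suc j) i))))) ⟩
      _ ∎
      where
      open SetoidReasoning setoid
      E = const (ℤ.+ e)
      L = geometric (suc M)
      L′ : Series
      L′ m = ∑⁺ M λ j → geometric j m
      F = factor e (suc M)
      G = partialProduct (factor e) M

    -- Up to q^N the product agrees with its N-th partial product, and the sum of the first N
    -- geometric series is the Lambert series of σ₁.
    ∏-derivative : ∀ e → D (∏ (factor e)) ≈ ⊝ (const (ℤ.+ e) ⊛ s 1) ⊛ ∏ (factor e)
    ∏-derivative e = trans (D-cong (sym truncate)) (trans (partialProduct-derivative e N)
      (*-cong (-‿cong (*-congˡ {const (ℤ.+ e)} lambert)) truncate))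
      where
      truncate : partialProduct (factor e) N ≈ ∏ (factor e)
      truncate = coeffs λ i i≤N → ∏-stable e i≤N

      lambert : (λ m → ∑⁺ N λ j → geometric j m) ≈ s 1
      lambert = coeffs λ i i≤N → ≡.trans
        (∑-cong N λ j → ∑-cong N λ z → cong (_* (q^ (suc j ℕ.* suc z)) i) (≡.sym (ℤ.^-identityʳ (ℤ.+ suc j))))
        (≡.sym (σ-expand 1 i≤N))

    τ-derivative : D τ ≈ (q^ 0 ⊕ ⊝ (const (ℤ.+ 24) ⊛ s 1)) ⊛ τ
    τ-derivative = begin
      D (q^ 1 ⊛ Π)
        ≈⟨ D-product (q^ 1) Π ⟩
      (D (q^ 1) ⊛ Π) ⊕ (q^ 1 ⊛ D Π)
        ≈⟨ +-cong (*-congʳ {Π} (pointwise λ i → ≡.trans (D-q^ 1 i) (ℤ.*-identityˡ ((q^ 1) i))))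
            (*-congˡ {q^ 1} (∏-derivative 24)) ⟩
      (q^ 1 ⊛ Π) ⊕ (q^ 1 ⊛ (⊝ (const (ℤ.+ 24) ⊛ s 1) ⊛ Π))
        ≈⟨ solve 3 (λ q Π s → q :* Π :+ q :* (:- (con (ℤ.+ 24) :* s) :* Π) :=
            (q :^ 0 :+ :- (con (ℤ.+ 24) :* s)) :* (q :* Π))
             (q^ 1) Π (s 1) ⟩
      _ ∎
      where
      open SetoidReasoning setoid
      Π = ∏ (factor 24)

-- Ramanujan's system and Rankin-Cohen brackets in an abstract differential ring

module DifferentialRing {c ℓ} (𝓡 : CommutativeRing c ℓ)
  (hom : CommutativeRing.rawRing ℤ.+-*-commutativeRing -Raw-AlmostCommutative⟶ fromCommutativeRing 𝓡)
  where

  open CommutativeRing 𝓡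
  open _-Raw-AlmostCommutative⟶_ hom renaming (⟦_⟧ to κ)
  open IntegerCoefficients 𝓡 hom

  infixr 9 _·_ _:·_

  _·_ : ℕ → Carrier → Carrier
  n · x = κ (ℤ.+ n) * x

  _:·_ : ∀ {m} → ℕ → Polynomial m → Polynomial m
  n :· p = con (ℤ.+ n) :* p

  module Derivation
    (D : Carrier → Carrier)
    (D-cong : ∀ {x y} → x ≈ y → D x ≈ D y)
    (D-+ : ∀ x y → D (x + y) ≈ D x + D y)
    (D-neg : ∀ x → D (- x) ≈ - D x)
    (D-* : ∀ x y → D (x * y) ≈ D x * y + x * D y)
    (D-κ : ∀ c → D (κ c) ≈ 0#)
    -- This stands in for division: `cancel 479` divides by 480.
    (cancel : ∀ n {x y} → suc n · x ≈ suc n · y → x ≈ y)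
    where

    private
      :1 : ∀ {m} → Polynomial m
      :1 = con 1ℤ

      D-scale : ∀ n x → D (n · x) ≈ n · D x
      D-scale n x = trans (D-* (κ (ℤ.+ n)) x)
        (trans (+-congʳ (trans (*-congʳ (D-κ (ℤ.+ n))) (zeroˡ x))) (+-identityˡ _))

      D-minus : ∀ x y → D (x - y) ≈ D x - D y
      D-minus x y = trans (D-+ x (- y)) (+-congˡ (D-neg y))

      D-κ+ : ∀ c x → D (κ c + x) ≈ D x
      D-κ+ c x = trans (D-+ (κ c) x) (trans (+-congʳ (D-κ c)) (+-identityˡ _))

      D-scale-cong : ∀ n {x y} → D x ≈ y → D (n · x) ≈ n · y
      D-scale-cong n {x} eq = trans (D-scale n x) (*-congˡ eq)

      D-*-cong : ∀ {x y x′ y′} → D x ≈ x′ → D y ≈ y′ → D (x * y) ≈ x′ * y + x * y′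
      D-*-cong {x} {y} eq eq′ = trans (D-* x y) (+-cong (*-congʳ eq) (*-congˡ eq′))

      D-+-cong : ∀ {x y x′ y′} → D x ≈ x′ → D y ≈ y′ → D (x + y) ≈ x′ + y′
      D-+-cong {x} {y} eq eq′ = trans (D-+ x y) (+-cong eq eq′)

      D-minus-cong : ∀ {x y x′ y′} → D x ≈ x′ → D y ≈ y′ → D (x - y) ≈ x′ - y′
      D-minus-cong {x} {y} eq eq′ = trans (D-minus x y) (+-cong eq (-‿cong eq′))

    module Eisenstein (s₁ s₃ s₅ s₇ s₉ s₁₁ : Carrier)
      (s₁s₁ : 12 · (s₁ * s₁) ≈ 5 · s₃ + s₁ - 6 · D s₁)
      (s₁s₃ : 240 · (s₁ * s₃) ≈ 21 · s₅ + 10 · s₃ - s₁ - 30 · D s₃)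
      (s₁s₅ : 1008 · (s₁ * s₅) ≈ 40 · s₇ + 42 · s₅ + 2 · s₁ - 84 · D s₅)
      (s₃s₃ : 120 · (s₃ * s₃) ≈ s₇ - s₃)
      (s₃s₅ : 5040 · (s₃ * s₅) ≈ 11 · s₉ - 21 · s₅ + 10 · s₃)
      (s₃s₇ : 10080 · (s₃ * s₇) + 12600 · (s₅ * s₅) ≈ 13 · s₁₁ - 42 · s₇ + 50 · s₅ - 21 · s₃)
      where

      P Q R : Carrier
      P = κ 1ℤ - 24 · s₁
      Q = κ 1ℤ + 240 · s₃
      R = κ 1ℤ - 504 · s₅

      private
        :P :Q :R : ∀ {m} → Polynomial m → Polynomial m
        :P s = :1 :- 24 :· s
        :Q s = :1 :+ 240 :· s
        :R s = :1 :- 504 :· s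

        d₁ d₃ d₅ d₇ d₉ d₁₁ dd₃ dd₅ dd₇ dd₁₁ : Carrier
        d₁ = D s₁
        d₃ = D s₃
        d₅ = D s₅
        d₇ = D s₇
        d₉ = D s₉
        d₁₁ = D s₁₁
        dd₃ = D d₃
        dd₅ = D d₅
        dd₇ = D d₇
        dd₁₁ = D d₁₁

        DP : D P ≈ - (24 · d₁)
        DP = trans (D-κ+ 1ℤ _) (trans (D-neg _) (-‿cong (D-scale 24 s₁)))

        DQ : D Q ≈ 240 · d₃
        DQ = trans (D-κ+ 1ℤ _) (D-scale 240 s₃)

        DR : D R ≈ - (504 · d₅)
        DR = trans (D-κ+ 1ℤ _) (trans (D-neg _) (-‿cong (D-scale 504 s₅)))

      -- Since D P = - 24 d₁, this is half of 24 D P = 2 (P² - Q). The multiplier 48 = 24² / 12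
      -- matches the term s₁ s₁ of P².
      ramanujan-P : 288 · d₁ ≈ Q - P * P
      ramanujan-P = trans (solve 3 (λ s₁ s₃ d₁ → 288 :· d₁ := :Q s₃ :- :P s₁ :* :P s₁
          :+ con (ℤ.+ 48) :* (12 :· (s₁ :* s₁) :- (5 :· s₃ :+ s₁ :- 6 :· d₁))) s₁ s₃ d₁)
        (drop s₁s₁ _)

      ramanujan-Q : 720 · d₃ ≈ P * Q - R
      ramanujan-Q = trans (solve 4 (λ s₁ s₃ s₅ d₃ → 720 :· d₃ := :P s₁ :* :Q s₃ :- :R s₅
          :+ con (ℤ.+ 24) :* (240 :· (s₁ :* s₃) :- (21 :· s₅ :+ 10 :· s₃ :- s₁ :- 30 :· d₃))) s₁ s₃ s₅ d₃)
        (drop s₁s₃ _)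

      ramanujan-R : 1008 · d₅ ≈ Q * Q - P * R
      ramanujan-R = trans (solve 5 (λ s₁ s₃ s₅ s₇ d₅ → 1008 :· d₅ := :Q s₃ :* :Q s₃ :- :P s₁ :* :R s₅
          :+ con (ℤ.+ 12) :* (1008 :· (s₁ :* s₅) :- (40 :· s₇ :+ 42 :· s₅ :+ 2 :· s₁ :- 84 :· d₅))
          :+ con (ℤ.- ℤ.+ 480) :* (120 :· (s₃ :* s₃) :- (s₇ :- s₃))) s₁ s₃ s₅ s₇ d₅)
        (trans (drop s₃s₃ _) (drop s₁s₅ _))

      E₈≈Q² : κ 1ℤ + 480 · s₇ ≈ Q * Q
      E₈≈Q² = trans (solve 2 (λ s₃ s₇ → :1 :+ 480 :· s₇ := :Q s₃ :* :Q s₃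
          :+ con (ℤ.- ℤ.+ 480) :* (120 :· (s₃ :* s₃) :- (s₇ :- s₃))) s₃ s₇)
        (drop s₃s₃ _)

      E₁₀≈QR : κ 1ℤ - 264 · s₉ ≈ Q * R
      E₁₀≈QR = trans (solve 3 (λ s₃ s₅ s₉ → :1 :- 264 :· s₉ := :Q s₃ :* :R s₅
          :+ con (ℤ.+ 24) :* (5040 :· (s₃ :* s₅) :- (11 :· s₉ :- 21 :· s₅ :+ 10 :· s₃))) s₃ s₅ s₉)
        (drop s₃s₅ _)

      -- The ratio 441 : 250 is forced by the ratio 10080 : 12600 in `s₃s₇`: 441 · 240 · 480 = 5040
      -- · 10080 for Q E₈, and 250 · 504² = 5040 · 12600 for R². Then E₈ is replaced by Q².
      691E₁₂ : κ (ℤ.+ 691) + 65520 · s₁₁ ≈ 441 · (Q * Q * Q) + 250 · (R * R)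
      691E₁₂ = trans (solve 4 (λ s₃ s₅ s₇ s₁₁ → let Q = :Q s₃ ; R = :R s₅ in
          con (ℤ.+ 691) :+ 65520 :· s₁₁ := 441 :· (Q :* Q :* Q) :+ 250 :· (R :* R)
          :+ 441 :· Q :* (:1 :+ 480 :· s₇ :- Q :* Q)
          :+ con (ℤ.- ℤ.+ 5040) :* (10080 :· (s₃ :* s₇) :+ 12600 :· (s₅ :* s₅)
               :- (13 :· s₁₁ :- 42 :· s₇ :+ 50 :· s₅ :- 21 :· s₃))) s₃ s₅ s₇ s₁₁)
        (trans (drop s₃s₇ _) (drop E₈≈Q² _))

      Q³-R² : Carrier
      Q³-R² = Q * Q * Q - R * R

      -- In 3 Q² D Q - 2 R D R = Q² (P Q - R) - R (P R - Q²) the terms Q² R cancel.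
      D-Q³-R² : D Q³-R² ≈ P * Q³-R²
      D-Q³-R² = trans (D-minus-cong (D-*-cong (D-*-cong DQ DQ) DQ) (D-*-cong DR DR))
        (trans (solve 5 (λ P Q R d₃ d₅ →
          ((240 :· d₃ :* Q :+ Q :* 240 :· d₃) :* Q :+ Q :* Q :* 240 :· d₃)
            :- (:- (504 :· d₅) :* R :+ R :* (:- (504 :· d₅)))
          := P :* (Q :* Q :* Q :- R :* R)
            :+ Q :* Q :* (720 :· d₃ :- (P :* Q :- R))
            :+ R :* (1008 :· d₅ :- (Q :* Q :- P :* R))) P Q R d₃ d₅)
        (trans (drop ramanujan-R _) (drop ramanujan-Q _)))

      private
        D-ramanujan-Q : 720 · dd₃ ≈ - (24 · d₁) * Q + P * 240 · d₃ - - (504 · d₅)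
        D-ramanujan-Q = trans (sym (D-scale 720 d₃)) (trans (D-cong ramanujan-Q)
          (D-minus-cong (D-*-cong DP DQ) DR))

        D-ramanujan-R : 1008 · dd₅ ≈ (240 · d₃ * Q + Q * 240 · d₃) - (- (24 · d₁) * R + P * (- (504 · d₅)))
        D-ramanujan-R = trans (sym (D-scale 1008 d₅)) (trans (D-cong ramanujan-R)
          (D-minus-cong (D-*-cong DQ DQ) (D-*-cong DP DR)))

        d₇≈ : d₇ ≈ Q * d₃
        d₇≈ = cancel 479 (trans (sym (trans (D-κ+ 1ℤ _) (D-scale 480 s₇))) (trans (D-cong E₈≈Q²)
          (trans (D-*-cong DQ DQ) (solve 2 (λ Q d₃ → 240 :· d₃ :* Q :+ Q :* 240 :· d₃ := 480 :·
              (Q :* d₃)) Q d₃))))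

        dd₇≈ : dd₇ ≈ 240 · (d₃ * d₃) + Q * dd₃
        dd₇≈ = trans (D-cong d₇≈) (trans (D-*-cong DQ refl) (+-congʳ (*-assoc _ d₃ d₃)))

        d₉≈ : 11 · d₉ ≈ 21 · (Q * d₅) - 10 · (R * d₃)
        d₉≈ = cancel 23 (trans (solve 1 (λ d₉ → 24 :· 11 :· d₉ := :- (:- (264 :· d₉))) d₉)
          (trans (-‿cong (trans (sym (trans (D-κ+ 1ℤ _) (trans (D-neg _) (-‿cong (D-scale 264 s₉)))))
            (trans (D-cong E₁₀≈QR) (D-*-cong DQ DR))))
          (solve 4 (λ Q R d₃ d₅ → :- (240 :· d₃ :* R :+ Q :* (:- (504 :· d₅)))
            := 24 :· (21 :· (Q :* d₅) :- 10 :· (R :* d₃))) Q R d₃ d₅)))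

      module Discriminant (τ : Carrier) (1728τ : 1728 · τ ≈ Q³-R²) where

        private
          dτ ddτ : Carrier
          dτ = D τ
          ddτ = D dτ

          -- The Rankin–Cohen brackets [Q , R]₁, [Q , Q]₂ and [R , R]₂ are cusp forms of
          -- weight 12, 12 and 16.
          bracket-QR : 12 · τ ≈ 5 · (R * d₃) + 7 · (Q * d₅)
          bracket-QR = cancel 143 (trans (solve 6 (λ P Q R d₃ d₅ τ →
              144 :· 12 :· τ := 144 :· (5 :· (R :* d₃) :+ 7 :· (Q :* d₅))
              :+ :1 :* (1728 :· τ :- (Q :* Q :* Q :- R :* R))
              :+ (:- R) :* (720 :· d₃ :- (P :* Q :- R))
              :+ (:- Q) :* (1008 :· d₅ :- (Q :* Q :- P :* R))) P Q R d₃ d₅ τ)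
            (trans (drop ramanujan-R _) (trans (drop ramanujan-Q _) (drop 1728τ _))))

          -- [Q , Q]₂ = 20 Q D² Q - 25 (D Q)² with D Q = 240 d₃; dividing by 4800 gives the constant
          -- 300.
          bracket-QQ : τ ≈ Q * dd₃ - 300 · (d₃ * d₃)
          bracket-QQ = cancel 34559 (trans (solve 8 (λ P Q R d₁ d₃ d₅ dd₃ τ →
              34560 :· τ := 34560 :· (Q :* dd₃ :- 300 :· (d₃ :* d₃))
              :+ (:- (48 :· Q)) :* (720 :· dd₃ :- (:- (24 :· d₁) :* Q :+ P :* 240 :· d₃ :- :- (504 :· d₅)))
              :+ 4 :· (Q :* Q) :* (288 :· d₁ :- (Q :- P :* P))
              -- The square (720 d₃)² is replaced by (P Q - R)² as a difference of squares, whence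
              -- the multiplier 720 d₃ + P Q - R.
              :+ (20 :· (720 :· d₃ :+ P :* Q :- R) :- 16 :· (Q :* P)) :* (720 :· d₃ :- (P :* Q :- R))
              :+ (:- (24 :· Q)) :* (1008 :· d₅ :- (Q :* Q :- P :* R))
              :+ con (ℤ.+ 20) :* (1728 :· τ :- (Q :* Q :* Q :- R :* R))) P Q R d₁ d₃ d₅ dd₃ τ)
            (trans (drop 1728τ _) (trans (drop ramanujan-R _) (trans (drop ramanujan-Q _)
              (trans (drop ramanujan-P _) (drop D-ramanujan-Q _))))))

          -- [R , R]₂ = 42 R D² R - 49 (D R)² with D R = - 504 d₅, so 588 = 49 · 504 / 42.
          bracket-RR : Q * τ ≈ R * dd₅ + 588 · (d₅ * d₅)
          bracket-RR = cancel 12095 (trans (solve 8 (λ P Q R d₁ d₃ d₅ dd₅ τ →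
              12096 :· (Q :* τ) := 12096 :· (R :* dd₅ :+ 588 :· (d₅ :* d₅))
              :+ 7 :· Q :* (1728 :· τ :- (Q :* Q :* Q :- R :* R))
              :+ (:- (12 :· R)) :* (1008 :· dd₅ :- ((240 :· d₃ :* Q :+ Q :* 240 :· d₃)
                   :- (:- (24 :· d₁) :* R :+ P :* (:- (504 :· d₅)))))
              :+ (:- (8 :· (Q :* R))) :* (720 :· d₃ :- (P :* Q :- R))
              :+ (:- (R :* R)) :* (288 :· d₁ :- (Q :- P :* P))
              :+ (:- (6 :· (P :* R) :+ 7 :· (1008 :· d₅ :+ Q :* Q :- P :* R))) :*
                  (1008 :· d₅ :- (Q :* Q :- P :* R)))
              P Q R d₁ d₃ d₅ dd₅ τ)
            (trans (drop ramanujan-R _) (trans (drop ramanujan-P _) (trans (drop ramanujan-Q _)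
              (trans (drop D-ramanujan-R _) (drop 1728τ _))))))

          -- 441 Q³ + 250 R² = 441 (Q³ - R²) + 691 R², and 762048 = 441 · 1728.
          E₁₂-discriminant : κ (ℤ.+ 691) + 65520 · s₁₁ ≈ 762048 · τ + 691 · (R * R)
          E₁₂-discriminant = trans (solve 4 (λ Q R s₁₁ τ →
              con (ℤ.+ 691) :+ 65520 :· s₁₁ := 762048 :· τ :+ 691 :· (R :* R)
              :+ :1 :* (con (ℤ.+ 691) :+ 65520 :· s₁₁ :- (441 :· (Q :* Q :* Q) :+ 250 :· (R :* R)))
              :+ con (ℤ.- ℤ.+ 441) :* (1728 :· τ :- (Q :* Q :* Q :- R :* R))) Q R s₁₁ τ)
            (trans (drop 1728τ _) (drop 691E₁₂ _))

          D-E₁₂ : 65520 · d₁₁ ≈ 762048 · dτ - 691 · 1008 · (R * d₅)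
          D-E₁₂ = trans (sym (trans (D-κ+ (ℤ.+ 691) _) (D-scale 65520 s₁₁))) (trans (D-cong E₁₂-discriminant)
            (trans (D-+-cong (D-scale 762048 τ) (D-scale-cong 691 (D-*-cong DR DR)))
              (solve 3 (λ R d₅ dτ → 762048 :· dτ :+ 691 :· (:- (504 :· d₅) :* R :+ R :* (:- (504 :· d₅)))
                := 762048 :· dτ :- 691 :· 1008 :· (R :* d₅)) R d₅ dτ)))

          DD-E₁₂ : 65520 · dd₁₁ ≈ 762048 · ddτ - 691 · 1008 · (- (504 · d₅) * d₅ + R * dd₅)
          DD-E₁₂ = trans (sym (D-scale 65520 d₁₁)) (trans (D-cong D-E₁₂)
            (D-minus-cong (D-scale 762048 dτ) (D-scale-cong 691 (D-scale-cong 1008 (D-*-cong DR refl)))))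

          -- In `DD-E₁₂` the term R dd₅ becomes Q τ - 588 d₅². Division by 84 gives 780 = 65520 /
          -- 84, 8292 = 691 · 1008 / 84 and 9054864 = 8292 (504 + 588).
          DDτ : 9072 · ddτ ≈ 780 · dd₁₁ - 9054864 · (d₅ * d₅) + 8292 · (Q * τ)
          DDτ = cancel 83 (trans (solve 7 (λ Q R d₅ dd₅ dd₁₁ τ ddτ →
              84 :· 9072 :· ddτ := 84 :· (780 :· dd₁₁ :- 9054864 :· (d₅ :* d₅) :+ 8292 :· (Q :* τ))
              :+ con (ℤ.- ℤ.+ 1) :* (65520 :· dd₁₁ :-
                  (762048 :· ddτ :- 691 :· 1008 :· (:- (504 :· d₅) :* d₅ :+ R :* dd₅)))
              :+ con (ℤ.- ℤ.+ 696528) :* (Q :* τ :- (R :* dd₅ :+ 588 :· (d₅ :* d₅)))) Q R d₅ dd₅ dd₁₁ τ ddτ)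
            (trans (drop bracket-RR _) (drop DD-E₁₂ _)))

        τ-i : 12 · τ ≈ 5 · d₃ + 7 · d₅ + 840 · (2 · (s₃ * d₅) - 3 · (d₃ * s₅))
        τ-i = trans bracket-QR (solve 4 (λ s₃ s₅ d₃ d₅ → 5 :· (:R s₅ :* d₃) :+ 7 :· (:Q s₃ :* d₅)
          := 5 :· d₃ :+ 7 :· d₅ :+ 840 :· (2 :· (s₃ :* d₅) :- 3 :· (d₃ :* s₅))) s₃ s₅ d₃ d₅)

        τ-ii : τ ≈ dd₃ + 60 · (4 · (s₃ * dd₃) - 5 · (d₃ * d₃))
        τ-ii = trans bracket-QQ (solve 3 (λ s₃ d₃ dd₃ → :Q s₃ :* dd₃ :- 300 :· (d₃ :* d₃)
          := dd₃ :+ 60 :· (4 :· (s₃ :* dd₃) :- 5 :· (d₃ :* d₃))) s₃ d₃ dd₃)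

        private
          -- The brackets [E₆ , E₈]₁, [E₄ , E₈]₂ and [E₄ , E₁₀]₁ of weight 16.
          Qτ-57 : 12 · (Q * τ) ≈ 5 · d₇ + 7 · d₅ - 840 · (3 · (s₅ * d₇) - 4 · (d₅ * s₇))
          -- This is Q times `bracket-QR`, with Q d₃ = d₇ and Q² = E₈.
          Qτ-57 = trans (solve 7 (λ Q s₅ s₇ d₃ d₅ d₇ τ → let R = :R s₅ in
              12 :· (Q :* τ) := 5 :· d₇ :+ 7 :· d₅ :- 840 :· (3 :· (s₅ :* d₇) :- 4 :· (d₅ :* s₇))
              :+ Q :* (12 :· τ :- (5 :· (R :* d₃) :+ 7 :· (Q :* d₅)))
              :+ (:- (5 :· R)) :* (d₇ :- Q :* d₃)
              :+ (:- (7 :· d₅)) :* (:1 :+ 480 :· s₇ :- Q :* Q)) Q s₅ s₇ d₃ d₅ d₇ τ)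
            (trans (drop E₈≈Q² _) (trans (drop d₇≈ _) (drop bracket-QR _)))

          Qτ-37 : 14 · (Q * τ) ≈ 9 · dd₃ + 5 · dd₇ + 120 · (36 · (dd₃ * s₇) - 45 · (d₃ * d₇) + 10 · (s₃ * dd₇))
          -- The weights 36, 45, 10 are the coefficients C(9,2), 9 · 5, C(5,2) of [E₄ , E₈]₂. In 14
          -- Q times `bracket-QQ`, the term 14 Q² dd₃ splits as 9 + 5: nine parts become E₈ dd₃,
          -- five become Q dd₇ by `dd₇≈`.
          Qτ-37 = trans (solve 7 (λ s₃ s₇ d₃ d₇ dd₃ dd₇ τ → let Q = :Q s₃ in
              14 :· (Q :* τ) := 9 :· dd₃ :+ 5 :· dd₇ :+ 120 :·
                  (36 :· (dd₃ :* s₇) :- 45 :· (d₃ :* d₇) :+ 10 :· (s₃ :* dd₇))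
              :+ 14 :· Q :* (τ :- (Q :* dd₃ :- 300 :· (d₃ :* d₃)))
              :+ (:- (9 :· dd₃)) :* (:1 :+ 480 :· s₇ :- Q :* Q)
              :+ (:- (5 :· Q)) :* (dd₇ :- (240 :· (d₃ :* d₃) :+ Q :* dd₃))
              :+ 5400 :· d₃ :* (d₇ :- Q :* d₃)) s₃ s₇ d₃ d₇ dd₃ dd₇ τ)
            (trans (drop d₇≈ _) (trans (drop dd₇≈ _) (trans (drop E₈≈Q² _) (drop bracket-QQ _))))

          Qτ-39 : 36 · (Q * τ) ≈ 25 · d₃ + 11 · d₉ - 1320 · (5 · (d₃ * s₉) - 2 · (s₃ * d₉))
          -- Three times Q `bracket-QR` contains 21 Q d₅, which `d₉≈` turns into 11 d₉ + 10 R d₃.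
          Qτ-39 = trans (solve 7 (λ s₃ R s₉ d₃ d₅ d₉ τ → let Q = :Q s₃ in
              36 :· (Q :* τ) := 25 :· d₃ :+ 11 :· d₉ :- 1320 :· (5 :· (d₃ :* s₉) :- 2 :· (s₃ :* d₉))
              :+ 3 :· Q :* (12 :· τ :- (5 :· (R :* d₃) :+ 7 :· (Q :* d₅)))
              :+ (:- (25 :· d₃)) :* (:1 :- 264 :· s₉ :- Q :* R)
              :+ (:- Q) :* (11 :· d₉ :- (21 :· (Q :* d₅) :- 10 :· (R :* d₃)))) s₃ R s₉ d₃ d₅ d₉ τ)
            (trans (drop d₉≈ _) (trans (drop E₁₀≈QR _) (drop bracket-QR _)))

        -- 9072, 10584 and 27216 are the common denominators of (iii), (iv) and (v).
        τ-iii : 9072 · ddτ ≈ 780 · dd₁₁ + 3455 · d₇ + 4837 · d₅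
          - 580440 · (3 · (s₅ * d₇) - 4 · (d₅ * s₇)) - 9054864 · (d₅ * d₅)
        τ-iii = trans (solve 8 (λ s₅ s₇ d₅ d₇ dd₁₁ Q τ ddτ →
            9072 :· ddτ := 780 :· dd₁₁ :+ 3455 :· d₇ :+ 4837 :· d₅
              :- 580440 :· (3 :· (s₅ :* d₇) :- 4 :· (d₅ :* s₇)) :- 9054864 :· (d₅ :* d₅)
            :+ :1 :* (9072 :· ddτ :- (780 :· dd₁₁ :- 9054864 :· (d₅ :* d₅) :+ 8292 :· (Q :* τ)))
            :+ con (ℤ.+ 691) :* (12 :· (Q :* τ) :-
                (5 :· d₇ :+ 7 :· d₅ :- 840 :· (3 :· (s₅ :* d₇) :- 4 :· (d₅ :* s₇)))))
            s₅ s₇ d₅ d₇ dd₁₁ Q τ ddτ)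
          (trans (drop Qτ-57 _) (drop DDτ _))

        τ-iv : 10584 · ddτ ≈ 910 · dd₁₁ + 6219 · dd₃ + 3455 · dd₇
          + 82920 · (36 · (dd₃ * s₇) - 45 · (d₃ * d₇) + 10 · (s₃ * dd₇)) - 10564008 · (d₅ * d₅)
        -- Since 7 · 8292 = 4146 · 14, seven times `DDτ` plus 4146 times `Qτ-37` eliminates Q τ; the
        -- result is divisible by 6.
        τ-iv = cancel 5 (trans (solve 11 (λ s₃ s₇ d₃ d₅ d₇ dd₃ dd₇ dd₁₁ Q τ ddτ →
            let B = 36 :· (dd₃ :* s₇) :- 45 :· (d₃ :* d₇) :+ 10 :· (s₃ :* dd₇) in
            6 :· 10584 :· ddτ := 6 :· (910 :· dd₁₁ :+ 6219 :· dd₃ :+ 3455 :· dd₇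
              :+ 82920 :· B :- 10564008 :· (d₅ :* d₅))
            :+ con (ℤ.+ 7) :* (9072 :· ddτ :- (780 :· dd₁₁ :- 9054864 :· (d₅ :* d₅) :+ 8292 :· (Q :* τ)))
            :+ con (ℤ.+ 4146) :* (14 :· (Q :* τ) :- (9 :· dd₃ :+ 5 :· dd₇ :+ 120 :· B)))
            s₃ s₇ d₃ d₅ d₇ dd₃ dd₇ dd₁₁ Q τ ddτ)
          (trans (drop Qτ-37 _) (drop DDτ _)))

        τ-v : 27216 · ddτ ≈ 2340 · dd₁₁ + 17275 · d₃ + 7601 · d₉
          - 912120 · (5 · (d₃ * s₉) - 2 · (s₃ * d₉)) - 27164592 · (d₅ * d₅)
        τ-v = trans (solve 9 (λ s₃ s₉ d₃ d₅ d₉ dd₁₁ Q τ ddτ →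
            27216 :· ddτ := 2340 :· dd₁₁ :+ 17275 :· d₃ :+ 7601 :· d₉
              :- 912120 :· (5 :· (d₃ :* s₉) :- 2 :· (s₃ :* d₉)) :- 27164592 :· (d₅ :* d₅)
            :+ con (ℤ.+ 3) :* (9072 :· ddτ :- (780 :· dd₁₁ :- 9054864 :· (d₅ :* d₅) :+ 8292 :· (Q :* τ)))
            :+ con (ℤ.+ 691) :* (36 :· (Q :* τ) :-
                (25 :· d₃ :+ 11 :· d₉ :- 1320 :· (5 :· (d₃ :* s₉) :- 2 :· (s₃ :* d₉)))))
            s₃ s₉ d₃ d₅ d₉ dd₁₁ Q τ ddτ)
          (trans (drop Qτ-39 _) (drop DDτ _))

        -- Stated for an arbitrary additive functional: on a variable carrier the
        -- two sides are compared without unfolding any convolution.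
        module Functional (ev : Carrier → ℤ) (ev-cong : ∀ {x y} → x ≈ y → ev x ≡ ev y)
          (ev-+ : ∀ x y → ev (x + y) ≡ ev x ℤ.+ ev y) (ev-neg : ∀ x → ev (- x) ≡ ℤ.- ev x)
          (ev-· : ∀ n x → ev (n · x) ≡ ℤ.+ n ℤ.* ev x)
          where

          private
            infixl 6 _⟨+⟩_ _⟨-⟩_

            _⟨+⟩_ : ∀ {x y a b} → ev x ≡ a → ev y ≡ b → ev (x + y) ≡ a ℤ.+ b
            p ⟨+⟩ q = ≡.trans (ev-+ _ _) (≡.cong₂ ℤ._+_ p q)

            _⟨-⟩_ : ∀ {x y a b} → ev x ≡ a → ev y ≡ b → ev (x - y) ≡ a ℤ.- b
            p ⟨-⟩ q = p ⟨+⟩ ≡.trans (ev-neg _) (≡.cong ℤ.-_ q)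

            scale : ∀ n {x a} → ev x ≡ a → ev (n · x) ≡ ℤ.+ n ℤ.* a
            scale n p = ≡.trans (ev-· n _) (≡.cong (ℤ.+ n ℤ.*_) p)

          ev-i : ∀ t a b x y → ev τ ≡ t → ev (D s₃) ≡ a → ev (D s₅) ≡ b →
            ev (s₃ * D s₅) ≡ x → ev (D s₃ * s₅) ≡ y →
            ℤ.+ 12 ℤ.* t ≡ ℤ.+ 5 ℤ.* a ℤ.+ ℤ.+ 7 ℤ.* b ℤ.+ ℤ.+ 840 ℤ.* (ℤ.+ 2 ℤ.* x ℤ.- ℤ.+ 3 ℤ.* y)
          ev-i t a b x y pt pa pb px py = ≡.trans (≡.sym (scale 12 pt)) (≡.trans (ev-cong τ-i)
            (scale 5 pa ⟨+⟩ scale 7 pb ⟨+⟩ scale 840 (scale 2 px ⟨-⟩ scale 3 py)))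

          ev-ii : ∀ t a x y → ev τ ≡ t → ev (D (D s₃)) ≡ a → ev (s₃ * D (D s₃)) ≡ x → ev (D s₃ * D s₃) ≡ y →
            t ≡ a ℤ.+ ℤ.+ 60 ℤ.* (ℤ.+ 4 ℤ.* x ℤ.- ℤ.+ 5 ℤ.* y)
          ev-ii t a x y pt pa px py = ≡.trans (≡.sym pt) (≡.trans (ev-cong τ-ii)
            (pa ⟨+⟩ scale 60 (scale 4 px ⟨-⟩ scale 5 py)))

          ev-iii : ∀ t a b c x y z → ev (D (D τ)) ≡ t →
            ev (D (D s₁₁)) ≡ a → ev (D s₇) ≡ b → ev (D s₅) ≡ c →
            ev (s₅ * D s₇) ≡ x → ev (D s₅ * s₇) ≡ y → ev (D s₅ * D s₅) ≡ z →
            ℤ.+ 9072 ℤ.* t ≡ ℤ.+ 780 ℤ.* a ℤ.+ ℤ.+ 3455 ℤ.* b ℤ.+ ℤ.+ 4837 ℤ.* c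
              ℤ.- ℤ.+ 580440 ℤ.* (ℤ.+ 3 ℤ.* x ℤ.- ℤ.+ 4 ℤ.* y) ℤ.- ℤ.+ 9054864 ℤ.* z
          ev-iii t a b c x y z pt pa pb pc px py pz = ≡.trans (≡.sym (scale 9072 pt)) (≡.trans (ev-cong τ-iii)
            (scale 780 pa ⟨+⟩ scale 3455 pb ⟨+⟩ scale 4837 pc
              ⟨-⟩ scale 580440 (scale 3 px ⟨-⟩ scale 4 py) ⟨-⟩ scale 9054864 pz))

          ev-iv : ∀ t a b c x y w z → ev (D (D τ)) ≡ t →
            ev (D (D s₁₁)) ≡ a → ev (D (D s₃)) ≡ b → ev (D (D s₇)) ≡ c →
            ev (D (D s₃) * s₇) ≡ x → ev (D s₃ * D s₇) ≡ y → ev (s₃ * D (D s₇)) ≡ w → ev (D s₅ * D s₅) ≡ z →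
            ℤ.+ 10584 ℤ.* t ≡ ℤ.+ 910 ℤ.* a ℤ.+ ℤ.+ 6219 ℤ.* b ℤ.+ ℤ.+ 3455 ℤ.* c
              ℤ.+ ℤ.+ 82920 ℤ.* (ℤ.+ 36 ℤ.* x ℤ.- ℤ.+ 45 ℤ.* y ℤ.+ ℤ.+ 10 ℤ.* w) ℤ.- ℤ.+ 10564008 ℤ.* z
          ev-iv t a b c x y w z pt pa pb pc px py pw pz = ≡.trans (≡.sym (scale 10584 pt))
              (≡.trans (ev-cong τ-iv)
            (scale 910 pa ⟨+⟩ scale 6219 pb ⟨+⟩ scale 3455 pc
              ⟨+⟩ scale 82920 (scale 36 px ⟨-⟩ scale 45 py ⟨+⟩ scale 10 pw) ⟨-⟩ scale 10564008 pz))

          ev-v : ∀ t a b c x y z → ev (D (D τ)) ≡ t →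
            ev (D (D s₁₁)) ≡ a → ev (D s₃) ≡ b → ev (D s₉) ≡ c →
            ev (D s₃ * s₉) ≡ x → ev (s₃ * D s₉) ≡ y → ev (D s₅ * D s₅) ≡ z →
            ℤ.+ 27216 ℤ.* t ≡ ℤ.+ 2340 ℤ.* a ℤ.+ ℤ.+ 17275 ℤ.* b ℤ.+ ℤ.+ 7601 ℤ.* c
              ℤ.- ℤ.+ 912120 ℤ.* (ℤ.+ 5 ℤ.* x ℤ.- ℤ.+ 2 ℤ.* y) ℤ.- ℤ.+ 27164592 ℤ.* z
          ev-v t a b c x y z pt pa pb pc px py pz = ≡.trans (≡.sym (scale 27216 pt)) (≡.trans (ev-cong τ-v)
            (scale 2340 pa ⟨+⟩ scale 17275 pb ⟨+⟩ scale 7601 pc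
              ⟨-⟩ scale 912120 (scale 5 px ⟨-⟩ scale 2 py) ⟨-⟩ scale 27164592 pz))

-- The discriminant identity and the coefficients at index N

module TauCoefficients where

  open import Data.Integer.Base using (_+_; _*_; _-_; -_)
  open FiniteSums
  open PowerSeries
  open DivisorSums
  open ConvolutionRelations
  open ProductDerivative

  module Coefficients (N : ℕ) where

    open Truncated N
    open CommutativeRing commutativeRing using (refl; sym; trans; +-cong; *-congˡ; *-congʳ; -‿cong)
    open Solver using (solve; con; _:+_; _:*_; :-_; _:-_; _:^_; _:=_)

    private
      D-⊕ : ∀ f g → D (f ⊕ g) ≈ D f ⊕ D g
      D-⊕ f g = pointwise λ i → ℤ.*-distribˡ-+ (ℤ.+ i) (f i) (g i)

      D-⊝ : ∀ f → D (⊝ f) ≈ ⊝ D f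
      D-⊝ f = pointwise λ i → ≡.sym (ℤ.neg-distribʳ-* (ℤ.+ i) (f i))

      D-const : ∀ c → D (const c) ≈ (λ _ → 0ℤ)
      D-const c = pointwise λ i → ≡.trans (swap (ℤ.+ i) c ((q^ 0) i))
        (≡.trans (cong (c *_) (D-q^ 0 i)) (ℤ.*-zeroʳ c))
        where
        swap : ∀ i c q → i * (c * q) ≡ c * (i * q)
        swap = solve-∀

      const-cancel : ∀ n {f g} → const (ℤ.+ suc n) ⊛ f ≈ const (ℤ.+ suc n) ⊛ g → f ≈ g
      const-cancel n {f} {g} e = coeffs λ i i≤N → ℤ.*-cancelˡ-≡ (ℤ.+ suc n) (f i) (g i)
        (≡.trans (≡.sym (const-⊛ (ℤ.+ suc n) f i)) (≡.trans (coeff e i i≤N) (const-⊛ (ℤ.+ suc n) g i)))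

      open DifferentialRing commutativeRing const-hom
      open Derivation D D-cong D-⊕ D-⊝ (λ f g → pointwise (D-⊛ f g)) D-const const-cancel

      scale : ∀ n f i → (n · f) i ≡ ℤ.+ n * f i
      scale n = const-⊛ (ℤ.+ n)

      r₁₁ : 12 · (s 1 ⊛ s 1) ≈ 5 · s 3 ⊕ s 1 ⊕ ⊝ 6 · D (s 1)
      r₁₁ = pointwise λ i → ≡.trans (scale 12 (s 1 ⊛ s 1) i)
          (≡.trans (≡.sym (ℤ.+-identityʳ (ℤ.+ 12 * (s 1 ⊛ s 1) i)))
        (≡.trans (σ₁σ₁ i) (≡.trans (shape (s 3 i) (s 1 i) (D (s 1) i))
          (≡.sym (cong₂ (λ x y → x + s 1 i - y) (scale 5 (s 3) i) (scale 6 (D (s 1)) i))))))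
        where
        shape : ∀ a b c → ℤ.+ 5 * a + (ℤ.+ 1 * b + 0ℤ) - ℤ.+ 6 * c ≡ ℤ.+ 5 * a + b - ℤ.+ 6 * c
        shape = solve-∀

      -- The two mixed convolutions, equal by commutativity, merge and double the coefficient 120.
      r₁₃ : 240 · (s 1 ⊛ s 3) ≈ 21 · s 5 ⊕ 10 · s 3 ⊕ ⊝ s 1 ⊕ ⊝ 30 · D (s 3)
      r₁₃ = pointwise λ i → ≡.trans (scale 240 (s 1 ⊛ s 3) i) (≡.trans (double ((s 1 ⊛ s 3) i))
        (≡.trans (cong (λ x → ℤ.+ 120 * x + (ℤ.+ 120 * (s 1 ⊛ s 3) i + 0ℤ)) (⊛-comm (s 1) (s 3) i))
        (≡.trans (σ₁σ₃ i) (≡.trans (shape (s 5 i) (s 3 i) (s 1 i) (D (s 3) i))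
          (≡.sym (cong₂ (λ x y → x + - s 1 i - y) (cong₂ _+_ (scale 21 (s 5) i) (scale 10 (s 3) i))
              (scale 30 (D (s 3)) i)))))))
        where
        double : ∀ x → ℤ.+ 240 * x ≡ ℤ.+ 120 * x + (ℤ.+ 120 * x + 0ℤ)
        double = solve-∀
        shape : ∀ a b c d → ℤ.+ 21 * a + (ℤ.+ 10 * b +
            (- ℤ.+ 1 * c + 0ℤ)) - ℤ.+ 30 * d ≡ ℤ.+ 21 * a + ℤ.+ 10 * b + - c - ℤ.+ 30 * d
        shape = solve-∀

      r₁₅ : 1008 · (s 1 ⊛ s 5) ≈ 40 · s 7 ⊕ 42 · s 5 ⊕ 2 · s 1 ⊕ ⊝ 84 · D (s 5)
      r₁₅ = pointwise λ i → ≡.trans (scale 1008 (s 1 ⊛ s 5) i) (≡.trans (double ((s 1 ⊛ s 5) i))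
        (≡.trans (cong (λ x → ℤ.+ 504 * x + (ℤ.+ 504 * (s 1 ⊛ s 5) i + 0ℤ)) (⊛-comm (s 1) (s 5) i))
        (≡.trans (σ₁σ₅ i) (≡.trans (shape (s 7 i) (s 5 i) (s 1 i) (D (s 5) i))
          (≡.sym (cong₂ _-_ (cong₂ _+_ (cong₂ _+_ (scale 40 (s 7) i) (scale 42 (s 5) i)) (scale 2 (s 1) i))
              (scale 84 (D (s 5)) i)))))))
        where
        double : ∀ x → ℤ.+ 1008 * x ≡ ℤ.+ 504 * x + (ℤ.+ 504 * x + 0ℤ)
        double = solve-∀
        shape : ∀ a b c d → ℤ.+ 40 * a + (ℤ.+ 42 * b +
            (ℤ.+ 2 * c + 0ℤ)) - ℤ.+ 84 * d ≡ ℤ.+ 40 * a + ℤ.+ 42 * b + ℤ.+ 2 * c - ℤ.+ 84 * d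
        shape = solve-∀

      r₃₃ : 120 · (s 3 ⊛ s 3) ≈ s 7 ⊕ ⊝ s 3
      r₃₃ = pointwise λ i → ≡.trans (scale 120 (s 3 ⊛ s 3) i)
          (≡.trans (≡.sym (ℤ.+-identityʳ (ℤ.+ 120 * (s 3 ⊛ s 3) i)))
        (≡.trans (σ₃σ₃ i) (shape (s 7 i) (s 3 i) (D (s 0) i))))
        where
        shape : ∀ a b c → ℤ.+ 1 * a + (- ℤ.+ 1 * b + 0ℤ) - ℤ.+ 0 * c ≡ a - b
        shape = solve-∀

      r₃₅ : 5040 · (s 3 ⊛ s 5) ≈ 11 · s 9 ⊕ ⊝ 21 · s 5 ⊕ 10 · s 3
      r₃₅ = pointwise λ i → ≡.trans (scale 5040 (s 3 ⊛ s 5) i) (≡.trans (double ((s 3 ⊛ s 5) i))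
        (≡.trans (cong (λ x → ℤ.+ 2520 * x + (ℤ.+ 2520 * (s 3 ⊛ s 5) i + 0ℤ)) (⊛-comm (s 3) (s 5) i))
        (≡.trans (σ₃σ₅ i) (≡.trans (shape (s 9 i) (s 5 i) (s 3 i) (D (s 0) i))
          (≡.sym (cong₂ _+_ (cong₂ _-_ (scale 11 (s 9) i) (scale 21 (s 5) i)) (scale 10 (s 3) i)))))))
        where
        double : ∀ x → ℤ.+ 5040 * x ≡ ℤ.+ 2520 * x + (ℤ.+ 2520 * x + 0ℤ)
        double = solve-∀
        shape : ∀ a b c d → ℤ.+ 11 * a + (- ℤ.+ 21 * b +
            (ℤ.+ 10 * c + 0ℤ)) - ℤ.+ 0 * d ≡ ℤ.+ 11 * a - ℤ.+ 21 * b + ℤ.+ 10 * c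
        shape = solve-∀

      r₃₇ : 10080 · (s 3 ⊛ s 7) ⊕ 12600 · (s 5 ⊛ s 5) ≈ 13 · s 11 ⊕ ⊝ 42 · s 7 ⊕ 50 · s 5 ⊕ ⊝ 21 · s 3
      r₃₇ = pointwise λ i → ≡.trans (cong₂ _+_ (scale 10080 (s 3 ⊛ s 7) i) (scale 12600 (s 5 ⊛ s 5) i))
        (≡.trans (double ((s 3 ⊛ s 7) i) ((s 5 ⊛ s 5) i))
        (≡.trans (cong (λ x → ℤ.+ 5040 * x + (ℤ.+ 12600 * (s 5 ⊛ s 5) i + (ℤ.+ 5040 * (s 3 ⊛ s 7) i + 0ℤ)))
            (⊛-comm (s 3) (s 7) i))
        (≡.trans (σ₃σ₇ i) (≡.trans (shape (s 11 i) (s 7 i) (s 5 i) (s 3 i) (D (s 0) i))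
          (≡.sym (cong₂ _-_ (cong₂ _+_ (cong₂ _-_ (scale 13 (s 11) i) (scale 42 (s 7) i)) (scale 50 (s 5) i))
              (scale 21 (s 3) i)))))))
        where
        double : ∀ x y → ℤ.+ 10080 * x + ℤ.+ 12600 * y ≡ ℤ.+ 5040 * x + (ℤ.+ 12600 * y + (ℤ.+ 5040 * x + 0ℤ))
        double = solve-∀
        shape : ∀ a b c d e → ℤ.+ 13 * a + (- ℤ.+ 42 * b + (ℤ.+ 50 * c + (- ℤ.+ 21 * d + 0ℤ))) - ℤ.+ 0 * e ≡
          ℤ.+ 13 * a - ℤ.+ 42 * b + ℤ.+ 50 * c - ℤ.+ 21 * d
        shape = solve-∀

      open Eisenstein (s 1) (s 3) (s 5) (s 7) (s 9) (s 11) r₁₁ r₁₃ r₁₅ r₃₃ r₃₅ r₃₇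

      -- The coefficient of q^n in D f ≈ P f reads (n - 1) f n = ∑_{k ≥ 1} P k · f (n - k).
      derivative-unique : ∀ p f → D f ≈ p ⊛ f → p 0 ≡ 1ℤ → f 0 ≡ 0ℤ → f 1 ≡ 0ℤ → ∀ n → n ≤ N → f n ≡ 0ℤ
      derivative-unique p f Df p₀ f₀ f₁ = <-rec _ step
        where
        step : ∀ n → (∀ {m} → m < n → m ≤ N → f m ≡ 0ℤ) → n ≤ N → f n ≡ 0ℤ
        step zero          rec n≤N = f₀
        -- At index 1 the factor n - 1 is 0 and the equation determines nothing, so this coefficient
        -- must be given.
        step (suc zero)    rec n≤N = f₁
        step (suc (suc n)) rec n≤N = ℤ.*-cancelˡ-≡ (ℤ.+ suc n) (f m) 0ℤ
          (≡.trans (split (ℤ.+ suc n) (f m)) (≡.trans (cong (_- f m) (coeff Df m n≤N))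
            (≡.trans (cong₂ (λ x y → x * f m + y - f m) p₀
              (∑-zero m λ k k<m → ≡.trans (cong (p (suc k) *_)
                  (rec (s≤s (ℕ.m∸n≤m (suc n) k)) (ℕ.≤-trans (ℕ.m∸n≤m m (suc k)) n≤N)))
                (ℤ.*-zeroʳ (p (suc k)))))
              (≡.trans (finish (f m)) (≡.sym (ℤ.*-zeroʳ (ℤ.+ suc n)))))))
          where
          m = suc (suc n)
          split : ∀ k x → k * x ≡ (1ℤ + k) * x - x
          split = solve-∀
          finish : ∀ x → 1ℤ * x + 0ℤ - x ≡ 0ℤ
          finish = solve-∀

      1728τ≈ : 1728 · τ ≈ Q³-R²
      1728τ≈ = coeffs λ i i≤N → ℤ.i-j≡0⇒i≡j ((1728 · τ) i) (Q³-R² i)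
        -- The coefficients at 0 and 1 are evaluated; that of q in Q³ - R² is 3 · 240 + 2 · 504 =
        -- 1728, the source of the constant.
        (derivative-unique P (1728 · τ ⊕ ⊝ Q³-R²) derivative ≡.refl ≡.refl ≡.refl i i≤N)
        where
        Dτ : D τ ≈ P ⊛ τ
        Dτ = trans (LogarithmicDerivative.τ-derivative N)
          (solve 2 (λ s t → (s :^ 0 :+ :- (con (ℤ.+ 24) :* s)) :* t := (con 1ℤ :- con (ℤ.+ 24) :* s) :* t)
              (s 1) τ)

        derivative : D (1728 · τ ⊕ ⊝ Q³-R²) ≈ P ⊛ (1728 · τ ⊕ ⊝ Q³-R²)
        derivative = trans (D-⊕ (1728 · τ) (⊝ Q³-R²)) (trans (+-cong
            (trans (pointwise λ i → ≡.trans (cong (ℤ.+ i *_) (scale 1728 τ i))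
                (≡.trans (swap (ℤ.+ i) (τ i)) (≡.sym (scale 1728 (D τ) i))))
              (*-congˡ {const (ℤ.+ 1728)} Dτ))
            (trans (D-⊝ Q³-R²) (-‿cong D-Q³-R²)))
          (solve 3 (λ p t e → con (ℤ.+ 1728) :* (p :* t) :- p :* e := p :*
              (con (ℤ.+ 1728) :* t :- e)) P τ Q³-R²))
          where
          swap : ∀ i t → i * (ℤ.+ 1728 * t) ≡ ℤ.+ 1728 * (i * t)
          swap = solve-∀

      open Eisenstein.Discriminant (s 1) (s 3) (s 5) (s 7) (s 9) (s 11) r₁₁ r₁₃ r₁₅ r₃₃ r₃₅ r₃₇ τ 1728τ≈

      open Functional (λ f → f N) (λ e → coeff e N ℕ.≤-refl) (λ _ _ → ≡.refl) (λ _ → ≡.refl)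
          (λ n f → scale n f N)

      n : ℤ
      n = ℤ.+ N

    τ-35 : ℤ.+ 12 * τ N ≡ ℤ.+ 5 * (n * s 3 N) + ℤ.+ 7 * (n * s 5 N)
      + ℤ.+ 840 * (ℤ.+ 2 * (s 3 ⊛ D (s 5)) N - ℤ.+ 3 * (D (s 3) ⊛ s 5) N)
    τ-35 = ev-i (τ N) (n * s 3 N) (n * s 5 N) ((s 3 ⊛ D (s 5)) N)
        ((D (s 3) ⊛ s 5) N) ≡.refl ≡.refl ≡.refl ≡.refl ≡.refl

    τ-33 : τ N ≡ n * (n * s 3 N) + ℤ.+ 60 * (ℤ.+ 4 * (s 3 ⊛ D (D (s 3))) N - ℤ.+ 5 * (D (s 3) ⊛ D (s 3)) N)
    τ-33 = ev-ii (τ N) (n * (n * s 3 N)) ((s 3 ⊛ D (D (s 3))) N)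
        ((D (s 3) ⊛ D (s 3)) N) ≡.refl ≡.refl ≡.refl ≡.refl

    τ-57 : ℤ.+ 9072 * (n * (n * τ N)) ≡
      ℤ.+ 780 * (n * (n * s 11 N)) + ℤ.+ 3455 * (n * s 7 N) + ℤ.+ 4837 * (n * s 5 N)
      - ℤ.+ 580440 * (ℤ.+ 3 * (s 5 ⊛ D (s 7)) N - ℤ.+ 4 * (D (s 5) ⊛ s 7) N)
      - ℤ.+ 9054864 * (D (s 5) ⊛ D (s 5)) N
    τ-57 = ev-iii (n * (n * τ N)) (n * (n * s 11 N)) (n * s 7 N) (n * s 5 N)
      ((s 5 ⊛ D (s 7)) N) ((D (s 5) ⊛ s 7) N) ((D (s 5) ⊛ D (s 5)) N)
      ≡.refl ≡.refl ≡.refl ≡.refl ≡.refl ≡.refl ≡.refl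

    τ-37 : ℤ.+ 10584 * (n * (n * τ N)) ≡
      ℤ.+ 910 * (n * (n * s 11 N)) + ℤ.+ 6219 * (n * (n * s 3 N)) + ℤ.+ 3455 * (n * (n * s 7 N))
      + ℤ.+ 82920 * (ℤ.+ 36 * (D (D (s 3)) ⊛ s 7) N - ℤ.+ 45 * (D (s 3) ⊛ D (s 7)) N + ℤ.+ 10 *
          (s 3 ⊛ D (D (s 7))) N)
      - ℤ.+ 10564008 * (D (s 5) ⊛ D (s 5)) N
    τ-37 = ev-iv (n * (n * τ N)) (n * (n * s 11 N)) (n * (n * s 3 N)) (n * (n * s 7 N))
      ((D (D (s 3)) ⊛ s 7) N) ((D (s 3) ⊛ D (s 7)) N) ((s 3 ⊛ D (D (s 7))) N) ((D (s 5) ⊛ D (s 5)) N)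
      ≡.refl ≡.refl ≡.refl ≡.refl ≡.refl ≡.refl ≡.refl ≡.refl

    τ-39 : ℤ.+ 27216 * (n * (n * τ N)) ≡
      ℤ.+ 2340 * (n * (n * s 11 N)) + ℤ.+ 17275 * (n * s 3 N) + ℤ.+ 7601 * (n * s 9 N)
      - ℤ.+ 912120 * (ℤ.+ 5 * (D (s 3) ⊛ s 9) N - ℤ.+ 2 * (s 3 ⊛ D (s 9)) N)
      - ℤ.+ 27164592 * (D (s 5) ⊛ D (s 5)) N
    τ-39 = ev-v (n * (n * τ N)) (n * (n * s 11 N)) (n * s 3 N) (n * s 9 N)
      ((D (s 3) ⊛ s 9) N) ((s 3 ⊛ D (s 9)) N) ((D (s 5) ⊛ D (s 5)) N)
      ≡.refl ≡.refl ≡.refl ≡.refl ≡.refl ≡.refl ≡.refl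

-- Transfer of integer identities to the rationals

module Rationals where

  open import Data.Rational.Base using (_+_; _*_; _-_; -_; _/_)
  open ≡ using (refl; sym; trans)
  open FiniteSums

  fromℤ-+ : ∀ a b → fromℤ (a ℤ.+ b) ≡ fromℤ a + fromℤ b
  fromℤ-+ a b = ℚ.toℚᵘ-injective (ℚᵘ.≃-sym (ℚᵘ.≃-trans (ℚ.toℚᵘ-homo-+ (fromℤ a) (fromℤ b))
    (*≡* (lemma a b))))
    where
    lemma : ∀ a b → (a ℤ.* 1ℤ ℤ.+ b ℤ.* 1ℤ) ℤ.* 1ℤ ≡ (a ℤ.+ b) ℤ.* 1ℤ
    lemma = solve-∀

  fromℤ-* : ∀ a b → fromℤ (a ℤ.* b) ≡ fromℤ a * fromℤ b
  fromℤ-* a b = ℚ.toℚᵘ-injective (ℚᵘ.≃-sym (ℚᵘ.≃-trans (ℚ.toℚᵘ-homo-* (fromℤ a) (fromℤ b)) (*≡* refl)))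

  fromℤ-neg : ∀ a → fromℤ (ℤ.- a) ≡ - fromℤ a
  fromℤ-neg a = ℚ.toℚᵘ-injective (ℚᵘ.≃-sym (ℚᵘ.≃-trans (ℚ.toℚᵘ-homo‿- (fromℤ a)) (*≡* refl)))

  -- For a variable d the gcd that normalises `1ℤ / d` does not compute; among unnormalised
  -- fractions the claim is a cross multiplication.
  /-inverse : ∀ d .{{_ : ℕ.NonZero d}} → ι d * (1ℤ / d) ≡ 1ℚ
  /-inverse d@(suc d-1) = ℚ.toℚᵘ-injective (ℚᵘ.≃-trans (ℚ.toℚᵘ-homo-* (ι d) (1ℤ / d))
    (ℚᵘ.≃-trans (ℚᵘ.*-congˡ {toℚᵘ (ι d)} (ℚ.toℚᵘ-fromℚᵘ (mkℚᵘ 1ℤ d-1))) (*≡* lemma)))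
    where
    lemma : ℤ.+ d ℤ.* 1ℤ ℤ.* 1ℤ ≡ 1ℤ ℤ.* (1ℤ ℤ.* ℤ.+ d)
    lemma = solve₁ (ℤ.+ d)
      where
      solve₁ : ∀ x → x ℤ.* 1ℤ ℤ.* 1ℤ ≡ 1ℤ ℤ.* (1ℤ ℤ.* x)
      solve₁ = solve-∀

  fromℤ-hom : CommutativeRing.rawRing ℤ.+-*-commutativeRing -Raw-AlmostCommutative⟶ fromCommutativeRing ℚ.+-*-commutativeRing
  fromℤ-hom = record
    { ⟦_⟧ = fromℤ ; +-homo = fromℤ-+ ; *-homo = fromℤ-* ; -‿homo = fromℤ-neg ; 0-homo = refl ; 1-homo = refl }

  infixl 6 _`+_ _`-_
  infixl 7 _`*_

  -- A syntax shared by ℤ and ℚ: `fromℤ` passes through a whole expression at once, and both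
  -- evaluations unfold to the formulas as written.
  data Expr : Set where
    leaf : ℤ → Expr
    _`+_ _`-_ _`*_ : Expr → Expr → Expr

  ⟦_⟧ℤ : Expr → ℤ
  ⟦ leaf a ⟧ℤ  = a
  ⟦ e `+ f ⟧ℤ = ⟦ e ⟧ℤ ℤ.+ ⟦ f ⟧ℤ
  ⟦ e `- f ⟧ℤ = ⟦ e ⟧ℤ ℤ.- ⟦ f ⟧ℤ
  ⟦ e `* f ⟧ℤ = ⟦ e ⟧ℤ ℤ.* ⟦ f ⟧ℤ

  ⟦_⟧ℚ : Expr → ℚ
  ⟦ leaf a ⟧ℚ  = fromℤ a
  ⟦ e `+ f ⟧ℚ = ⟦ e ⟧ℚ + ⟦ f ⟧ℚ
  ⟦ e `- f ⟧ℚ = ⟦ e ⟧ℚ - ⟦ f ⟧ℚ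
  ⟦ e `* f ⟧ℚ = ⟦ e ⟧ℚ * ⟦ f ⟧ℚ

  fromℤ-expr : ∀ e → fromℤ ⟦ e ⟧ℤ ≡ ⟦ e ⟧ℚ
  fromℤ-expr (leaf a) = refl
  fromℤ-expr (e `+ f) = trans (fromℤ-+ ⟦ e ⟧ℤ ⟦ f ⟧ℤ) (cong₂ _+_ (fromℤ-expr e) (fromℤ-expr f))
  fromℤ-expr (e `- f) = trans (fromℤ-+ ⟦ e ⟧ℤ (ℤ.- ⟦ f ⟧ℤ))
    (cong₂ _+_ (fromℤ-expr e) (trans (fromℤ-neg ⟦ f ⟧ℤ) (cong -_ (fromℤ-expr f))))
  fromℤ-expr (e `* f) = trans (fromℤ-* ⟦ e ⟧ℤ ⟦ f ⟧ℤ) (cong₂ _*_ (fromℤ-expr e) (fromℤ-expr f))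

  fromℤ-∑ : ∀ n (e : ℕ → Expr) → fromℤ (∑ n (λ i → ⟦ e i ⟧ℤ)) ≡ foldr _+_ 0ℚ (applyUpTo (λ i → ⟦ e i ⟧ℚ) n)
  fromℤ-∑ zero    e = refl
  fromℤ-∑ (suc n) e = trans (fromℤ-+ ⟦ e 0 ⟧ℤ _) (cong₂ _+_ (fromℤ-expr (e 0)) (fromℤ-∑ n (λ i → e (suc i))))

-- Solving for τ with inverses as formal variables

module Isolation {c ℓ} (𝓡 : CommutativeRing c ℓ)
  (hom : CommutativeRing.rawRing ℤ.+-*-commutativeRing -Raw-AlmostCommutative⟶ fromCommutativeRing 𝓡)
  where

  open CommutativeRing 𝓡
  open _-Raw-AlmostCommutative⟶_ hom renaming (⟦_⟧ to κ)
  open IntegerCoefficients 𝓡 hom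

  -- `w` plays 1/12. Constraining it by an equation keeps the claim polynomial, and 12 w = 1 turns
  -- 840 w S into 70 S.
  isolate-i : ∀ n t a b S w → κ (ℤ.+ 12) * t ≈ κ (ℤ.+ 5) * (n * a) + κ (ℤ.+ 7) * (n * b) + κ
      (ℤ.+ 840) * S → κ (ℤ.+ 12) * w ≈ κ 1ℤ →
    t ≈ κ (ℤ.+ 5) * w * n * a + κ (ℤ.+ 7) * w * n * b + κ (ℤ.+ 70) * S
  isolate-i n t a b S w eq wK = trans
    (solve 6 (λ n t a b S w → t := con (ℤ.+ 5) :* w :* n :* a :+ con (ℤ.+ 7) :* w :* n :* b :+ con (ℤ.+ 70) :* S
       :+ w :* (con (ℤ.+ 12) :* t :- (con (ℤ.+ 5) :* (n :* a) :+ con (ℤ.+ 7) :* (n :* b) :+ con (ℤ.+ 840) :* S))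
       :+ (con (ℤ.+ 70) :* S :- t) :* (con (ℤ.+ 12) :* w :- con 1ℤ)) n t a b S w)
    (trans (drop wK _) (drop eq _))

  -- In use, w = 1/K, y = 1/n and z = 1/n².
  isolate-odd : ∀ n t a b c S S′ y z w K k₁ k₂ k₃ k₄ k₅ →
    K * (n * (n * t)) ≈ k₁ * (n * (n * a)) + k₂ * (n * b) + k₃ * (n * c) - k₄ * S - k₅ * S′ →
    K * w ≈ κ 1ℤ → n * n * z ≈ κ 1ℤ → n * y ≈ κ 1ℤ →
    t ≈ k₁ * w * a + k₂ * w * y * b + k₃ * w * y * c - k₄ * w * z * S - k₅ * w * z * S′
  isolate-odd n t a b c S S′ y z w K k₁ k₂ k₃ k₄ k₅ eq wK zn yn = trans
    (solve 16 (λ n t a b c S S′ y z w K k₁ k₂ k₃ k₄ k₅ → let β = k₂ :* w :* b :+ k₃ :* w :* c in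
       t := k₁ :* w :* a :+ k₂ :* w :* y :* b :+ k₃ :* w :* y :* c :- k₄ :* w :* z :* S :- k₅ :* w :* z :* S′
       :+ w :* z :* (K :* (n :* (n :* t)) :- (k₁ :* (n :* (n :* a)) :+ k₂ :* (n :* b) :+ k₃ :*
           (n :* c) :- k₄ :* S :- k₅ :* S′))
       :+ (:- t) :* (K :* w :- con 1ℤ)
       :+ (k₁ :* w :* a :+ β :* y :- K :* w :* t) :* (n :* n :* z :- con 1ℤ)
       :+ (:- (n :* z :* β)) :* (n :* y :- con 1ℤ)) n t a b c S S′ y z w K k₁ k₂ k₃ k₄ k₅)
    (trans (drop yn _) (trans (drop zn _) (trans (drop wK _) (drop eq _))))

  isolate-even : ∀ n t a b c S S′ z w K k₁ k₂ k₃ k₄ k₅ →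
    K * (n * (n * t)) ≈ k₁ * (n * (n * a)) + k₂ * (n * (n * b)) + k₃ * (n * (n * c)) + k₄ * S - k₅ * S′ →
    K * w ≈ κ 1ℤ → n * n * z ≈ κ 1ℤ →
    t ≈ k₁ * w * a + k₂ * w * b + k₃ * w * c + k₄ * w * z * S - k₅ * w * z * S′
  isolate-even n t a b c S S′ z w K k₁ k₂ k₃ k₄ k₅ eq wK zn = trans
    (solve 15 (λ n t a b c S S′ z w K k₁ k₂ k₃ k₄ k₅ →
       t := k₁ :* w :* a :+ k₂ :* w :* b :+ k₃ :* w :* c :+ k₄ :* w :* z :* S :- k₅ :* w :* z :* S′
       :+ w :* z :* (K :* (n :* (n :* t)) :- (k₁ :* (n :* (n :* a)) :+ k₂ :* (n :* (n :* b)) :+ k₃ :*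
           (n :* (n :* c)) :+ k₄ :* S :- k₅ :* S′))
       :+ (:- t) :* (K :* w :- con 1ℤ)
       :+ (w :* (k₁ :* a :+ k₂ :* b :+ k₃ :* c) :- K :* w :* t) :*
           (n :* n :* z :- con 1ℤ)) n t a b c S S′ z w K k₁ k₂ k₃ k₄ k₅)
    (trans (drop zn _) (trans (drop wK _) (drop eq _)))

-- Rational form of the identities and their convolution sums

module Assembly where

  open import Data.Integer.Base using (+_)
  open import Data.Nat.Base using (_^_)
  open import Data.Rational.Base using (_+_; _*_; _-_; _/_)
  open ≡ using (refl; sym; trans; subst)
  open FiniteSums
  open PowerSeries
  open DivisorSums
  open Rationals

  open Isolation ℚ.+-*-commutativeRing fromℤ-hom using (isolate-i; isolate-odd; isolate-even)

  rational-i : ∀ n t a b B → + 12 ℤ.* t ≡ + 5 ℤ.* (n ℤ.* a) ℤ.+ + 7 ℤ.* (n ℤ.* b) ℤ.+ + 840 ℤ.* B →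
    ∀ S → fromℤ B ≡ S →
    fromℤ t ≡ (+ 5 / 12) * fromℤ n * fromℤ a + (+ 7 / 12) * fromℤ n * fromℤ b + ι 70 * S
  rational-i n t a b B eq S refl = isolate-i (fromℤ n) (fromℤ t) (fromℤ a) (fromℤ b) (fromℤ B) (1ℤ / 12)
    (trans (sym (fromℤ-expr (leaf (+ 12) `* leaf t))) (trans (cong fromℤ eq)
      (fromℤ-expr (leaf (+ 5) `* (leaf n `* leaf a) `+ leaf (+ 7) `* (leaf n `* leaf b) `+ leaf
          (+ 840) `* leaf B))))
    (/-inverse 12)

  rational-ii : ∀ n n² t a B → n² ≡ n ℤ.* n → t ≡ n ℤ.* (n ℤ.* a) ℤ.+ + 60 ℤ.* B →
    ∀ S → fromℤ B ≡ S → fromℤ t ≡ fromℤ n² * fromℤ a + ι 60 * S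
  rational-ii n _ t a B refl eq S refl = trans
      (cong fromℤ (trans eq (cong (ℤ._+ + 60 ℤ.* B) (sym (ℤ.*-assoc n n a)))))
    (fromℤ-expr (leaf (n ℤ.* n) `* leaf a `+ leaf (+ 60) `* leaf B))

  -- The stated coefficients enter as variables c with c = k / K, so that their reduction to lowest
  -- terms is a closed computation, apart from the argument for variable n.
  rational-odd : ∀ K k₁ k₂ k₃ k₄ k₅ n t a b c B C →
    K ℤ.* (n ℤ.* (n ℤ.* t)) ≡ k₁ ℤ.* (n ℤ.* (n ℤ.* a)) ℤ.+ k₂ ℤ.* (n ℤ.* b) ℤ.+ k₃ ℤ.*
        (n ℤ.* c) ℤ.- k₄ ℤ.* B ℤ.- k₅ ℤ.* C →
    ∀ w y z S S′ c₁ c₂ c₃ c₄ c₅ → fromℤ K * w ≡ 1ℚ → fromℤ n * fromℤ n * z ≡ 1ℚ → fromℤ n * y ≡ 1ℚ → fromℤ B ≡ S → fromℤ C ≡ S′ →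
    c₁ ≡ fromℤ k₁ * w → c₂ ≡ fromℤ k₂ * w → c₃ ≡ fromℤ k₃ * w → c₄ ≡ fromℤ k₄ * w → c₅ ≡ fromℤ k₅ * w →
    fromℤ t ≡ c₁ * fromℤ a + c₂ * y * fromℤ b + c₃ * y * fromℤ c - c₄ * z * S - c₅ * z * S′
  rational-odd K k₁ k₂ k₃ k₄ k₅ n t a b c B C eq w y z _ _ _ _ _ _ _ wK zn yn refl refl refl refl refl refl refl =
    isolate-odd (fromℤ n) (fromℤ t) (fromℤ a) (fromℤ b) (fromℤ c) (fromℤ B) (fromℤ C) y z w
      (fromℤ K) (fromℤ k₁) (fromℤ k₂) (fromℤ k₃) (fromℤ k₄) (fromℤ k₅)
      (trans (sym (fromℤ-expr (leaf K `* (leaf n `* (leaf n `* leaf t))))) (trans (cong fromℤ eq)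
        (fromℤ-expr (leaf k₁ `* (leaf n `* (leaf n `* leaf a)) `+ leaf k₂ `* (leaf n `* leaf b) `+ leaf k₃ `*
            (leaf n `* leaf c)
          `- leaf k₄ `* leaf B `- leaf k₅ `* leaf C))))
      wK zn yn

  rational-even : ∀ K k₁ k₂ k₃ k₄ k₅ n t a b c B C →
    K ℤ.* (n ℤ.* (n ℤ.* t)) ≡ k₁ ℤ.* (n ℤ.* (n ℤ.* a)) ℤ.+ k₂ ℤ.* (n ℤ.* (n ℤ.* b)) ℤ.+ k₃ ℤ.*
        (n ℤ.* (n ℤ.* c)) ℤ.+ k₄ ℤ.* B ℤ.- k₅ ℤ.* C →
    ∀ w z S S′ c₁ c₂ c₃ c₄ c₅ → fromℤ K * w ≡ 1ℚ → fromℤ n * fromℤ n * z ≡ 1ℚ → fromℤ B ≡ S → fromℤ C ≡ S′ →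
    c₁ ≡ fromℤ k₁ * w → c₂ ≡ fromℤ k₂ * w → c₃ ≡ fromℤ k₃ * w → c₄ ≡ fromℤ k₄ * w → c₅ ≡ fromℤ k₅ * w →
    fromℤ t ≡ c₁ * fromℤ a + c₂ * fromℤ b + c₃ * fromℤ c + c₄ * z * S - c₅ * z * S′
  rational-even K k₁ k₂ k₃ k₄ k₅ n t a b c B C eq w z _ _ _ _ _ _ _ wK zn refl refl refl refl refl refl refl =
    isolate-even (fromℤ n) (fromℤ t) (fromℤ a) (fromℤ b) (fromℤ c) (fromℤ B) (fromℤ C) z w
      (fromℤ K) (fromℤ k₁) (fromℤ k₂) (fromℤ k₃) (fromℤ k₄) (fromℤ k₅)
      (trans (sym (fromℤ-expr (leaf K `* (leaf n `* (leaf n `* leaf t))))) (trans (cong fromℤ eq)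
        (fromℤ-expr (leaf k₁ `* (leaf n `* (leaf n `* leaf a)) `+ leaf k₂ `*
            (leaf n `* (leaf n `* leaf b)) `+ leaf k₃ `* (leaf n `* (leaf n `* leaf c))
          `+ leaf k₄ `* leaf B `- leaf k₅ `* leaf C))))
      wK zn

  -- Without constant terms both end terms vanish, which leaves the range 1 ≤ m < n + 1 with m = i +
  -- 1.
  ⊛-inner : ∀ f g n → f 0 ≡ 0ℤ → g 0 ≡ 0ℤ → (f ⊛ g) (suc n) ≡ ∑ n (λ i → f (suc i) ℤ.* g (n ∸ i))
  ⊛-inner f g n f₀ g₀ = trans
    (cong₂ ℤ._+_ (trans (cong (ℤ._* g (suc n)) f₀) (ℤ.*-zeroˡ (g (suc n))))
      (∑-last-zero n (λ i → f (suc i) ℤ.* g (n ∸ i)) (trans (cong (λ i → f (suc n) ℤ.* g i) (ℕ.n∸n≡0 n))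
        (trans (cong (f (suc n) ℤ.*_) g₀) (ℤ.*-zeroʳ (f (suc n)))))))
    (ℤ.+-identityˡ (∑ n (λ i → f (suc i) ℤ.* g (n ∸ i))))

  cast-∸ : ∀ {n i} → i ℕ.< n → + (n ∸ i) ≡ + suc n ℤ.- + suc i
  cast-∸ {n} {i} i<n = sym (trans (ℤ.m-n≡m⊖n (suc n) (suc i)) (ℤ.⊖-≥ (ℕ.s≤s (ℕ.<⇒≤ i<n))))

  ∑-combine : ∀ n a b x y → a ℤ.* ∑ n x ℤ.- b ℤ.* ∑ n y ≡ ∑ n (λ i → a ℤ.* x i ℤ.- b ℤ.* y i)
  ∑-combine n a b x y = trans (cong (ℤ._+_ (a ℤ.* ∑ n x)) (ℤ.neg-distribˡ-* b (∑ n y)))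
    (trans (cong₂ ℤ._+_ (sym (∑-distribˡ-* n a x)) (sym (∑-distribˡ-* n (ℤ.- b) y)))
      (trans (sym (∑-distrib-+ n (λ i → a ℤ.* x i) (λ i → ℤ.- b ℤ.* y i)))
        (∑-cong n λ i → cong (ℤ._+_ (a ℤ.* x i)) (sym (ℤ.neg-distribˡ-* b (y i))))))

  square : ∀ m → + (m ^ 2) ≡ + m ℤ.* + m
  square m = trans (cong (λ k → + (m ℕ.* k)) (ℕ.*-identityʳ m)) (ℤ.pos-* m m)

  module ConvolutionSums (n : ℕ) where

    private
      N : ℤ
      N = + suc n

      σ-∗ : ℕ → ℕ → ℕ → Expr → Expr
      σ-∗ j k i e = e `* leaf (s j (suc i)) `* leaf (s k (n ∸ i))

      lit : ℕ → Expr
      lit a = leaf (+ a)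

      -- The explicit motive restricts the rewriting to the weights produced by `D`; the index n ∸ i
      -- inside the divisor sum stays as it is.
      with-l : ∀ {i} → i ℕ.< n → (P : ℤ → Set) → P (N ℤ.- + suc i) → P (+ (n ∸ i))
      with-l i<n P = subst P (sym (cast-∸ i<n))

    summand-35 summand-33 summand-57 summand-37 summand-39 summand-55 : ℕ → Expr
    summand-35 i = σ-∗ 3 5 i (lit 2 `* leaf N `- lit 5 `* lit (suc i))
    summand-33 i = σ-∗ 3 3 i (lit 4 `* lit (suc n ^ 2) `- lit 13 `* lit (suc i) `* leaf N `+ lit 9 `* lit
        (suc i ^ 2))
    summand-57 i = σ-∗ 5 7 i (lit 3 `* leaf N `- lit 7 `* lit (suc i))
    summand-37 i = σ-∗ 3 7 i (lit 91 `* lit (suc i ^ 2) `- lit 65 `* lit (suc i) `* leaf N `+ lit 10 `* lit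
        (suc n ^ 2))
    summand-39 i = σ-∗ 3 9 i (lit 7 `* lit (suc i) `- lit 2 `* leaf N)
    summand-55 i = σ-∗ 5 5 i (lit (suc i) `* lit (n ∸ i))

    -- `D` on the second factor contributes N - m, so the kernel is 2 (N - m) - 3 m = 2 N - 5 m. The
    -- other kernels arise alike, for instance 4 (N - m)² - 5 m (N - m) = 4 N² - 13 m N + 9 m².
    bracket-35 : + 2 ℤ.* (s 3 ⊛ D (s 5)) (suc n) ℤ.- + 3 ℤ.* (D (s 3) ⊛ s 5) (suc n) ≡ ∑ n
        (λ i → ⟦ summand-35 i ⟧ℤ)
    bracket-35 = trans (cong₂ (λ x y → + 2 ℤ.* x ℤ.- + 3 ℤ.* y) (⊛-inner (s 3) (D (s 5)) n refl refl)
        (⊛-inner (D (s 3)) (s 5) n refl refl))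
      (trans (∑-combine n (+ 2) (+ 3) (λ i → s 3 (suc i) ℤ.* D (s 5) (n ∸ i))
          (λ i → D (s 3) (suc i) ℤ.* s 5 (n ∸ i)))
        (∑-cong-< n λ i i<n → with-l i<n
          (λ l → + 2 ℤ.* (s 3 (suc i) ℤ.* (l ℤ.* s 5 (n ∸ i))) ℤ.- + 3 ℤ.*
              (+ suc i ℤ.* s 3 (suc i) ℤ.* s 5 (n ∸ i)) ≡ ⟦ summand-35 i ⟧ℤ)
          (shape N (+ suc i) (s 3 (suc i)) (s 5 (n ∸ i)))))
      where
      shape : ∀ N m F G → + 2 ℤ.* (F ℤ.* ((N ℤ.- m) ℤ.* G)) ℤ.- + 3 ℤ.* (m ℤ.* F ℤ.* G) ≡
          (+ 2 ℤ.* N ℤ.- + 5 ℤ.* m) ℤ.* F ℤ.* G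
      shape = solve-∀

    bracket-33 : + 4 ℤ.* (s 3 ⊛ D (D (s 3))) (suc n) ℤ.- + 5 ℤ.* (D (s 3) ⊛ D (s 3)) (suc n) ≡ ∑ n
        (λ i → ⟦ summand-33 i ⟧ℤ)
    bracket-33 = trans (cong₂ (λ x y → + 4 ℤ.* x ℤ.- + 5 ℤ.* y) (⊛-inner (s 3) (D (D (s 3))) n refl refl)
        (⊛-inner (D (s 3)) (D (s 3)) n refl refl))
      (trans (∑-combine n (+ 4) (+ 5) (λ i → s 3 (suc i) ℤ.* D (D (s 3)) (n ∸ i))
          (λ i → D (s 3) (suc i) ℤ.* D (s 3) (n ∸ i)))
        (∑-cong-< n λ i i<n → trans (with-l i<n
          (λ l → + 4 ℤ.* (s 3 (suc i) ℤ.* (l ℤ.* (l ℤ.* s 3 (n ∸ i)))) ℤ.- + 5 ℤ.*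
              (+ suc i ℤ.* s 3 (suc i) ℤ.* (l ℤ.* s 3 (n ∸ i)))
            ≡ (+ 4 ℤ.* (N ℤ.* N) ℤ.- + 13 ℤ.* + suc i ℤ.* N ℤ.+ + 9 ℤ.* (+ suc i ℤ.* + suc i)) ℤ.* s 3
                (suc i) ℤ.* s 3 (n ∸ i))
          (shape N (+ suc i) (s 3 (suc i)) (s 3 (n ∸ i))))
          (cong₂ (λ x y → (+ 4 ℤ.* x ℤ.- + 13 ℤ.* + suc i ℤ.* N ℤ.+ + 9 ℤ.* y) ℤ.* s 3 (suc i) ℤ.* s 3 (n ∸ i))
            (sym (square (suc n))) (sym (square (suc i))))))
      where
      shape : ∀ N m F G → + 4 ℤ.* (F ℤ.* ((N ℤ.- m) ℤ.* ((N ℤ.- m) ℤ.* G))) ℤ.- + 5 ℤ.*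
          (m ℤ.* F ℤ.* ((N ℤ.- m) ℤ.* G)) ≡
        (+ 4 ℤ.* (N ℤ.* N) ℤ.- + 13 ℤ.* m ℤ.* N ℤ.+ + 9 ℤ.* (m ℤ.* m)) ℤ.* F ℤ.* G
      shape = solve-∀

    bracket-57 : + 3 ℤ.* (s 5 ⊛ D (s 7)) (suc n) ℤ.- + 4 ℤ.* (D (s 5) ⊛ s 7) (suc n) ≡ ∑ n
        (λ i → ⟦ summand-57 i ⟧ℤ)
    bracket-57 = trans (cong₂ (λ x y → + 3 ℤ.* x ℤ.- + 4 ℤ.* y) (⊛-inner (s 5) (D (s 7)) n refl refl)
        (⊛-inner (D (s 5)) (s 7) n refl refl))
      (trans (∑-combine n (+ 3) (+ 4) (λ i → s 5 (suc i) ℤ.* D (s 7) (n ∸ i))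
          (λ i → D (s 5) (suc i) ℤ.* s 7 (n ∸ i)))
        (∑-cong-< n λ i i<n → with-l i<n
          (λ l → + 3 ℤ.* (s 5 (suc i) ℤ.* (l ℤ.* s 7 (n ∸ i))) ℤ.- + 4 ℤ.*
              (+ suc i ℤ.* s 5 (suc i) ℤ.* s 7 (n ∸ i)) ≡ ⟦ summand-57 i ⟧ℤ)
          (shape N (+ suc i) (s 5 (suc i)) (s 7 (n ∸ i)))))
      where
      shape : ∀ N m F G → + 3 ℤ.* (F ℤ.* ((N ℤ.- m) ℤ.* G)) ℤ.- + 4 ℤ.* (m ℤ.* F ℤ.* G) ≡
          (+ 3 ℤ.* N ℤ.- + 7 ℤ.* m) ℤ.* F ℤ.* G
      shape = solve-∀

    bracket-37 : + 36 ℤ.* (D (D (s 3)) ⊛ s 7) (suc n) ℤ.- + 45 ℤ.* (D (s 3) ⊛ D (s 7)) (suc n) ℤ.+ + 10 ℤ.*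
        (s 3 ⊛ D (D (s 7))) (suc n)
      ≡ ∑ n (λ i → ⟦ summand-37 i ⟧ℤ)
    bracket-37 = trans (cong₂ ℤ._+_
        (trans (cong₂ (λ x y → + 36 ℤ.* x ℤ.- + 45 ℤ.* y) (⊛-inner (D (D (s 3))) (s 7) n refl refl)
            (⊛-inner (D (s 3)) (D (s 7)) n refl refl))
          (∑-combine n (+ 36) (+ 45) (λ i → D (D (s 3)) (suc i) ℤ.* s 7 (n ∸ i))
              (λ i → D (s 3) (suc i) ℤ.* D (s 7) (n ∸ i))))
        (trans (cong (ℤ._*_ (+ 10)) (⊛-inner (s 3) (D (D (s 7))) n refl refl))
            (sym (∑-distribˡ-* n (+ 10) (λ i → s 3 (suc i) ℤ.* D (D (s 7)) (n ∸ i))))))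
      (trans (sym (∑-distrib-+ n (λ i → + 36 ℤ.* (D (D (s 3)) (suc i) ℤ.* s 7 (n ∸ i)) ℤ.- + 45 ℤ.*
          (D (s 3) (suc i) ℤ.* D (s 7) (n ∸ i))) (λ i → + 10 ℤ.* (s 3 (suc i) ℤ.* D (D (s 7)) (n ∸ i)))))
        (∑-cong-< n λ i i<n → trans (with-l i<n
          (λ l → + 36 ℤ.* (+ suc i ℤ.* (+ suc i ℤ.* s 3 (suc i)) ℤ.* s 7 (n ∸ i)) ℤ.- + 45 ℤ.*
              (+ suc i ℤ.* s 3 (suc i) ℤ.* (l ℤ.* s 7 (n ∸ i)))
              ℤ.+ + 10 ℤ.* (s 3 (suc i) ℤ.* (l ℤ.* (l ℤ.* s 7 (n ∸ i))))
            ≡ (+ 91 ℤ.* (+ suc i ℤ.* + suc i) ℤ.- + 65 ℤ.* + suc i ℤ.* N ℤ.+ + 10 ℤ.* (N ℤ.* N)) ℤ.* s 3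
                (suc i) ℤ.* s 7 (n ∸ i))
          (shape N (+ suc i) (s 3 (suc i)) (s 7 (n ∸ i))))
          (cong₂ (λ x y → (+ 91 ℤ.* x ℤ.- + 65 ℤ.* + suc i ℤ.* N ℤ.+ + 10 ℤ.* y) ℤ.* s 3 (suc i) ℤ.* s 7
              (n ∸ i))
            (sym (square (suc i))) (sym (square (suc n))))))
      where
      shape : ∀ N m F G → + 36 ℤ.* (m ℤ.* (m ℤ.* F) ℤ.* G) ℤ.- + 45 ℤ.*
          (m ℤ.* F ℤ.* ((N ℤ.- m) ℤ.* G)) ℤ.+ + 10 ℤ.* (F ℤ.* ((N ℤ.- m) ℤ.* ((N ℤ.- m) ℤ.* G))) ≡
        (+ 91 ℤ.* (m ℤ.* m) ℤ.- + 65 ℤ.* m ℤ.* N ℤ.+ + 10 ℤ.* (N ℤ.* N)) ℤ.* F ℤ.* G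
      shape = solve-∀

    bracket-39 : + 5 ℤ.* (D (s 3) ⊛ s 9) (suc n) ℤ.- + 2 ℤ.* (s 3 ⊛ D (s 9)) (suc n) ≡ ∑ n
        (λ i → ⟦ summand-39 i ⟧ℤ)
    bracket-39 = trans (cong₂ (λ x y → + 5 ℤ.* x ℤ.- + 2 ℤ.* y) (⊛-inner (D (s 3)) (s 9) n refl refl)
        (⊛-inner (s 3) (D (s 9)) n refl refl))
      (trans (∑-combine n (+ 5) (+ 2) (λ i → D (s 3) (suc i) ℤ.* s 9 (n ∸ i))
          (λ i → s 3 (suc i) ℤ.* D (s 9) (n ∸ i)))
        (∑-cong-< n λ i i<n → with-l i<n
          (λ l → + 5 ℤ.* (+ suc i ℤ.* s 3 (suc i) ℤ.* s 9 (n ∸ i)) ℤ.- + 2 ℤ.*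
              (s 3 (suc i) ℤ.* (l ℤ.* s 9 (n ∸ i))) ≡ ⟦ summand-39 i ⟧ℤ)
          (shape N (+ suc i) (s 3 (suc i)) (s 9 (n ∸ i)))))
      where
      shape : ∀ N m F G → + 5 ℤ.* (m ℤ.* F ℤ.* G) ℤ.- + 2 ℤ.* (F ℤ.* ((N ℤ.- m) ℤ.* G)) ≡
          (+ 7 ℤ.* m ℤ.- + 2 ℤ.* N) ℤ.* F ℤ.* G
      shape = solve-∀

    product-55 : (D (s 5) ⊛ D (s 5)) (suc n) ≡ ∑ n (λ i → ⟦ summand-55 i ⟧ℤ)
    product-55 = trans (⊛-inner (D (s 5)) (D (s 5)) n refl refl)
      (∑-cong n λ i → shape (+ suc i) (+ (n ∸ i)) (s 5 (suc i)) (s 5 (n ∸ i)))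
      where
      shape : ∀ m l F G → m ℤ.* F ℤ.* (l ℤ.* G) ≡ m ℤ.* l ℤ.* F ℤ.* G
      shape = solve-∀

open import Data.Integer.Base using (+_)
open import Data.Nat.Base as ℕ using (ℕ; NonZero; _∸_; _^_)
open import Data.Nat.Properties using (m^n≢0)
open import Data.Product.Base using (_×_)
open import Data.Rational.Base using (ℚ; _+_; _*_; _-_; _/_)
open import Data.Rational.Literals using (fromℤ)
open import Relation.Binary.PropositionalEquality using (_≡_)

open ≡ using (refl; sym; trans)
open FiniteSums
open DivisorSums using (s)
open TauCoefficients
open Rationals
open Assembly

theorem2p6 : (n : ℕ) .{{_ : NonZero n}} →
  let instance n²≢0 : NonZero (n ^ 2)
               n²≢0 = m^n≢0 n 2
  in
  ( fromℤ (τ n) ≡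
      (+ 5 / 12) * ι n * ι (σ 3 n) + (+ 7 / 12) * ι n * ι (σ 5 n)
      + ι 70 * ∑[1≤ m < n ] ((ι 2 * ι n - ι 5 * ι m) * ι (σ 3 m) * ι (σ 5 (n ∸ m))) )
  ×
  ( fromℤ (τ n) ≡
      ι (n ^ 2) * ι (σ 3 n)
      + ι 60 * ∑[1≤ m < n ] ((ι 4 * ι (n ^ 2) - ι 13 * ι m * ι n + ι 9 * ι (m ^ 2)) * ι (σ 3 m) * ι (σ 3 (n ∸ m))) )
  ×
  ( fromℤ (τ n) ≡
      (+ 65 / 756) * ι (σ 11 n)
      + (+ (5 ℕ.* 691) / (12 ℕ.* 756)) ÷ℕ n * ι (σ 7 n)
      + (+ 691 / (12 ℕ.* 108)) ÷ℕ n * ι (σ 5 n)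
      - (+ (5 ℕ.* 691) / 54) ÷ℕ (n ^ 2) * ∑[1≤ m < n ] ((ι 3 * ι n - ι 7 * ι m) * ι (σ 5 m) * ι (σ 7 (n ∸ m)))
      - (+ (13 ℕ.* 691) / 9) ÷ℕ (n ^ 2) * ∑[1≤ m < n ] (ι m * ι (n ∸ m) * ι (σ 5 m) * ι (σ 5 (n ∸ m))) )
  ×
  ( fromℤ (τ n) ≡
      (+ 65 / 756) * ι (σ 11 n)
      + (+ (3 ℕ.* 691) / (8 ℕ.* 441)) * ι (σ 3 n)
      + (+ (5 ℕ.* 691) / (24 ℕ.* 441)) * ι (σ 7 n)
      + (+ (5 ℕ.* 691) / 441) ÷ℕ (n ^ 2) * ∑[1≤ m < n ] ((ι 91 * ι (m ^ 2) - ι 65 * ι m * ι n + ι 10 * ι (n ^ 2)) * ι (σ 3 m) * ι (σ 7 (n ∸ m)))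
      - (+ (13 ℕ.* 691) / 9) ÷ℕ (n ^ 2) * ∑[1≤ m < n ] (ι m * ι (n ∸ m) * ι (σ 5 m) * ι (σ 5 (n ∸ m))) )
  ×
  ( fromℤ (τ n) ≡
      (+ 65 / 756) * ι (σ 11 n)
      + (+ (25 ℕ.* 691) / (36 ℕ.* 756)) ÷ℕ n * ι (σ 3 n)
      + (+ (11 ℕ.* 691) / (36 ℕ.* 756)) ÷ℕ n * ι (σ 9 n)
      - (+ (55 ℕ.* 691) / 1134) ÷ℕ (n ^ 2) * ∑[1≤ m < n ] ((ι 7 * ι m - ι 2 * ι n) * ι (σ 3 m) * ι (σ 9 (n ∸ m)))
      - (+ (13 ℕ.* 691) / 9) ÷ℕ (n ^ 2) * ∑[1≤ m < n ] (ι m * ι (n ∸ m) * ι (σ 5 m) * ι (σ 5 (n ∸ m))) )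
theorem2p6 (suc m) =
  rational-i n (τ N) (s 3 N) (s 5 N) (∑ m (λ i → ⟦ summand-35 i ⟧ℤ))
    (trans τ-35 (cong (λ B → + 5 ℤ.* (n ℤ.* s 3 N) ℤ.+ + 7 ℤ.* (n ℤ.* s 5 N) ℤ.+ + 840 ℤ.* B) bracket-35))
    _ (fromℤ-∑ m summand-35) ,
  rational-ii n (+ (N ^ 2)) (τ N) (s 3 N) (∑ m (λ i → ⟦ summand-33 i ⟧ℤ)) (square N)
    (trans τ-33 (cong (λ B → n ℤ.* (n ℤ.* s 3 N) ℤ.+ + 60 ℤ.* B) bracket-33))
    _ (fromℤ-∑ m summand-33) ,
  rational-odd (+ 9072) (+ 780) (+ 3455) (+ 4837) (+ 580440) (+ 9054864) n (τ N) (s 11 N) (s 7 N) (s 5 N) _ _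
    τ-57 (1ℤ / 9072) (1ℤ / N) (1ℤ / N ^ 2) _ _
    (+ 65 / 756) (+ (5 ℕ.* 691) / (12 ℕ.* 756)) (+ 691 / (12 ℕ.* 108)) (+ (5 ℕ.* 691) / 54) (+ (13 ℕ.* 691) / 9)
    (/-inverse 9072) n²-inverse (/-inverse N) (trans (cong fromℤ bracket-57) (fromℤ-∑ m summand-57)) S₅₅
    -- Reductions of closed fractions: 780, 5 · 691, 7 · 691, 840 · 691 and 12 · 691 · 1092, each
    -- over 9072 = 12 · 756.
    refl refl refl refl refl ,
  rational-even (+ 10584) (+ 910) (+ 6219) (+ 3455) (+ 82920) (+ 10564008) n (τ N) (s 11 N) (s 3 N) (s 7 N) _ _
    τ-37 (1ℤ / 10584) (1ℤ / N ^ 2) _ _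
    (+ 65 / 756) (+ (3 ℕ.* 691) / (8 ℕ.* 441)) (+ (5 ℕ.* 691) / (24 ℕ.* 441)) (+ (5 ℕ.* 691) / 441)
        (+ (13 ℕ.* 691) / 9)
    (/-inverse 10584) n²-inverse (trans (cong fromℤ bracket-37) (fromℤ-∑ m summand-37)) S₅₅
    refl refl refl refl refl ,
  rational-odd (+ 27216) (+ 2340) (+ 17275) (+ 7601) (+ 912120) (+ 27164592) n (τ N) (s 11 N) (s 3 N)
      (s 9 N) _ _
    τ-39 (1ℤ / 27216) (1ℤ / N) (1ℤ / N ^ 2) _ _
    (+ 65 / 756) (+ (25 ℕ.* 691) / (36 ℕ.* 756)) (+ (11 ℕ.* 691) / (36 ℕ.* 756)) (+ (55 ℕ.* 691) / 1134)
        (+ (13 ℕ.* 691) / 9)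
    (/-inverse 27216) n²-inverse (/-inverse N) (trans (cong fromℤ bracket-39) (fromℤ-∑ m summand-39)) S₅₅
    refl refl refl refl refl
  where
  N = suc m
  n = + N
  open ConvolutionSums m
  open Coefficients N

  instance
    N²≢0 : NonZero (N ^ 2)
    N²≢0 = m^n≢0 N 2

  n²-inverse : fromℤ n * fromℤ n * (1ℤ / N ^ 2) ≡ 1ℚ
  n²-inverse = trans (cong (_* (1ℤ / N ^ 2)) (trans (sym (fromℤ-* n n)) (cong fromℤ (sym (square N)))))
      (/-inverse (N ^ 2))

  S₅₅ = trans (cong fromℤ product-55) (fromℤ-∑ m summand-55)
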